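{- The class of $(2P_2,\overline{P_2+P_3})$-free atoms has bounded clique-width, whereas the class of all $(2P_2,\overline{P_2+P_3})$-free graphs has unbounded clique-width.
   Context: Graphs are finite, simple and undirected. A graph $G$ is $(H_1,\dots,H_p)$-free if it contains none of $H_1,\dots,H_p$ as an induced subgraph. A clique $K\subseteq V(G)$ (possibly empty) is a clique cut-set of $G$ if $G\setminus K$ is disconnected; an atom is a graph with no clique cut-set (so atoms are connected). $P_t$ is the path on $t$ vertices, $G_1+G_2$ is the disjoint union of vertex-disjoint graphs, $rG$ is the disjoint union of $r$ copies of $G$, and $\overline{G}$ is the complement of $G$. The clique-width $\mathrm{cw}(G)$ is the minimum number of labels needed to construct $G$ using four operations: create a new graph consisting of a single vertex with label $i$; take the disjoint union of two labelled graphs; add an edge between every vertex with label $i$ and every vertex with label $j$ ($i\ne j$); relabel every vertex with label $i$ to have label $j$. A class of graphs has bounded clique-width if there is a constant $c$ with $\mathrm{cw}(G)\le c$ for every $G$ in the class; otherwise its clique-width is unbounded. -}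

module Defs where

open import Data.Bool.Base using (if_then_else_)
open import Data.Fin.Base using (Fin; toℕ; splitAt)
open import Data.Fin.Properties using () renaming (_≟_ to _≟ᶠ_)
open import Data.Fin.Subset using (Subset; _∈_; _∉_)
open import Data.List.Base using (List)
open import Data.List.Relation.Unary.All using (All)
open import Data.Nat.Base using (ℕ; zero; suc; _+_; _≤_)
open import Data.Nat.Properties using (_≟_; 1+n≢n)
open import Data.Product.Base using (Σ-syntax; ∃-syntax; _×_; _,_)
open import Data.Sum.Base as Sum using (_⊎_; inj₁; inj₂; [_,_]′)
open import Data.Sum.Relation.Binary.Pointwise
  using (Pointwise; ⊎-symmetric; ⊎-irreflexive; ⊎-decidable; ≡⇒Pointwise-≡)
open import Function.Base using (_∘_; _on_)
open import Function.Bundles using (_⇔_; _↔_; _↣_; Inverse; Injection)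
open import Level using (Level; 0ℓ)
open import Relation.Binary.Construct.Closure.ReflexiveTransitive using (Star)
open import Relation.Binary.Core using (Rel)
open import Relation.Binary.Definitions using (Symmetric; Irreflexive; Decidable)
open import Relation.Binary.PropositionalEquality
  using (_≡_; _≢_; refl; sym; trans; cong; ≢-sym)
open import Relation.Nullary.Decidable using (does; ¬?; _×-dec_; _⊎-dec_)
open import Relation.Nullary.Negation using (¬_)
open import Relation.Unary using (Pred)

record Graph : Set₁ where
  field
    order    : ℕ
    E        : Rel (Fin order) 0ℓ
    E-sym    : Symmetric E
    E-irrefl : Irreflexive _≡_ E
    E?       : Decidable E

  V : Set
  V = Fin order

open Graph

infix 4 _≅_ _⊑_

_≅_ : Graph → Graph → Set
G ≅ H = Σ[ f ∈ V G ↔ V H ]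
  (∀ u v → E G u v ⇔ E H (Inverse.to f u) (Inverse.to f v))

-- H ⊑ G: G contains a copy of H as an induced subgraph.
_⊑_ : Graph → Graph → Set
H ⊑ G = Σ[ f ∈ V H ↣ V G ]
  (∀ u v → E H u v ⇔ E G (Injection.to f u) (Injection.to f v))

Free : List Graph → Pred Graph _
Free Hs G = All (λ H → ¬ (H ⊑ G)) Hs

∅ : Graph
∅ = record
  { order    = 0
  ; E        = λ ()
  ; E-sym    = λ { {()} }
  ; E-irrefl = λ { {()} }
  ; E?       = λ ()
  }

P : ℕ → Graph
P t = record
  { order    = t
  ; E        = λ u v → toℕ v ≡ suc (toℕ u) ⊎ toℕ u ≡ suc (toℕ v)
  ; E-sym    = Sum.swap
  ; E-irrefl = λ { refl → [ 1+n≢n ∘ sym , 1+n≢n ∘ sym ]′ }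
  ; E?       = λ u v → (toℕ v ≟ suc (toℕ u)) ⊎-dec (toℕ u ≟ suc (toℕ v))
  }

infixl 6 _⊕_

_⊕_ : Graph → Graph → Graph
G ⊕ H = record
  { order    = order G + order H
  ; E        = Pointwise (E G) (E H) on splitAt (order G)
  ; E-sym    = ⊎-symmetric (E-sym G) (E-sym H)
  ; E-irrefl = ⊎-irreflexive (E-irrefl G) (E-irrefl H)
             ∘ ≡⇒Pointwise-≡ ∘ cong (splitAt (order G))
  ; E?       = λ u v → ⊎-decidable (E? G) (E? H)
                         (splitAt (order G) u) (splitAt (order G) v)
  }

infixr 7 _·_

_·_ : ℕ → Graph → Graph
zero  · G = ∅
suc r · G = G ⊕ r · G

complement : Graph → Graph
complement G = record
  { order    = order G
  ; E        = λ u v → u ≢ v × ¬ E G u v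
  ; E-sym    = λ (u≢v , ¬uv) → ≢-sym u≢v , ¬uv ∘ E-sym G
  ; E-irrefl = λ u≡v (u≢v , _) → u≢v u≡v
  ; E?       = λ u v → ¬? (u ≟ᶠ v) ×-dec ¬? (E? G u v)
  }

IsClique : (G : Graph) → Subset (order G) → Set
IsClique G K = ∀ {u v} → u ∈ K → v ∈ K → u ≢ v → E G u v

-- Connectedness of G ∖ K.  When no vertex is left this holds vacuously, so the
-- graph without vertices counts as connected.
ConnectedOutside : (G : Graph) → Subset (order G) → Set
ConnectedOutside G K = ∀ {u v} → u ∉ K → v ∉ K →
  Star (λ x y → x ∉ K × y ∉ K × E G x y) u v

IsCliqueCutSet : (G : Graph) → Subset (order G) → Set
IsCliqueCutSet G K = IsClique G K × ¬ ConnectedOutside G K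

Atom : Pred Graph _
Atom G = ¬ (∃[ K ] IsCliqueCutSet G K)

data Expr (k : ℕ) : Set where
  vertex  : Fin k → Expr k
  union   : Expr k → Expr k → Expr k
  join    : (i j : Fin k) → i ≢ j → Expr k → Expr k
  relabel : (i j : Fin k) → Expr k → Expr k

⟦_⟧   : ∀ {k} → Expr k → Graph
label : ∀ {k} (e : Expr k) → V ⟦ e ⟧ → Fin k

⟦ vertex i ⟧       = P 1
⟦ union e f ⟧      = ⟦ e ⟧ ⊕ ⟦ f ⟧
⟦ join i j i≢j e ⟧ = record
  { order    = order ⟦ e ⟧
  ; E        = λ u v → E ⟦ e ⟧ u v
                     ⊎ (label e u ≡ i × label e v ≡ j)
                     ⊎ (label e v ≡ i × label e u ≡ j)
  ; E-sym    = Sum.map (E-sym ⟦ e ⟧) Sum.swap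
  ; E-irrefl = λ { refl (inj₁ uu)               → E-irrefl ⟦ e ⟧ refl uu
                 ; refl (inj₂ (inj₁ (u≡i , u≡j))) → i≢j (trans (sym u≡i) u≡j)
                 ; refl (inj₂ (inj₂ (u≡i , u≡j))) → i≢j (trans (sym u≡i) u≡j) }
  ; E?       = λ u v → E? ⟦ e ⟧ u v
                 ⊎-dec ((label e u ≟ᶠ i) ×-dec (label e v ≟ᶠ j))
                 ⊎-dec ((label e v ≟ᶠ i) ×-dec (label e u ≟ᶠ j))
  }
⟦ relabel i j e ⟧  = ⟦ e ⟧

label (vertex i) _       = i
label (union e f) u      = [ label e , label f ]′ (splitAt (order ⟦ e ⟧) u)
label (join i j i≢j e) u = label e u
label (relabel i j e) u  = if does (label e u ≟ᶠ i) then j else label e u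

Constructible : ℕ → Pred Graph _
Constructible k G = ∃[ e ] ⟦_⟧ {k} e ≅ G

-- CliqueWidth G k: the minimum defining cw(G) is k.  A relation rather than a
-- function, as computing the minimum needs Constructible to be decided.  The
-- graph without vertices is built by no expression and has no clique-width.
CliqueWidth : Graph → ℕ → Set
CliqueWidth G k = Constructible k G × (∀ {j} → Constructible j G → k ≤ j)

BoundedCliqueWidth : ∀ {ℓ : Level} → Pred Graph ℓ → Set _
BoundedCliqueWidth C = ∃[ c ] (∀ {G} → C G → ∀ {k} → CliqueWidth G k → k ≤ c)

{-# OPTIONS --safe #-}

-- Unboundedness: in the graph formed by a clique on the numbers below N and, for each
-- pair (i , j), a further vertex adjacent to i and j, a set containing more than k
-- clique vertices and avoiding more than k has more than k neighbourhoods outside it;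
-- but a suitable subexpression of an expression with k labels has such a vertex set,
-- and its at most k labels determine these neighbourhoods.
--
-- Boundedness: it suffices to find boundedly many vertex classes and a rank such that
-- adjacency depends only on the classes and on the comparison of the ranks.  In an atom
-- no vertex with a non-neighbour has a clique as its neighbourhood.  Hence an atom with
-- neither induced C₄ nor C₅ is complete (look at a vertex of least degree), and one with
-- a C₅ but no C₄ is a C₅ joined to a clique.  Around an induced C₄ x₁x₂x₃x₄ sort the
-- vertices by their neighbours on it.  Those adjacent to just x₁, x₃ (A) or just x₂, x₄
-- (B) form independent sets, those adjacent to all four (W) a complete multipartite
-- graph complete to A and B, and the adjacencies among the remaining ones (Y) depend only
-- on the types.  Apart from boundedly many exceptional vertices, the adjacencies of A
-- and B to one another and to Y split into disjoint chain graphs, which are comparisons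
-- of ranks.  Finally, W is complete to the vertices of Y with two neighbours in A or in
-- B, and does not distinguish the others of one type: a failure would turn the
-- neighbourhood of such a vertex into a clique, or create a forbidden subgraph.

module Submission where

open import Defs
open import Data.Bool.Base using (Bool; true; false; if_then_else_)
open import Data.Bool.Properties using () renaming (_≟_ to _≟ᵇ_)
open import Data.Empty using (⊥; ⊥-elim)
open import Data.Fin.Base as Fin using (Fin; zero; suc; toℕ; splitAt; _↑ˡ_; _↑ʳ_; combine; remQuot; funToFin; finToFun)
open import Data.Fin.Patterns using (0F; 1F; 2F; 3F; 4F)
open import Data.Fin.Properties
  using (any?; all?; toℕ-injective; toℕ<n; splitAt-↑ˡ; splitAt-↑ʳ; splitAt⁻¹-↑ˡ; splitAt⁻¹-↑ʳ;
         remQuot-combine; combine-remQuot; combine-injective; finToFun-funToFin; pigeonhole;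
         ↑ˡ-injective; ↑ʳ-injective)
  renaming (_≟_ to _≟ᶠ_; _<?_ to _<?ᶠ_; suc-injective to suc-injectiveᶠ; <-cmp to <-cmpᶠ)
open import Data.Fin.Subset using (Subset; _∈_; _∉_)
open import Data.Vec.Base using (tabulate)
open import Data.Vec.Properties using (lookup∘tabulate; []=⇒lookup; lookup⇒[]=)
open import Data.List.Base using (List; []; _∷_; allFin)
open import Data.List.Membership.Propositional using () renaming (_∈_ to _∈ˡ_)
open import Data.List.Membership.Propositional.Properties using (∈-allFin)
open import Data.List.Relation.Unary.All using ([]; _∷_)
open import Data.List.Relation.Unary.Any using (here; there)
open import Data.Nat.Base using (ℕ; zero; suc; _+_; _*_; _^_; _⊔_; _≤_; _<_; z≤n; s≤s; s≤s⁻¹)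
open import Data.Nat.Properties
  using (≤-refl; ≤-reflexive; ≤-trans; <-irrefl; <-trans; ≤-<-trans; <-≤-trans; <⇒≤; ≰⇒>; ≮⇒≥; <⇒≱; _≤?_; _<?_; ≤-total;
         ≤∧≢⇒<; m≤n+m; m≤m+n; +-mono-≤; +-monoʳ-<; *-monoˡ-≤; +-comm; +-suc; ≤-antisym;
         +-cancelʳ-≤; +-cancelˡ-≡; m≤m⊔n; m≤n⊔m; n≤1+n; m≤n⇒m<n∨m≡n; suc-injective)
  renaming (_≟_ to _≟ⁿ_)
open import Data.Product.Base using (Σ-syntax; ∃; ∃-syntax; _×_; _,_; proj₁; proj₂; swap)
open import Data.Sum.Base as Sum using (_⊎_; inj₁; inj₂; [_,_]′)
open import Data.Sum.Relation.Binary.Pointwise using (inj₁; inj₂; drop-inj₁; drop-inj₂)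
open import Data.Unit.Base using (⊤; tt)
open import Function.Base using (_∘_; id; case_of_)
open import Function.Bundles using (_⇔_; mk⇔; mk↔ₛ′; mk↣; Equivalence; Inverse; Injection)
open import Relation.Binary.Construct.Closure.ReflexiveTransitive using (Star; ε; _◅_)
open import Relation.Binary.Core using (Rel)
open import Relation.Binary.PropositionalEquality
  using (_≡_; _≢_; refl; sym; trans; cong; subst; subst₂; ≢-sym)
open import Relation.Nullary.Decidable
  using (Dec; yes; toSum; no; does; ¬?; _×-dec_; _⊎-dec_; decidable-stable; dec-true; dec-false; from-yes; does-⇔; map′)
open import Relation.Nullary.Negation using (¬_; contradiction)
open import Relation.Unary using (Pred; Decidable; _∩_)
open import Level using (0ℓ)
open import Relation.Binary.Definitions using (Tri; tri<; tri≈; tri>)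

open Graph

-- Counting in Fin n

count : ∀ {n} {P : Pred (Fin n) 0ℓ} → Decidable P → ℕ
count {zero}  P? = 0
count {suc n} P? = (if does (P? zero) then 1 else 0) + count (P? ∘ suc)

count-mono : ∀ {n} {P Q : Pred (Fin n) 0ℓ} (P? : Decidable P) (Q? : Decidable Q) →
             (∀ x → P x → Q x) → count P? ≤ count Q?
count-mono {zero}  P? Q? P⊆Q = z≤n
count-mono {suc n} P? Q? P⊆Q with P? zero | Q? zero
... | yes p | yes q = s≤s (count-mono (P? ∘ suc) (Q? ∘ suc) (P⊆Q ∘ suc))
... | yes p | no ¬q = contradiction (P⊆Q zero p) ¬q
... | no ¬p | yes q = ≤-trans (count-mono (P? ∘ suc) (Q? ∘ suc) (P⊆Q ∘ suc)) (n≤1+n _)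
... | no ¬p | no ¬q = count-mono (P? ∘ suc) (Q? ∘ suc) (P⊆Q ∘ suc)

count-strict : ∀ {n} {P Q : Pred (Fin n) 0ℓ} (P? : Decidable P) (Q? : Decidable Q) →
               (∀ x → P x → Q x) → ∀ x → Q x → ¬ P x → count P? < count Q?
count-strict P? Q? P⊆Q zero q ¬p with P? zero | Q? zero
... | yes p | _     = contradiction p ¬p
... | no _  | yes _ = s≤s (count-mono (P? ∘ suc) (Q? ∘ suc) (P⊆Q ∘ suc))
... | no _  | no ¬q = contradiction q ¬q
count-strict P? Q? P⊆Q (suc x) q ¬p with P? zero | Q? zero
... | yes _ | yes _ = s≤s (count-strict (P? ∘ suc) (Q? ∘ suc) (P⊆Q ∘ suc) x q ¬p)
... | yes p | no ¬q = contradiction (P⊆Q zero p) ¬q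
... | no _  | yes _ = ≤-trans (count-strict (P? ∘ suc) (Q? ∘ suc) (P⊆Q ∘ suc) x q ¬p) (n≤1+n _)
... | no _  | no _  = count-strict (P? ∘ suc) (Q? ∘ suc) (P⊆Q ∘ suc) x q ¬p

count-cover : ∀ {n} {P Q : Pred (Fin n) 0ℓ} (P? : Decidable P) (Q? : Decidable Q) →
              (∀ x → P x ⊎ Q x) → n ≤ count P? + count Q?
count-cover {zero}  P? Q? cover = z≤n
count-cover {suc n} P? Q? cover with P? zero | Q? zero
... | yes p | yes q rewrite +-suc (count (P? ∘ suc)) (count (Q? ∘ suc)) =
  s≤s (≤-trans (count-cover (P? ∘ suc) (Q? ∘ suc) (cover ∘ suc)) (n≤1+n _))
... | yes p | no ¬q = s≤s (count-cover (P? ∘ suc) (Q? ∘ suc) (cover ∘ suc))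
... | no ¬p | yes q rewrite +-suc (count (P? ∘ suc)) (count (Q? ∘ suc)) =
  s≤s (count-cover (P? ∘ suc) (Q? ∘ suc) (cover ∘ suc))
... | no ¬p | no ¬q = ⊥-elim ([ ¬p , ¬q ]′ (cover zero))

count-∪ : ∀ {n} {P Q R : Pred (Fin n) 0ℓ} (P? : Decidable P) (Q? : Decidable Q) (R? : Decidable R) →
          (∀ x → R x → P x ⊎ Q x) → count R? ≤ count P? + count Q?
count-∪ {zero}  P? Q? R? R⊆ = z≤n
count-∪ {suc n} P? Q? R? R⊆ with count-∪ (P? ∘ suc) (Q? ∘ suc) (R? ∘ suc) (R⊆ ∘ suc)
... | ih with P? zero | Q? zero | R? zero
... | yes _ | yes _ | yes _ rewrite +-suc (count (P? ∘ suc)) (count (Q? ∘ suc)) = s≤s (≤-trans ih (n≤1+n _))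
... | yes _ | yes _ | no _  rewrite +-suc (count (P? ∘ suc)) (count (Q? ∘ suc)) =
  ≤-trans ih (≤-trans (n≤1+n _) (n≤1+n _))
... | yes _ | no _  | yes _ = s≤s ih
... | yes _ | no _  | no _  = ≤-trans ih (n≤1+n _)
... | no _  | yes _ | yes _ rewrite +-suc (count (P? ∘ suc)) (count (Q? ∘ suc)) = s≤s ih
... | no _  | yes _ | no _  rewrite +-suc (count (P? ∘ suc)) (count (Q? ∘ suc)) = ≤-trans ih (n≤1+n _)
... | no ¬p | no ¬q | yes r = ⊥-elim ([ ¬p , ¬q ]′ (R⊆ zero r))
... | no _  | no _  | no _  = ih

count-full : ∀ {n} {P : Pred (Fin n) 0ℓ} (P? : Decidable P) → (∀ x → P x) → n ≤ count P?
count-full {zero}  P? full = z≤n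
count-full {suc n} P? full with P? zero
... | yes _ = s≤s (count-full (P? ∘ suc) (full ∘ suc))
... | no ¬p = contradiction (full zero) ¬p

enumerate : ∀ {n} {P : Pred (Fin n) 0ℓ} (P? : Decidable P) →
            Σ[ f ∈ (Fin (count P?) → Fin n) ] (∀ i → P (f i)) × (∀ {i j} → f i ≡ f j → i ≡ j)
enumerate {zero} P? = (λ ()) , (λ ()) , λ { {()} }
enumerate {suc n} P? with P? zero | enumerate (P? ∘ suc)
... | no _  | f , Pf , inj = suc ∘ f , Pf , inj ∘ suc-injectiveᶠ
... | yes p | f , Pf , inj = g , Pg , ginj
  where
  g : _ → _
  g zero    = zero
  g (suc i) = suc (f i)
  Pg : ∀ i → _
  Pg zero    = p
  Pg (suc i) = Pf i
  ginj : ∀ {i j} → g i ≡ g j → i ≡ j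
  ginj {zero}  {zero}  _  = refl
  ginj {zero}  {suc j} ()
  ginj {suc i} {zero}  ()
  ginj {suc i} {suc j} eq = cong suc (inj (suc-injectiveᶠ eq))

count-pigeonhole : ∀ {n k} {P : Pred (Fin n) 0ℓ} (P? : Decidable P) → k < count P? →
                   (f : ∀ x → P x → Fin k) →
                   ∃[ x ] ∃[ y ] ∃[ p ] ∃[ q ] x ≢ y × f x p ≡ f y q
count-pigeonhole P? k< f with enumerate P?
... | g , Pg , inj with pigeonhole k< (λ i → f (g i) (Pg i))
... | i , j , i<j , eq = g i , g j , Pg i , Pg j , (λ e → <-irrefl (cong toℕ (inj e)) i<j) , eq

argmin : ∀ {n} (f : Fin n → ℕ) → Fin n → ∃[ v ] (∀ u → f v ≤ f u)
argmin {suc zero}    f _ = zero , λ { zero → ≤-refl }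
argmin {suc (suc n)} f _ with argmin (f ∘ suc) zero
... | v , min with ≤-total (f zero) (f (suc v))
... | inj₁ 0≤v = zero , λ { zero → ≤-refl ; (suc u) → ≤-trans 0≤v (min u) }
... | inj₂ v≤0 = suc v , λ { zero → v≤0 ; (suc u) → min u }

strictBound : ∀ {n} (f : Fin n → ℕ) → ∃[ b ] (∀ u → f u < b)
strictBound {zero}  f = 0 , λ ()
strictBound {suc n} f with strictBound (f ∘ suc)
... | b , f<b = suc (f zero) ⊔ b , λ { zero → m≤m⊔n _ b ; (suc u) → ≤-trans (f<b u) (m≤n⊔m (suc (f zero)) b) }

-- The value is n when P is empty.
first : ∀ {n} {P : Pred (Fin n) 0ℓ} → Decidable P → ℕ
first {zero}  P? = 0
first {suc n} P? = if does (P? zero) then 0 else suc (first (P? ∘ suc))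

first-cong : ∀ {n} {P Q : Pred (Fin n) 0ℓ} (P? : Decidable P) (Q? : Decidable Q) →
             (∀ x → P x → Q x) → (∀ x → Q x → P x) → first P? ≡ first Q?
first-cong {zero}  P? Q? P⊆Q Q⊆P = refl
first-cong {suc n} P? Q? P⊆Q Q⊆P with P? zero | Q? zero
... | yes p | yes q = refl
... | yes p | no ¬q = contradiction (P⊆Q zero p) ¬q
... | no ¬p | yes q = contradiction (Q⊆P zero q) ¬p
... | no ¬p | no ¬q = cong suc (first-cong (P? ∘ suc) (Q? ∘ suc) (P⊆Q ∘ suc) (Q⊆P ∘ suc))

first-common : ∀ {n} {P Q : Pred (Fin n) 0ℓ} (P? : Decidable P) (Q? : Decidable Q) →
               first P? ≡ first Q? → ∃ P → ∃ (λ x → P x × Q x)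
first-common {suc n} P? Q? eq (x , px) with P? zero | Q? zero
... | yes p | yes q = zero , p , q
... | no ¬p | no ¬q with x
...   | zero   = contradiction px ¬p
...   | suc x′ with first-common (P? ∘ suc) (Q? ∘ suc) (suc-injective eq) (x′ , px)
...     | y , py , qy = suc y , py , qy
first-common {suc n} P? Q? () _ | yes p | no ¬q
first-common {suc n} P? Q? () _ | no ¬p | yes q

-- By hypothesis the neighbourhoods are nested. `ρ x` counts the `x′` with a neighbour that `x`
-- lacks, `σ y` the neighbours of `y`: if `x` is adjacent to `y`, so are all these `x′`, and `x`
-- itself adds one; if not, every neighbour of `y` is such an `x′`.
chain-rank : ∀ {n} {E : Rel (Fin n) 0ℓ} {X Y : Pred (Fin n) 0ℓ} →
             (∀ u v → Dec (E u v)) → Decidable X → Decidable Y →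
             (∀ {x x′ y y′} → X x → X x′ → Y y → Y y′ → E x y → E x′ y′ → ¬ E x y′ → ¬ E x′ y → ⊥) →
             Σ[ ρ ∈ (Fin n → ℕ) ] Σ[ σ ∈ (Fin n → ℕ) ] (∀ {x y} → X x → Y y → E x y ⇔ ρ x < σ y)
chain-rank {n} {E} {X} {Y} E? X? Y? chain = count ∘ above? , count ∘ nbr? , λ Xx Yy → mk⇔ (to Xx Yy) (from Xx Yy)
  where
  Above : Fin n → Pred (Fin n) 0ℓ
  Above x x′ = X x′ × ∃[ y ] Y y × E x′ y × ¬ E x y
  above? : ∀ x → Decidable (Above x)
  above? x x′ = X? x′ ×-dec any? (λ y → Y? y ×-dec E? x′ y ×-dec ¬? (E? x y))
  nbr? : ∀ y → Decidable (λ x → X x × E x y)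
  nbr? y x = X? x ×-dec E? x y
  to : ∀ {x y} → X x → Y y → E x y → count (above? x) < count (nbr? y)
  to {x} {y} Xx Yy xy = count-strict (above? x) (nbr? y)
    (λ { x′ (Xx′ , y′ , Yy′ , x′y′ , ¬xy′) →
         Xx′ , decidable-stable (E? x′ y) (chain Xx Xx′ Yy Yy′ xy x′y′ ¬xy′) })
    x (Xx , xy) (λ { (_ , _ , _ , e , ¬e) → ¬e e })
  from : ∀ {x y} → X x → Y y → count (above? x) < count (nbr? y) → E x y
  from {x} {y} Xx Yy lt = decidable-stable (E? x y) λ ¬xy →
    <⇒≱ lt (count-mono (nbr? y) (above? x) (λ { x′ (Xx′ , x′y) → Xx′ , y , Yy , x′y , ¬xy }))

-- Split graphs of unbounded clique-width

module SplitGraph (N : ℕ) where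

  -- Ordered pairs, those with equal entries included, are what `combine` numbers bijectively.
  Vertex : Set
  Vertex = Fin N ⊎ Fin N × Fin N

  Adj : Rel Vertex 0ℓ
  Adj (inj₁ i)       (inj₁ j)       = i ≢ j
  Adj (inj₁ i)       (inj₂ (a , b)) = i ≡ a ⊎ i ≡ b
  Adj (inj₂ (a , b)) (inj₁ i)       = i ≡ a ⊎ i ≡ b
  Adj (inj₂ _)       (inj₂ _)       = ⊥

  Adj-sym : ∀ x y → Adj x y → Adj y x
  Adj-sym (inj₁ i) (inj₁ j) = ≢-sym
  Adj-sym (inj₁ i) (inj₂ _) = id
  Adj-sym (inj₂ _) (inj₁ i) = id

  Adj-irrefl : ∀ x → ¬ Adj x x
  Adj-irrefl (inj₁ i) i≢i = i≢i refl

  Adj? : ∀ x y → Dec (Adj x y)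
  Adj? (inj₁ i)       (inj₁ j)       = ¬? (i ≟ᶠ j)
  Adj? (inj₁ i)       (inj₂ (a , b)) = (i ≟ᶠ a) ⊎-dec (i ≟ᶠ b)
  Adj? (inj₂ (a , b)) (inj₁ i)       = (i ≟ᶠ a) ⊎-dec (i ≟ᶠ b)
  Adj? (inj₂ _)       (inj₂ _)       = no λ ()

  decode : Fin (N + N * N) → Vertex
  decode = Sum.map₂ (remQuot N) ∘ splitAt N

  clique : Fin N → Fin (N + N * N)
  clique i = i ↑ˡ (N * N)

  pair : Fin N → Fin N → Fin (N + N * N)
  pair a b = N ↑ʳ combine a b

  decode-clique : ∀ i → decode (clique i) ≡ inj₁ i
  decode-clique i = cong (Sum.map₂ (remQuot N)) (splitAt-↑ˡ N i (N * N))

  decode-pair : ∀ a b → decode (pair a b) ≡ inj₂ (a , b)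
  decode-pair a b = trans (cong (Sum.map₂ (remQuot N)) (splitAt-↑ʳ N (N * N) (combine a b)))
                          (cong inj₂ (remQuot-combine a b))

  encode : Vertex → Fin (N + N * N)
  encode = [ clique , (λ (a , b) → pair a b) ]′

  encode-decode : ∀ u → encode (decode u) ≡ u
  encode-decode u with splitAt N u in eq
  ... | inj₁ i = splitAt⁻¹-↑ˡ eq
  ... | inj₂ j = trans (cong (N ↑ʳ_) (combine-remQuot {N} N j)) (splitAt⁻¹-↑ʳ eq)

  decode-injective : ∀ {u v} → decode u ≡ decode v → u ≡ v
  decode-injective {u} {v} eq = trans (sym (encode-decode u)) (trans (cong encode eq) (encode-decode v))

  split : Graph
  split = record
    { order    = N + N * N
    ; E        = λ u v → Adj (decode u) (decode v)
    ; E-sym    = λ {u} {v} → Adj-sym (decode u) (decode v)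
    ; E-irrefl = λ { {u} refl → Adj-irrefl (decode u) }
    ; E?       = λ u v → Adj? (decode u) (decode v)
    }

  InClique : Vertex → Set
  InClique x = ∃[ i ] x ≡ inj₁ i

  edge-meets-clique : ∀ x y → Adj x y → InClique x ⊎ InClique y
  edge-meets-clique (inj₁ i) _        _ = inj₁ (i , refl)
  edge-meets-clique (inj₂ _) (inj₁ i) _ = inj₂ (i , refl)

  clique-adjacent : ∀ {x y} → InClique x → InClique y → x ≢ y → Adj x y
  clique-adjacent (i , refl) (j , refl) x≢y i≡j = x≢y (cong inj₁ i≡j)

  nonedge-not-in-clique : ∀ {H} ((f , _) : H ⊑ split) → ∀ a b → a ≢ b → ¬ E H a b →
    InClique (decode (Injection.to f a)) → InClique (decode (Injection.to f b)) → ⊥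
  nonedge-not-in-clique (f , iso) a b a≢b ¬ab a∈K b∈K = ¬ab (Equivalence.from (iso a b)
    (clique-adjacent a∈K b∈K (a≢b ∘ Injection.injective f ∘ decode-injective)))

  -- Each of the two edges meets the clique, and clique vertices on different edges would be
  -- adjacent.
  2P₂-free : ¬ (2 · P 2 ⊑ split)
  2P₂-free (f , iso) =
    [ (λ 0∈K → [ (λ 2∈K → off 0F 2F (λ ()) (λ ()) 0∈K 2∈K)
               , (λ 3∈K → off 0F 3F (λ ()) (λ ()) 0∈K 3∈K) ]′ right)
    , (λ 1∈K → [ (λ 2∈K → off 1F 2F (λ ()) (λ ()) 1∈K 2∈K)
               , (λ 3∈K → off 1F 3F (λ ()) (λ ()) 1∈K 3∈K) ]′ right) ]′ left
    where
    open Injection f using (to)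
    left : InClique (decode (to 0F)) ⊎ InClique (decode (to 1F))
    left = edge-meets-clique _ _ (Equivalence.to (iso 0F 1F) (inj₁ (inj₁ refl)))
    right : InClique (decode (to 2F)) ⊎ InClique (decode (to 3F))
    right = edge-meets-clique _ _ (Equivalence.to (iso 2F 3F) (inj₂ (inj₁ (inj₁ refl))))
    off = nonedge-not-in-clique {2 · P 2} (f , iso)

  -- The vertices 0, 2, 1, 3 of the complement of P₂ + P₃ form a C₄.
  co-P₂+P₃-free : ¬ (complement (P 2 ⊕ P 3) ⊑ split)
  co-P₂+P₃-free (f , iso) with edge 0F 2F (λ ()) (λ ()) | edge 0F 3F (λ ()) (λ ())
                             | edge 1F 2F (λ ()) (λ ()) | edge 1F 3F (λ ()) (λ ())
    where
    open Injection f using (to)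
    edge : ∀ a b → a ≢ b → ¬ E (P 2 ⊕ P 3) a b → InClique (decode (to a)) ⊎ InClique (decode (to b))
    edge a b a≢b ¬ab = edge-meets-clique _ _ (Equivalence.to (iso a b) (a≢b , ¬ab))
  ... | inj₂ 2∈K | inj₂ 3∈K | _        | _        = nonedge-not-in-clique {complement (P 2 ⊕ P 3)} (f , iso) 2F 3F (λ ()) (λ (_ , ¬e) → ¬e (inj₂ (inj₁ refl))) 2∈K 3∈K
  ... | _        | _        | inj₂ 2∈K | inj₂ 3∈K = nonedge-not-in-clique {complement (P 2 ⊕ P 3)} (f , iso) 2F 3F (λ ()) (λ (_ , ¬e) → ¬e (inj₂ (inj₁ refl))) 2∈K 3∈K
  ... | inj₁ 0∈K | _        | inj₁ 1∈K | _        = nonedge-not-in-clique {complement (P 2 ⊕ P 3)} (f , iso) 0F 1F (λ ()) (λ (_ , ¬e) → ¬e (inj₁ (inj₁ refl))) 0∈K 1∈K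
  ... | _        | inj₁ 0∈K | inj₁ 1∈K | _        = nonedge-not-in-clique {complement (P 2 ⊕ P 3)} (f , iso) 0F 1F (λ ()) (λ (_ , ¬e) → ¬e (inj₁ (inj₁ refl))) 0∈K 1∈K
  ... | inj₁ 0∈K | _        | _        | inj₁ 1∈K = nonedge-not-in-clique {complement (P 2 ⊕ P 3)} (f , iso) 0F 1F (λ ()) (λ (_ , ¬e) → ¬e (inj₁ (inj₁ refl))) 0∈K 1∈K
  ... | _        | inj₁ 0∈K | _        | inj₁ 1∈K = nonedge-not-in-clique {complement (P 2 ⊕ P 3)} (f , iso) 0F 1F (λ ()) (λ (_ , ¬e) → ¬e (inj₁ (inj₁ refl))) 0∈K 1∈K


-- The situation of a subexpression e of an expression for G: later operations
-- treat vertices with the same label alike.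
record Inside {k} (e : Expr k) (G : Graph) : Set where
  field
    place     : V ⟦ e ⟧ → V G
    injective : ∀ {u v} → place u ≡ place v → u ≡ v
    keeps     : ∀ {u x} → E ⟦ e ⟧ u x → E G (place u) (place x)
    outside   : ∀ {u v w} → label e u ≡ label e v → (∀ x → place x ≢ w) →
                E G (place u) w → E G (place v) w
    later     : ∀ {u v x y} → label e u ≡ label e v → label e x ≡ label e y →
                ¬ E ⟦ e ⟧ u x → E G (place u) (place x) → E G (place v) (place y)

inside-whole : ∀ {k G} ((e , _) : Constructible k G) → Inside e G
inside-whole (e , f , iso) = record
  { place     = Inverse.to f
  ; injective = λ {u} {v} eq → trans (sym (Inverse.strictlyInverseʳ f u))
                                 (trans (cong (Inverse.from f) eq) (Inverse.strictlyInverseʳ f v))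
  ; keeps     = Equivalence.to (iso _ _)
  ; outside   = λ {_} {_} {w} _ ∉im _ → contradiction (Inverse.strictlyInverseˡ f w) (∉im _)
  ; later     = λ _ _ ¬ux ux → contradiction (Equivalence.from (iso _ _) ux) ¬ux
  }

-- An edge of `G` still absent from `e` is added either by this join, which sees labels only, or by
-- a later operation.
inside-join : ∀ {k G i j} {i≢j : i ≢ j} {e : Expr k} → Inside (join i j i≢j e) G → Inside e G
inside-join {G = G} {i} {j} {i≢j} {e} ins = record
  { place     = place
  ; injective = injective
  ; keeps     = keeps ∘ inj₁
  ; outside   = outside
  ; later     = later′
  }
  where
  open Inside ins
  relabelled : ∀ {u v x y} → label e u ≡ label e v → label e x ≡ label e y →
               ¬ E ⟦ e ⟧ u x → E ⟦ join i j i≢j e ⟧ u x → E ⟦ join i j i≢j e ⟧ v y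
  relabelled uv xy ¬ux (inj₁ ux) = contradiction ux ¬ux
  relabelled uv xy ¬ux (inj₂ p) rewrite uv | xy = inj₂ p
  later′ : ∀ {u v x y} → label e u ≡ label e v → label e x ≡ label e y →
           ¬ E ⟦ e ⟧ u x → E G (place u) (place x) → E G (place v) (place y)
  later′ {u} {v} {x} {y} uv xy ¬ux ux with E? ⟦ join i j i≢j e ⟧ u x
  ... | yes ux′ = keeps (relabelled uv xy ¬ux ux′)
  ... | no ¬ux′ = later uv xy ¬ux′ ux

inside-relabel : ∀ {k G i j} {e : Expr k} → Inside (relabel i j e) G → Inside e G
inside-relabel {i = i} {j} {e} ins = record
  { place     = place
  ; injective = injective
  ; keeps     = keeps
  ; outside   = outside ∘ cong φ
  ; later     = λ uv xy → later (cong φ uv) (cong φ xy)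
  }
  where
  open Inside ins
  φ : _ → _
  φ l = if does (l ≟ᶠ i) then j else l

inside-unionˡ : ∀ {k G} {e f : Expr k} → Inside (union e f) G → Inside e G
inside-unionˡ {k} {G} {e} {f} ins = record
  { place     = place ∘ inˡ
  ; injective = ↑ˡ-injective n _ _ ∘ injective
  ; keeps     = keeps ∘ edge
  ; outside   = outside′
  ; later     = λ uv xy ¬ux → later (lab uv) (lab xy) (¬ux ∘ edge⁻¹)
  }
  where
  open Inside ins
  m = order ⟦ e ⟧
  n = order ⟦ f ⟧
  inˡ : V ⟦ e ⟧ → V ⟦ union e f ⟧
  inˡ u = u ↑ˡ n
  lab : ∀ {u v} → label e u ≡ label e v → label (union e f) (inˡ u) ≡ label (union e f) (inˡ v)
  lab {u} {v} eq rewrite splitAt-↑ˡ m u n | splitAt-↑ˡ m v n = eq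
  edge : ∀ {u x} → E ⟦ e ⟧ u x → E ⟦ union e f ⟧ (inˡ u) (inˡ x)
  edge {u} {x} ux rewrite splitAt-↑ˡ m u n | splitAt-↑ˡ m x n = inj₁ ux
  edge⁻¹ : ∀ {u x} → E ⟦ union e f ⟧ (inˡ u) (inˡ x) → E ⟦ e ⟧ u x
  edge⁻¹ {u} {x} ux rewrite splitAt-↑ˡ m u n | splitAt-↑ˡ m x n = drop-inj₁ ux
  cross : ∀ {u} y → ¬ E ⟦ union e f ⟧ (inˡ u) (m ↑ʳ y)
  cross {u} y uy rewrite splitAt-↑ˡ m u n | splitAt-↑ʳ m n y with () ← uy
  outside′ : ∀ {u v w} → label e u ≡ label e v → (∀ x → place (inˡ x) ≢ w) →
             E G (place (inˡ u)) w → E G (place (inˡ v)) w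
  outside′ {u} {v} {w} uv ∉im uw with any? (λ x → place x ≟ᶠ w)
  ... | no ∉im′ = outside (lab uv) (λ x eq → ∉im′ (x , eq)) uw
  ... | yes (x , refl) with splitAt m x in eq
  ...   | inj₁ y = contradiction (cong place (splitAt⁻¹-↑ˡ eq)) (∉im y)
  -- Here `w` lies in the other half, so the union has no edge between it and `u` yet: the edge is
  -- added later.
  ...   | inj₂ y rewrite sym (splitAt⁻¹-↑ʳ {m} {n} eq) = later (lab uv) refl (cross y) uw

inside-unionʳ : ∀ {k G} {e f : Expr k} → Inside (union e f) G → Inside f G
inside-unionʳ {k} {G} {e} {f} ins = record
  { place     = place ∘ inʳ
  ; injective = ↑ʳ-injective m _ _ ∘ injective
  ; keeps     = keeps ∘ edge
  ; outside   = outside′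
  ; later     = λ uv xy ¬ux → later (lab uv) (lab xy) (¬ux ∘ edge⁻¹)
  }
  where
  open Inside ins
  m = order ⟦ e ⟧
  n = order ⟦ f ⟧
  inʳ : V ⟦ f ⟧ → V ⟦ union e f ⟧
  inʳ u = m ↑ʳ u
  lab : ∀ {u v} → label f u ≡ label f v → label (union e f) (inʳ u) ≡ label (union e f) (inʳ v)
  lab {u} {v} eq rewrite splitAt-↑ʳ m n u | splitAt-↑ʳ m n v = eq
  edge : ∀ {u x} → E ⟦ f ⟧ u x → E ⟦ union e f ⟧ (inʳ u) (inʳ x)
  edge {u} {x} ux rewrite splitAt-↑ʳ m n u | splitAt-↑ʳ m n x = inj₂ ux
  edge⁻¹ : ∀ {u x} → E ⟦ union e f ⟧ (inʳ u) (inʳ x) → E ⟦ f ⟧ u x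
  edge⁻¹ {u} {x} ux rewrite splitAt-↑ʳ m n u | splitAt-↑ʳ m n x = drop-inj₂ ux
  cross : ∀ {u} y → ¬ E ⟦ union e f ⟧ (inʳ u) (y ↑ˡ n)
  cross {u} y uy rewrite splitAt-↑ʳ m n u | splitAt-↑ˡ m y n with () ← uy
  outside′ : ∀ {u v w} → label f u ≡ label f v → (∀ x → place (inʳ x) ≢ w) →
             E G (place (inʳ u)) w → E G (place (inʳ v)) w
  outside′ {u} {v} {w} uv ∉im uw with any? (λ x → place x ≟ᶠ w)
  ... | no ∉im′ = outside (lab uv) (λ x eq → ∉im′ (x , eq)) uw
  ... | yes (x , refl) with splitAt m x in eq
  ...   | inj₂ y = contradiction (cong place (splitAt⁻¹-↑ʳ {m} {n} eq)) (∉im y)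
  ...   | inj₁ y rewrite sym (splitAt⁻¹-↑ˡ {m} {n} eq) = later (lab uv) refl (cross y) uw

-- At most k clique vertices inside any subexpression

module _ {k N : ℕ} (large : suc k + (k + k) ≤ N) where

  open SplitGraph using (split; clique; pair; decode-clique; decode-pair)

  Covered : {e : Expr k} → Inside e (split N) → Pred (Fin N) 0ℓ
  Covered ins i = ∃[ x ] Inside.place ins x ≡ clique N i

  covered? : {e : Expr k} (ins : Inside e (split N)) → Decidable (Covered ins)
  covered? ins i = any? (λ x → Inside.place ins x ≟ᶠ clique N i)

  clique∼pair : ∀ l i j → E (split N) (clique N l) (pair N i j) ⇔ (l ≡ i ⊎ l ≡ j)
  clique∼pair l i j rewrite decode-clique N l | decode-pair N i j = mk⇔ id id

  ReachesInside : {e : Expr k} → Inside e (split N) → Pred (Fin N) 0ℓ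
  ReachesInside ins j = ∃[ i ] Covered ins i × ∃[ x ] Inside.place ins x ≡ pair N i j

  -- More than k clique vertices i lie inside e and more than k, j, outside.  If some
  -- j has all its pair i j outside, these tell the i apart; otherwise the j tell
  -- apart the inside ones of their pairs.
  unbalanced : {e : Expr k} (ins : Inside e (split N)) →
               k < count (covered? ins) → k < count (¬? ∘ covered? ins) → ⊥
  unbalanced {e} ins inner outer = [ separated , reached ]′ dichotomy
    where
    open Inside ins
    reaches? : Decidable (ReachesInside ins)
    reaches? j = any? λ i → covered? ins i ×-dec any? (λ x → place x ≟ᶠ pair N i j)

    dichotomy : (∃[ j ] ¬ Covered ins j × ¬ ReachesInside ins j) ⊎
                (∀ j → ¬ Covered ins j → ReachesInside ins j)
    dichotomy with any? (λ j → ¬? (covered? ins j) ×-dec ¬? (reaches? j))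
    ... | yes p = inj₁ p
    ... | no ¬p = inj₂ λ j j∉ → decidable-stable (reaches? j) λ ¬r → ¬p (j , j∉ , ¬r)

    separated : (∃[ j ] ¬ Covered ins j × ¬ ReachesInside ins j) → ⊥
    separated (j , j∉ , ¬r) with count-pigeonhole (covered? ins) inner (λ _ (x , _) → label e x)
    ... | i , i′ , (x , x≡i) , (x′ , x′≡i′) , i≢i′ , same =
      [ i≢i′ ∘ sym , (λ { refl → j∉ (x′ , x′≡i′) }) ]′ (Equivalence.to (clique∼pair i′ i j) i′∼)
      where
      i′∼ : E (split N) (clique N i′) (pair N i j)
      i′∼ = subst (λ v → E (split N) v (pair N i j)) x′≡i′
        (outside same (λ y y≡ → ¬r (i , (x , x≡i) , y , y≡))
          (subst (λ v → E (split N) v (pair N i j)) (sym x≡i) (Equivalence.from (clique∼pair i i j) (inj₁ refl))))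

    reached : (∀ j → ¬ Covered ins j → ReachesInside ins j) → ⊥
    reached r with count-pigeonhole (¬? ∘ covered? ins) outer (λ j j∉ → label e (proj₁ (proj₂ (proj₂ (r j j∉)))))
    ... | j , j′ , j∉ , j′∉ , j≢j′ , same with r j j∉ | r j′ j′∉
    ...   | i , _ , x , x≡ | i′ , i′∈ , x′ , x′≡ =
      [ (λ { refl → j∉ i′∈ }) , j≢j′ ]′ (Equivalence.to (clique∼pair j i′ j′) j∼)
      where
      j∼ : E (split N) (clique N j) (pair N i′ j′)
      j∼ = E-sym (split N) {pair N i′ j′} {clique N j} (subst (λ v → E (split N) v (clique N j)) x′≡
        (outside same (λ y y≡ → j∉ (y , y≡))
          (subst (λ v → E (split N) v (clique N j)) (sym x≡)
            (E-sym (split N) {clique N j} {pair N i j} (Equivalence.from (clique∼pair j i j) (inj₂ refl))))))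

  -- The number covered cannot lie between k + 1 and 2k: at least N - 2k > k clique vertices would
  -- be left outside, against `unbalanced`.
  few-covered : {e : Expr k} (ins : Inside e (split N)) → count (covered? ins) ≤ k + k → count (covered? ins) ≤ k
  few-covered ins few with count (covered? ins) ≤? k
  ... | yes p = p
  ... | no ≰k = ⊥-elim (unbalanced ins (≰⇒> ≰k) (+-cancelʳ-≤ (k + k) _ _ (≤-trans large
      (≤-trans (count-cover (covered? ins) (¬? ∘ covered? ins) λ i → toSum (covered? ins i))
        (≤-trans (+-mono-≤ few ≤-refl) (≤-reflexive (+-comm (k + k) _)))))))

  -- Only a union changes the set of vertices; it gives at most 2k covered ones, and `few-covered`
  -- brings this back to k.
  covered-≤ : (e : Expr k) (ins : Inside e (split N)) → count (covered? ins) ≤ k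
  covered-≤ (vertex l) ins = ≮⇒≥ λ k< → case count-pigeonhole (covered? ins) k< (λ _ _ → l) of λ
    { (i , j , (zero , i≡) , (zero , j≡) , i≢j , _) →
      i≢j (↑ˡ-injective (N * N) i j (trans (sym i≡) j≡)) }
  covered-≤ (union e f) ins = few-covered ins (≤-trans
    (count-∪ (covered? insˡ) (covered? insʳ) (covered? ins) halves)
    (+-mono-≤ (covered-≤ e insˡ) (covered-≤ f insʳ)))
    where
    insˡ = inside-unionˡ ins
    insʳ = inside-unionʳ ins
    halves : ∀ i → Covered ins i → Covered insˡ i ⊎ Covered insʳ i
    halves i (x , x≡i) with splitAt (order ⟦ e ⟧) x in eq
    ... | inj₁ y = inj₁ (y , trans (cong (Inside.place ins) (splitAt⁻¹-↑ˡ eq)) x≡i)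
    ... | inj₂ y = inj₂ (y , trans (cong (Inside.place ins) (splitAt⁻¹-↑ʳ {order ⟦ e ⟧} eq)) x≡i)
  covered-≤ (join i j i≢j e) ins = covered-≤ e (inside-join ins)
  covered-≤ (relabel i j e)  ins = covered-≤ e (inside-relabel ins)

  split-not-constructible : ¬ Constructible k (split N)
  split-not-constructible c@(e , f , _) = <⇒≱ (≤-trans (m≤m+n (suc k) (k + k)) large)
    (≤-trans (count-full (covered? ins) λ i → Inverse.from f (clique N i) , Inverse.strictlyInverseˡ f _)
             (covered-≤ e ins))
    where
    ins = inside-whole c

-- Expressions from classes and ranks

-- e constructs, up to an isomorphism, the graph that R induces on the vertices in S,
-- with the labels ℓ.
record Builds {A : Set} {k} (e : Expr k) (S : Pred A 0ℓ) (R : Rel A 0ℓ) (ℓ : A → Fin k) : Set where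
  field
    place     : V ⟦ e ⟧ → A
    injective : ∀ {u v} → place u ≡ place v → u ≡ v
    sound     : ∀ u → S (place u)
    complete  : ∀ v → S v → ∃[ u ] place u ≡ v
    edge      : ∀ {u v} → E ⟦ e ⟧ u v → R (place u) (place v)
    edge⁻¹    : ∀ {u v} → R (place u) (place v) → E ⟦ e ⟧ u v
    labels    : ∀ u → label e u ≡ ℓ (place u)

Joined : ∀ {k} → Pred (Fin k) 0ℓ → Fin k → Rel (Fin k) 0ℓ
Joined J z a b = (J a × b ≡ z) ⊎ (J b × a ≡ z)

moveLabel : ∀ {k} → Fin k → Fin k → Fin k → Fin k
moveLabel i j l = if does (l ≟ᶠ i) then j else l

module _ {A : Set} {k : ℕ} where

  private variable
    e e′ : Expr k
    S S′ : Pred A 0ℓ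
    R R′ : Rel A 0ℓ
    ℓ ℓ′ : A → Fin k

  builds-cong : Builds e S R ℓ → (∀ {v} → S v → S′ v) → (∀ {v} → S′ v → S v) →
                (∀ {u v} → S u → S v → R u v → R′ u v) → (∀ {u v} → S u → S v → R′ u v → R u v) →
                (∀ {v} → S v → ℓ v ≡ ℓ′ v) → Builds e S′ R′ ℓ′
  builds-cong b S⊆ ⊆S R⊆ ⊆R ℓ≗ = record
    { place     = place
    ; injective = injective
    ; sound     = S⊆ ∘ sound
    ; complete  = λ v → complete v ∘ ⊆S
    ; edge      = R⊆ (sound _) (sound _) ∘ edge
    ; edge⁻¹    = edge⁻¹ ∘ ⊆R (sound _) (sound _)
    ; labels    = λ u → trans (labels u) (ℓ≗ (sound u))
    }
    where
    open Builds b

  builds-vertex : ∀ v {z} → ℓ v ≡ z → ¬ R v v → Builds (vertex z) (_≡ v) R ℓ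
  builds-vertex v ℓv≡z ¬vv = record
    { place     = λ _ → v
    ; injective = λ { {zero} {zero} _ → refl }
    ; sound     = λ _ → refl
    ; complete  = λ { _ refl → zero , refl }
    ; edge      = λ { {zero} {zero} (inj₁ ()) ; {zero} {zero} (inj₂ ()) }
    ; edge⁻¹    = λ vv → contradiction vv ¬vv
    ; labels    = λ _ → sym ℓv≡z
    }

  builds-union : Builds e S R ℓ → Builds e′ S′ R ℓ → (∀ {v} → S v → ¬ S′ v) →
                 (∀ {u v} → S u → S′ v → ¬ R u v × ¬ R v u) →
                 Builds (union e e′) (λ v → S v ⊎ S′ v) R ℓ
  builds-union {e = e} {S} {R} {ℓ} {e′} {S′} b b′ disjoint apart = record
    { place     = [ B.place , B′.place ]′ ∘ splitAt m
    ; injective = λ {u} {v} → inj u v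
    ; sound     = sound
    ; complete  = complete
    ; edge      = λ {u} {v} → edge u v
    ; edge⁻¹    = λ {u} {v} → edge⁻¹ u v
    ; labels    = labels
    }
    where
    module B  = Builds b
    module B′ = Builds b′
    m = order ⟦ e ⟧
    n = order ⟦ e′ ⟧
    place : V ⟦ union e e′ ⟧ → A
    place u = [ B.place , B′.place ]′ (splitAt m u)
    inj : ∀ u v → place u ≡ place v → u ≡ v
    inj u v eq with splitAt m u in p | splitAt m v in q
    ... | inj₁ a | inj₁ b = trans (sym (splitAt⁻¹-↑ˡ p)) (trans (cong (_↑ˡ n) (B.injective eq)) (splitAt⁻¹-↑ˡ q))
    ... | inj₂ a | inj₂ b = trans (sym (splitAt⁻¹-↑ʳ {m} p)) (trans (cong (m ↑ʳ_) (B′.injective eq)) (splitAt⁻¹-↑ʳ {m} q))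
    ... | inj₁ a | inj₂ b = contradiction (subst S′ (sym eq) (B′.sound b)) (disjoint (B.sound a))
    ... | inj₂ a | inj₁ b = contradiction (subst S′ eq (B′.sound a)) (disjoint (B.sound b))
    sound : ∀ u → S (place u) ⊎ S′ (place u)
    sound u with splitAt m u
    ... | inj₁ a = inj₁ (B.sound a)
    ... | inj₂ a = inj₂ (B′.sound a)
    complete : ∀ v → S v ⊎ S′ v → ∃[ u ] place u ≡ v
    complete v (inj₁ s) with B.complete v s
    ... | a , refl = a ↑ˡ n , cong [ B.place , B′.place ]′ (splitAt-↑ˡ m a n)
    complete v (inj₂ s) with B′.complete v s
    ... | a , refl = m ↑ʳ a , cong [ B.place , B′.place ]′ (splitAt-↑ʳ m n a)
    edge : ∀ u v → E ⟦ union e e′ ⟧ u v → R (place u) (place v)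
    edge u v uv with splitAt m u | splitAt m v | uv
    ... | inj₁ a | inj₁ b | inj₁ ab = B.edge ab
    ... | inj₂ a | inj₂ b | inj₂ ab = B′.edge ab
    edge⁻¹ : ∀ u v → R (place u) (place v) → E ⟦ union e e′ ⟧ u v
    edge⁻¹ u v uv with splitAt m u | splitAt m v
    ... | inj₁ a | inj₁ b = inj₁ (B.edge⁻¹ uv)
    ... | inj₂ a | inj₂ b = inj₂ (B′.edge⁻¹ uv)
    ... | inj₁ a | inj₂ b = contradiction uv (proj₁ (apart (B.sound a) (B′.sound b)))
    ... | inj₂ a | inj₁ b = contradiction uv (proj₂ (apart (B.sound b) (B′.sound a)))
    labels : ∀ u → label (union e e′) u ≡ ℓ (place u)
    labels u with splitAt m u
    ... | inj₁ a = B.labels a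
    ... | inj₂ a = B′.labels a

  builds-join : ∀ {i j} (i≢j : i ≢ j) → Builds e S R ℓ →
                Builds (join i j i≢j e) S (λ u v → R u v ⊎ Joined (_≡ i) j (ℓ u) (ℓ v)) ℓ
  builds-join {e = e} {ℓ = ℓ} {i = i} {j} i≢j b = record
    { place     = place
    ; injective = injective
    ; sound     = sound
    ; complete  = complete
    ; edge      = λ {u} {v} → Sum.map edge (subst₂ (Joined (_≡ i) j) (labels u) (labels v))
    ; edge⁻¹    = λ {u} {v} → Sum.map edge⁻¹ (subst₂ (Joined (_≡ i) j) (sym (labels u)) (sym (labels v)))
    ; labels    = labels
    }
    where
    open Builds b

  builds-joins : ∀ {J : Pred (Fin k) 0ℓ} → Decidable J → ∀ z → ¬ J z → ∃ (λ e → Builds e S R ℓ) →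
                 ∃[ e ] Builds e S (λ u v → R u v ⊎ Joined J z (ℓ u) (ℓ v)) ℓ
  builds-joins {S = S} {R} {ℓ} {J} J? z ¬Jz (e₀ , b₀) with all-labels (allFin k)
    where
    J∩ : List (Fin k) → Pred (Fin k) 0ℓ
    J∩ js a = J a × a ∈ˡ js
    all-labels : ∀ js → ∃[ e ] Builds e S (λ u v → R u v ⊎ Joined (J∩ js) z (ℓ u) (ℓ v)) ℓ
    all-labels [] = e₀ , builds-cong b₀ id id (λ _ _ → inj₁)
      (λ { _ _ (inj₁ r) → r ; _ _ (inj₂ (inj₁ ((_ , ()) , _))) ; _ _ (inj₂ (inj₂ ((_ , ()) , _))) }) (λ _ → refl)
    all-labels (j ∷ js) with all-labels js | J? j
    ... | e , b | no ¬Jj = e , builds-cong b id id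
      (λ _ _ → Sum.map₂ (Sum.map (λ ((p , q) , r) → (p , there q) , r) (λ ((p , q) , r) → (p , there q) , r)))
      (λ { _ _ (inj₁ r) → inj₁ r
         ; _ _ (inj₂ (inj₁ ((p , here refl) , _))) → contradiction p ¬Jj
         ; _ _ (inj₂ (inj₂ ((p , here refl) , _))) → contradiction p ¬Jj
         ; _ _ (inj₂ (inj₁ ((p , there q) , r))) → inj₂ (inj₁ ((p , q) , r))
         ; _ _ (inj₂ (inj₂ ((p , there q) , r))) → inj₂ (inj₂ ((p , q) , r)) })
      (λ _ → refl)
    ... | e , b | yes Jj = _ , builds-cong (builds-join j≢z b) id id
      (λ { _ _ (inj₁ (inj₁ r)) → inj₁ r
         ; _ _ (inj₁ (inj₂ (inj₁ ((p , q) , r)))) → inj₂ (inj₁ ((p , there q) , r))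
         ; _ _ (inj₁ (inj₂ (inj₂ ((p , q) , r)))) → inj₂ (inj₂ ((p , there q) , r))
         ; _ _ (inj₂ (inj₁ (p , r))) → inj₂ (inj₁ ((subst J (sym p) Jj , here p) , r))
         ; _ _ (inj₂ (inj₂ (p , r))) → inj₂ (inj₂ ((subst J (sym p) Jj , here p) , r)) })
      (λ { _ _ (inj₁ r) → inj₁ (inj₁ r)
         ; _ _ (inj₂ (inj₁ ((p , here q) , r))) → inj₂ (inj₁ (q , r))
         ; _ _ (inj₂ (inj₂ ((p , here q) , r))) → inj₂ (inj₂ (q , r))
         ; _ _ (inj₂ (inj₁ ((p , there q) , r))) → inj₁ (inj₂ (inj₁ ((p , q) , r)))
         ; _ _ (inj₂ (inj₂ ((p , there q) , r))) → inj₁ (inj₂ (inj₂ ((p , q) , r))) })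
      (λ _ → refl)
      where
      j≢z : j ≢ z
      j≢z refl = ¬Jz Jj
  ... | e , b = e , builds-cong b id id
    (λ _ _ → Sum.map₂ (Sum.map (λ ((p , _) , r) → p , r) (λ ((p , _) , r) → p , r)))
    (λ _ _ → Sum.map₂ (Sum.map (λ (p , r) → (p , ∈-allFin _) , r) (λ (p , r) → (p , ∈-allFin _) , r)))
    (λ _ → refl)

  builds-relabel : ∀ i j → Builds e S R ℓ → Builds (relabel i j e) S R (moveLabel i j ∘ ℓ)
  builds-relabel i j b = record
    { place     = place
    ; injective = injective
    ; sound     = sound
    ; complete  = complete
    ; edge      = edge
    ; edge⁻¹    = edge⁻¹
    ; labels    = cong (moveLabel i j) ∘ labels
    }
    where
    open Builds b

  -- Idempotence lets the labels be moved one at a time.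
  builds-relabels : (φ : Fin k → Fin k) → (∀ l → φ (φ l) ≡ φ l) → ∃ (λ e → Builds e S R ℓ) →
                    ∃[ e ] Builds e S R (φ ∘ ℓ)
  builds-relabels {S = S} {R} {ℓ} φ idem (e₀ , b₀) = proj₁ (go (allFin k)) ,
    builds-cong (proj₂ (go (allFin k))) id id (λ _ _ → id) (λ _ _ → id) (λ _ → done (allFin k) (∈-allFin _))
    where
    moved : List (Fin k) → Fin k → Fin k
    moved []       l = l
    moved (j ∷ js) l = moveLabel j (φ j) (moved js l)
    go : ∀ js → ∃[ e ] Builds e S R (moved js ∘ ℓ)
    go []       = e₀ , b₀
    go (j ∷ js) = _ , builds-relabel j (φ j) (proj₂ (go js))
    move-fixed : ∀ j l → moveLabel j (φ j) (φ l) ≡ φ l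
    move-fixed j l with φ l ≟ᶠ j
    ... | yes refl = idem l
    ... | no _     = refl
    kept-or-done : ∀ js l → moved js l ≡ l ⊎ moved js l ≡ φ l
    kept-or-done [] l = inj₁ refl
    kept-or-done (j ∷ js) l with kept-or-done js l
    ... | inj₂ eq rewrite eq = inj₂ (move-fixed j l)
    ... | inj₁ eq rewrite eq with l ≟ᶠ j
    ...   | yes refl = inj₂ refl
    ...   | no _     = inj₁ refl
    done : ∀ js {l} → l ∈ˡ js → moved js l ≡ φ l
    done (j ∷ js) {l} (there l∈) rewrite done js l∈ = move-fixed j l
    done (j ∷ js) {l} (here refl) with kept-or-done js l
    ... | inj₂ eq rewrite eq = move-fixed j l
    ... | inj₁ eq rewrite eq | dec-true (l ≟ᶠ l) refl = refl

-- z is a label not in use; it marks the new vertex while its edges are added.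
add-vertex : ∀ {n k} {e : Expr k} {S : Pred (Fin n) 0ℓ} {R : Rel (Fin n) 0ℓ} {ℓ ℓ′ : Fin n → Fin k}
             {v z} {J : Pred (Fin k) 0ℓ} → Decidable J →
             (∀ {u w} → R u w → R w u) → ¬ R v v → ¬ S v → ¬ J z → (∀ {u} → S u → ℓ u ≢ z) →
             (∀ {u} → S u → R u v ⇔ J (ℓ u)) → (∀ {u} → S u → ℓ u ≡ ℓ′ u) →
             Builds e S R ℓ → ∃[ e′ ] Builds e′ (λ u → S u ⊎ u ≡ v) R ℓ′
add-vertex {n} {k} {e} {S} {R} {ℓ} {ℓ′} {v} {z} {J} J? R-sym ¬vv ¬Sv ¬Jz fresh meets ℓ≗ b =
  _ , builds-cong (builds-relabel z (ℓ′ v) (builds-cong (proj₂ joined) id id sound complete (λ _ → refl)))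
        id id (λ _ _ → id) (λ _ _ → id) final
  where
  marked : Fin n → Fin k
  marked u = if does (u ≟ᶠ v) then z else ℓ u
  marked-v : marked v ≡ z
  marked-v rewrite dec-true (v ≟ᶠ v) refl = refl
  marked-old : ∀ {u} → S u → marked u ≡ ℓ u
  marked-old {u} Su rewrite dec-false (u ≟ᶠ v) (λ { refl → ¬Sv Su }) = refl
  -- Up to the joins, `v` is an isolated vertex.
  R₀ : Rel (Fin n) 0ℓ
  R₀ u w = R u w × u ≢ v × w ≢ v
  old : Builds e S R₀ marked
  old = builds-cong b id id
    (λ Su Sw uw → uw , (λ { refl → ¬Sv Su }) , (λ { refl → ¬Sv Sw })) (λ _ _ → proj₁) (sym ∘ marked-old)
  joined : ∃[ e′ ] Builds e′ (λ u → S u ⊎ u ≡ v)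
                     (λ u w → R₀ u w ⊎ Joined J z (marked u) (marked w)) marked
  joined = builds-joins J? z ¬Jz (_ , builds-union old (builds-vertex v marked-v λ (_ , v≢v , _) → v≢v refl)
    (λ { Sv refl → ¬Sv Sv })
    (λ { _ refl → (λ (_ , _ , v≢v) → v≢v refl) , (λ (_ , v≢v , _) → v≢v refl) }))
  attach : ∀ {u w} → S u ⊎ u ≡ v → S w ⊎ w ≡ v → J (marked u) → marked w ≡ z → R u w
  attach (inj₂ refl) _           Jv _  = contradiction (subst J marked-v Jv) ¬Jz
  attach _           (inj₁ Sw)   _  w≡ = contradiction (trans (sym (marked-old Sw)) w≡) (fresh Sw)
  attach (inj₁ Su)   (inj₂ refl) Ju _  = Equivalence.from (meets Su) (subst J (marked-old Su) Ju)
  sound : ∀ {u w} → S u ⊎ u ≡ v → S w ⊎ w ≡ v → R₀ u w ⊎ Joined J z (marked u) (marked w) → R u w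
  sound Su Sw (inj₁ (uw , _))        = uw
  sound Su Sw (inj₂ (inj₁ (Ju , w≡))) = attach Su Sw Ju w≡
  sound Su Sw (inj₂ (inj₂ (Jw , u≡))) = R-sym (attach Sw Su Jw u≡)
  attached : ∀ {u} → S u → R u v → J (marked u)
  attached Su uv = subst J (sym (marked-old Su)) (Equivalence.to (meets Su) uv)
  complete : ∀ {u w} → S u ⊎ u ≡ v → S w ⊎ w ≡ v → R u w → R₀ u w ⊎ Joined J z (marked u) (marked w)
  complete (inj₁ Su)   (inj₁ Sw)   uw = inj₁ (uw , (λ { refl → ¬Sv Su }) , (λ { refl → ¬Sv Sw }))
  complete (inj₁ Su)   (inj₂ refl) uv = inj₂ (inj₁ (attached Su uv , marked-v))
  complete (inj₂ refl) (inj₁ Sw)   vw = inj₂ (inj₂ (attached Sw (R-sym vw) , marked-v))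
  complete (inj₂ refl) (inj₂ refl) vv = contradiction vv ¬vv
  final : ∀ {u} → S u ⊎ u ≡ v → moveLabel z (ℓ′ v) (marked u) ≡ ℓ′ u
  final (inj₂ refl) rewrite marked-v | dec-true (z ≟ᶠ z) refl = refl
  final (inj₁ Su) rewrite marked-old Su | dec-false (ℓ _ ≟ᶠ z) (fresh Su) = ℓ≗ Su

-- When `v` is added, the earlier vertices have either smaller or equal rank. `determined` says that
-- the class together with this distinction decides the adjacency to `v`, so labels need to record
-- only these two.
module _ (G : Graph) {K : ℕ} (class : V G → Fin K) (rank : V G → ℕ)
  (determined : ∀ {u u′ v} → u ≢ v → u′ ≢ v → class u ≡ class u′ →
                (rank u < rank v × rank u′ < rank v) ⊎ (rank u ≡ rank v × rank u′ ≡ rank v) →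
                E G u v → E G u′ v)
  where

  private
    n = order G

    -- The vertices are added by increasing rank, ties broken by index.
    key : V G → ℕ
    key u = rank u * n + toℕ u

    key-rank : ∀ {u v} → key u ≤ key v → rank u ≤ rank v
    key-rank {u} {v} ku≤kv = ≮⇒≥ λ rv<ru → <⇒≱ (<-≤-trans (+-monoʳ-< (rank v * n) (toℕ<n v))
      (≤-trans (≤-reflexive (+-comm (rank v * n) n)) (≤-trans (*-monoˡ-≤ n rv<ru) (m≤m+n _ (toℕ u))))) ku≤kv

    key-injective : ∀ {u v} → key u ≡ key v → u ≡ v
    key-injective {u} {v} eq = toℕ-injective (+-cancelˡ-≡ (rank v * n) _ _
      (trans (cong (λ r → r * n + toℕ u) (sym ranks)) eq))
      where
      ranks : rank u ≡ rank v
      ranks = ≤-antisym (key-rank (≤-reflexive eq)) (key-rank (≤-reflexive (sym eq)))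

    -- Flag 0: rank below r, flag 1: rank r, flag 2: just being added.
    tag : Fin K → Fin 3 → Fin (K * 3)
    tag = combine

    flagOf : ∀ {P : Set} → Dec P → Fin 3
    flagOf (yes _) = 1F
    flagOf (no _)  = 0F

    flag : ℕ → V G → Fin 3
    flag r u = flagOf (rank u ≟ⁿ r)

    lab : ℕ → V G → Fin (K * 3)
    lab r u = tag (class u) (flag r u)

    flagOf≢2 : ∀ {P : Set} (d : Dec P) → flagOf d ≢ 2F
    flagOf≢2 (yes _) ()
    flagOf≢2 (no _)  ()

    flagOf-no : ∀ {P : Set} (d : Dec P) → ¬ P → flagOf d ≡ 0F
    flagOf-no (yes p) ¬p = contradiction p ¬p
    flagOf-no (no _)  _  = refl

    flagOf-≡ : ∀ {P Q : Set} (d : Dec P) (d′ : Dec Q) → flagOf d ≡ flagOf d′ → (P × Q) ⊎ (¬ P × ¬ Q)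
    flagOf-≡ (yes p) (yes q) _ = inj₁ (p , q)
    flagOf-≡ (no p)  (no q)  _ = inj₂ (p , q)
    flagOf-≡ (yes _) (no _)  ()
    flagOf-≡ (no _)  (yes _) ()

    age : Fin (K * 3) → Fin (K * 3)
    age l = tag (proj₁ (remQuot {K} 3 l)) 0F

    age-tag : ∀ c i → age (tag c i) ≡ tag c 0F
    age-tag c i = cong (λ p → tag (proj₁ p) 0F) (remQuot-combine c i)

    Below : ℕ → Pred (V G) 0ℓ
    Below t u = key u < t

    -- The flags refer to the rank `r`. That `r` is attained guarantees that the next vertex has
    -- rank at least `r`.
    Stage : ℕ → Set
    Stage t = ∃[ r ] (∃[ u ] Below t u × rank u ≡ r) × (∀ {u} → Below t u → rank u ≤ r) ×
              ∃[ e ] Builds e (Below t) (E G) (lab r)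

    -- When the current rank grows, every vertex present falls below it, so `age` clears all flags.
    refresh : ∀ {r S r′} → (∀ {u} → S u → rank u ≤ r) → r ≤ r′ →
              ∃ (λ e → Builds e S (E G) (lab r)) → ∃[ e ] Builds e S (E G) (lab r′)
    refresh {r} {S} {r′} S≤ r≤r′ b with m≤n⇒m<n∨m≡n r≤r′
    ... | inj₂ refl = b
    ... | inj₁ r<r′ with builds-relabels age (λ l → age-tag (proj₁ (remQuot {K} 3 l)) 0F) b
    ...   | e , b′ = e , builds-cong b′ id id (λ _ _ → id) (λ _ _ → id) λ {u} Su →
      trans (age-tag (class u) (flag r u)) (cong (tag (class u)) (sym (old Su)))
      where
      old : ∀ {u} → S u → flag r′ u ≡ 0F
      old {u} Su = flagOf-no (rank u ≟ⁿ r′) (λ eq → <-irrefl eq (≤-<-trans (S≤ Su) r<r′))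

    -- `J` collects the labels of earlier neighbours of `v`; by `determined`, every earlier vertex
    -- with such a label is a neighbour. Flag 2 provides the fresh label.
    extend : ∀ {t v} → key v ≡ t → ∃ (λ e → Builds e (Below t) (E G) (lab (rank v))) →
             ∃[ e ] Builds e (λ u → Below t u ⊎ u ≡ v) (E G) (lab (rank v))
    extend {t} {v} refl (e , b) = add-vertex {z = tag (class v) 2F} J? (λ uw → E-sym G uw) (E-irrefl G refl) (<-irrefl refl)
      (λ { (u , _ , eq , _) → flagOf≢2 (rank u ≟ⁿ rank v) (proj₂ (combine-injective (class u) _ (class v) _ eq)) })
      (λ {u} _ eq → flagOf≢2 (rank u ≟ⁿ rank v) (proj₂ (combine-injective (class u) _ (class v) _ eq)))
      (λ {u} u<v → mk⇔ (λ uv → u , u<v , refl , uv) (λ { (u′ , u′<v , eq , u′v) → same u<v u′<v eq u′v }))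
      (λ _ → refl) b
      where
      J : Pred (Fin (K * 3)) 0ℓ
      J l = ∃[ u ] Below (key v) u × lab (rank v) u ≡ l × E G u v
      J? : Decidable J
      J? l = any? λ u → (key u <? key v) ×-dec (lab (rank v) u ≟ᶠ l) ×-dec E? G u v
      same : ∀ {u u′} → Below (key v) u → Below (key v) u′ → lab (rank v) u′ ≡ lab (rank v) u → E G u′ v → E G u v
      same {u} {u′} u<v u′<v eq = determined (λ { refl → <-irrefl refl u′<v }) (λ { refl → <-irrefl refl u<v })
        (proj₁ eqs) (Sum.swap (Sum.map id (λ (p , q) → ≤∧≢⇒< (key-rank (<⇒≤ u′<v)) p ,
                                                     ≤∧≢⇒< (key-rank (<⇒≤ u<v)) q) (flagOf-≡ (rank u′ ≟ⁿ rank v) (rank u ≟ⁿ rank v) (proj₂ eqs))))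
        where
        eqs : class u′ ≡ class u × flag (rank v) u′ ≡ flag (rank v) u
        eqs = combine-injective (class u′) _ (class u) _ eq

    below-suc : ∀ {t u} → key u ≢ t → Below (suc t) u → Below t u
    below-suc u≢t u<st = ≤∧≢⇒< (s≤s⁻¹ u<st) u≢t

    below-suc-≡ : ∀ {t u v} → key v ≡ t → Below (suc t) u → Below t u ⊎ u ≡ v
    below-suc-≡ {t} {u} {v} v≡t u<st with key u ≟ⁿ t
    ... | yes u≡t = inj₂ (key-injective (trans u≡t (sym v≡t)))
    ... | no u≢t  = inj₁ (below-suc u≢t u<st)

    -- The first alternative is there because no expression builds the empty graph. Values `t` that
    -- are not keys leave the stage as it is.
    stage : ∀ t → (∀ u → ¬ Below t u) ⊎ Stage t
    stage zero = inj₁ λ _ ()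
    stage (suc t) with stage t | any? (λ u → key u ≟ⁿ t)
    ... | inj₁ none | no ¬t = inj₁ λ u u<st → none u (below-suc (λ eq → ¬t (u , eq)) u<st)
    ... | inj₂ (r , (u₀ , u₀<t , u₀≡r) , ≤r , e , b) | no ¬t =
      inj₂ (r , (u₀ , <-trans u₀<t ≤-refl , u₀≡r) , ≤r ∘ shrink , e ,
            builds-cong b (λ v<t → <-trans v<t ≤-refl) shrink (λ _ _ → id) (λ _ _ → id) (λ _ → refl))
      where
      shrink : ∀ {u} → Below (suc t) u → Below t u
      shrink {u} = below-suc (λ eq → ¬t (u , eq))
    ... | inj₁ none | yes (v , v≡t) = inj₂ (rank v , (v , v<st , refl) , top , _ ,
        builds-cong (builds-vertex v refl (E-irrefl G refl)) (λ { refl → v<st }) only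
          (λ _ _ → id) (λ _ _ → id) (λ _ → refl))
      where
      v<st : Below (suc t) v
      v<st rewrite v≡t = ≤-refl
      only : ∀ {u} → Below (suc t) u → u ≡ v
      only u<st = [ (λ u<t → contradiction u<t (none _)) , id ]′ (below-suc-≡ v≡t u<st)
      top : ∀ {u} → Below (suc t) u → rank u ≤ rank v
      top u<st rewrite only u<st = ≤-refl
    ... | inj₂ (r , (u₀ , u₀<t , u₀≡r) , ≤r , b) | yes (v , v≡t)
      with extend v≡t (refresh ≤r (≤-trans (≤-reflexive (sym u₀≡r))
                                    (key-rank (<⇒≤ (<-≤-trans u₀<t (≤-reflexive (sym v≡t)))))) b)
    ...   | e , b′ = inj₂ (rank v , (v , v<st , refl) , top , e ,
        builds-cong b′ [ (λ u<t → <-trans u<t ≤-refl) , (λ { refl → v<st }) ]′ (below-suc-≡ v≡t)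
          (λ _ _ → id) (λ _ _ → id) (λ _ → refl))
      where
      v<st : Below (suc t) v
      v<st rewrite v≡t = ≤-refl
      top : ∀ {u} → Below (suc t) u → rank u ≤ rank v
      top {u} u<st = key-rank (≤-trans (s≤s⁻¹ u<st) (≤-reflexive (sym v≡t)))

  constructible-by-classes : V G → Constructible (K * 3) G
  constructible-by-classes v with strictBound key
  ... | t , all<t with stage t
  ...   | inj₁ none = contradiction (all<t v) (none v)
  ...   | inj₂ (_ , _ , _ , e , b) = e ,
    mk↔ₛ′ place (λ u → proj₁ (complete u (all<t u))) (λ u → proj₂ (complete u (all<t u)))
      (λ x → injective (proj₂ (complete (place x) (all<t (place x))))) ,
    λ _ _ → mk⇔ edge edge⁻¹
    where
    open Builds b

-- Forbidden induced subgraphs and clique cut-sets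

⟨_⟩ : Bool → Set → Set
⟨ true  ⟩ P = P
⟨ false ⟩ P = ¬ P

-- Injectivity comes from the table: identified vertices have equal rows, which a separating `k`
-- excludes. Only twins, whose rows agree, must be known to be distinct.
embed : ∀ {H G} (f : V H → V G) (Twin : Rel (V H) 0ℓ) →
        (∀ i j → i ≡ j ⊎ (∃[ k ] does (E? H i k) ≢ does (E? H j k)) ⊎ Twin i j) → (∀ {i j} → Twin i j → f i ≢ f j) →
        (∀ i j → ⟨ does (E? H i j) ⟩ (E G (f i) (f j))) → H ⊑ G
embed {H} {G} f Twin separated twins table = mk↣ injective , λ i j → mk⇔ (to i j) (from i j)
  where
  to : ∀ i j → E H i j → E G (f i) (f j)
  to i j ij = subst (λ b → ⟨ b ⟩ (E G (f i) (f j))) (dec-true (E? H i j) ij) (table i j)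
  from : ∀ i j → E G (f i) (f j) → E H i j
  from i j ij = decidable-stable (E? H i j) λ ¬ij →
    subst (λ b → ⟨ b ⟩ (E G (f i) (f j))) (dec-false (E? H i j) ¬ij) (table i j) ij
  injective : ∀ {i j} → f i ≡ f j → i ≡ j
  injective {i} {j} eq with separated i j
  ... | inj₁ i≡j = i≡j
  ... | inj₂ (inj₁ (k , i≢j)) = contradiction (does-⇔ (mk⇔
    (λ ik → from j k (subst (λ v → E G v (f k)) eq (to i k ik)))
    (λ jk → from i k (subst (λ v → E G v (f k)) (sym eq) (to j k jk))))
    (E? H i k) (E? H j k)) i≢j
  ... | inj₂ (inj₂ t) = contradiction eq (twins t)

2P₂ co-P₂+P₃ : Graph
2P₂      = 2 · P 2
co-P₂+P₃ = complement (P 2 ⊕ P 3)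

2P₂-in : ∀ {G a b c d} → E G a b → E G c d → ¬ E G a c → ¬ E G a d → ¬ E G b c → ¬ E G b d → 2P₂ ⊑ G
2P₂-in {G} {a} {b} {c} {d} ab cd ¬ac ¬ad ¬bc ¬bd =
  embed {2P₂} {G} f (λ _ _ → ⊥) (from-yes (all? λ i → all? λ j → (i ≟ᶠ j) ⊎-dec
    (any? (λ k → ¬? (does (E? 2P₂ i k) ≟ᵇ does (E? 2P₂ j k))) ⊎-dec no λ ()))) (λ ()) table
  where
  f : V 2P₂ → V G
  f 0F = a
  f 1F = b
  f 2F = c
  f 3F = d
  table : ∀ i j → ⟨ does (E? 2P₂ i j) ⟩ (E G (f i) (f j))
  table 0F 0F = E-irrefl G refl
  table 0F 1F = ab
  table 0F 2F = ¬ac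
  table 0F 3F = ¬ad
  table 1F 0F = E-sym G ab
  table 1F 1F = E-irrefl G refl
  table 1F 2F = ¬bc
  table 1F 3F = ¬bd
  table 2F 0F = ¬ac ∘ E-sym G
  table 2F 1F = ¬bc ∘ E-sym G
  table 2F 2F = E-irrefl G refl
  table 2F 3F = cd
  table 3F 0F = ¬ad ∘ E-sym G
  table 3F 1F = ¬bd ∘ E-sym G
  table 3F 2F = E-sym G cd
  table 3F 3F = E-irrefl G refl

-- The graph is a non-adjacent pair `a`, `b` complete to the edge `c`, `e` and the vertex `d` off
-- that edge. Only `a` and `b` are twins, whence the hypothesis `a ≢ b`.
co-P₂+P₃-in : ∀ {G a b c d e} → a ≢ b → ¬ E G a b → E G a c → E G a d → E G a e →
              E G b c → E G b d → E G b e → E G c e → ¬ E G c d → ¬ E G d e → co-P₂+P₃ ⊑ G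
co-P₂+P₃-in {G} {a} {b} {c} {d} {e} a≢b ¬ab ac ad ae bc bd be ce ¬cd ¬de =
  embed {co-P₂+P₃} {G} f Twin (from-yes (all? λ i → all? λ j → (i ≟ᶠ j) ⊎-dec
    (any? (λ k → ¬? (does (E? co-P₂+P₃ i k) ≟ᵇ does (E? co-P₂+P₃ j k))) ⊎-dec twin? i j)))
    (λ { (inj₁ (refl , refl)) → a≢b ; (inj₂ (refl , refl)) → ≢-sym a≢b }) table
  where
  Twin : Rel (V co-P₂+P₃) 0ℓ
  Twin i j = (i ≡ 0F × j ≡ 1F) ⊎ (i ≡ 1F × j ≡ 0F)
  twin? : ∀ i j → Dec (Twin i j)
  twin? i j = ((i ≟ᶠ 0F) ×-dec (j ≟ᶠ 1F)) ⊎-dec ((i ≟ᶠ 1F) ×-dec (j ≟ᶠ 0F))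
  f : V co-P₂+P₃ → V G
  f 0F = a
  f 1F = b
  f 2F = c
  f 3F = d
  f 4F = e
  table : ∀ i j → ⟨ does (E? co-P₂+P₃ i j) ⟩ (E G (f i) (f j))
  table 0F 0F = E-irrefl G refl
  table 0F 1F = ¬ab
  table 0F 2F = ac
  table 0F 3F = ad
  table 0F 4F = ae
  table 1F 0F = ¬ab ∘ E-sym G
  table 1F 1F = E-irrefl G refl
  table 1F 2F = bc
  table 1F 3F = bd
  table 1F 4F = be
  table 2F 0F = E-sym G ac
  table 2F 1F = E-sym G bc
  table 2F 2F = E-irrefl G refl
  table 2F 3F = ¬cd
  table 2F 4F = ce
  table 3F 0F = E-sym G ad
  table 3F 1F = E-sym G bd
  table 3F 2F = ¬cd ∘ E-sym G
  table 3F 3F = E-irrefl G refl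
  table 3F 4F = ¬de
  table 4F 0F = E-sym G ae
  table 4F 1F = E-sym G be
  table 4F 2F = E-sym G ce
  table 4F 3F = ¬de ∘ E-sym G
  table 4F 4F = E-irrefl G refl

-- Otherwise the neighbourhood of `v` is a clique, and deleting it separates `v` from `z`.
atom-neighbourhood : ∀ {G} → Atom G → ∀ {v z} → v ≢ z → ¬ E G v z →
                     ∃[ p ] ∃[ q ] E G v p × E G v q × p ≢ q × ¬ E G p q
atom-neighbourhood {G} atom {v} {z} v≢z ¬vz
  with any? (λ p → any? λ q → E? G v p ×-dec E? G v q ×-dec ¬? (p ≟ᶠ q) ×-dec ¬? (E? G p q))
... | yes found = found
... | no ¬found = ⊥-elim (atom (N , clique , λ connected → stuck (connected (∉N (E-irrefl G refl)) (∉N ¬vz))))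
  where
  N : Subset (order G)
  N = tabulate (does ∘ E? G v)
  N∋ : ∀ {u} → u ∈ N → E G v u
  N∋ {u} u∈ = decidable-stable (E? G v u) λ ¬vu → case
    trans (sym (dec-false (E? G v u) ¬vu)) (trans (sym (lookup∘tabulate (does ∘ E? G v) u)) ([]=⇒lookup u∈)) of λ ()
  ∉N : ∀ {u} → ¬ E G v u → u ∉ N
  ∉N ¬vu u∈ = ¬vu (N∋ u∈)
  ∈N : ∀ {u} → E G v u → u ∈ N
  ∈N {u} vu = lookup⇒[]= u N (trans (lookup∘tabulate (does ∘ E? G v) u) (dec-true (E? G v u) vu))
  clique : IsClique G N
  clique {p} {q} p∈ q∈ p≢q = decidable-stable (E? G p q) λ ¬pq → ¬found (p , q , N∋ p∈ , N∋ q∈ , p≢q , ¬pq)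
  stuck : ¬ Star (λ x y → x ∉ N × y ∉ N × E G x y) v z
  stuck ε = v≢z refl
  stuck ((_ , y∉ , vy) ◅ _) = y∉ (∈N vy)

-- Vertex classes given by bits

Bits : ∀ {A : Set} → ℕ → Rel A 0ℓ → Set
Bits {A} m R = Σ[ f ∈ (A → Fin m → Fin 2) ] (∀ {u v} → (∀ i → f u i ≡ f v i) → R u v)

bit : ∀ {P : Set} → Dec P → Fin 2
bit (yes _) = 1F
bit (no _)  = 0F

bit-≡ : ∀ {P Q : Set} (d : Dec P) (d′ : Dec Q) → bit d ≡ bit d′ → P → Q
bit-≡ _       (yes q) _  _ = q
bit-≡ (yes _) (no _)  () _
bit-≡ (no ¬p) _       _  p = contradiction p ¬p

bit-cong : ∀ {P Q : Set} (d : Dec P) (d′ : Dec Q) → (P → Q) → (Q → P) → bit d ≡ bit d′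
bit-cong (yes _) (yes _) _ _ = refl
bit-cong (no _)  (no _)  _ _ = refl
bit-cong (yes p) (no ¬q) f _ = contradiction (f p) ¬q
bit-cong (no ¬p) (yes q) _ g = contradiction (g q) ¬p

module _ {A : Set} where

  bits-pred : ∀ {P : Pred A 0ℓ} → Decidable P → Bits 1 (λ u v → P u ⇔ P v)
  bits-pred P? = (λ u _ → bit (P? u)) ,
    λ {u} {v} eq → mk⇔ (bit-≡ (P? u) (P? v) (eq 0F)) (bit-≡ (P? v) (P? u) (sym (eq 0F)))

  bits-× : ∀ {m n} {R S : Rel A 0ℓ} → Bits m R → Bits n S → Bits (m + n) (λ u v → R u v × S u v)
  bits-× {m} {n} (f , Rf) (g , Sg) = (λ u → [ f u , g u ]′ ∘ splitAt m) , λ {u} {v} eq →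
    Rf (λ i → subst (λ s → [ f u , g u ]′ s ≡ [ f v , g v ]′ s) (splitAt-↑ˡ m i n) (eq (i ↑ˡ n))) ,
    Sg (λ i → subst (λ s → [ f u , g u ]′ s ≡ [ f v , g v ]′ s) (splitAt-↑ʳ m n i) (eq (m ↑ʳ i)))

  bits-∀ : ∀ {m n} {R : Fin n → Rel A 0ℓ} → (∀ i → Bits m (R i)) → Bits (n * m) (λ u v → ∀ i → R i u v)
  bits-∀ {m} {n} b = (λ u → at u ∘ remQuot {n} m) , λ {u} {v} eq i → proj₂ (b i) λ j →
    subst (λ p → at u p ≡ at v p) (remQuot-combine i j) (eq (combine i j))
    where
    at : A → Fin n × Fin m → Fin 2
    at u (i , j) = proj₁ (b i) u j

-- Numbers of bits add up over the components of `R`; they are turned into one of 2 ^ m classes only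
-- here.
constructible-by-bits : ∀ G {m} {R : Rel (V G) 0ℓ} → Bits m R → (rank : V G → ℕ) →
  (∀ {u u′ v} → u ≢ v → u′ ≢ v → R u u′ →
     (rank u < rank v × rank u′ < rank v) ⊎ (rank u ≡ rank v × rank u′ ≡ rank v) → E G u v → E G u′ v) →
  V G → Constructible (2 ^ m * 3) G
constructible-by-bits G (f , Rf) rank determined = constructible-by-classes G (funToFin ∘ f) rank
  λ u≢v u′≢v eq → determined u≢v u′≢v (Rf λ i →
    trans (sym (finToFun-funToFin (f _) i)) (trans (cong (λ c → finToFun c i) eq) (finToFun-funToFin (f _) i)))

-- The structure around an induced C₄

module Structure (G : Graph) (2P₂⋢G : ¬ 2P₂ ⊑ G) (H⋢G : ¬ co-P₂+P₃ ⊑ G) where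

  infix 4 _∼_ _≁_

  _∼_ _≁_ : Rel (V G) 0ℓ
  _∼_ = E G
  u ≁ v = ¬ u ∼ v

  _∼?_ : ∀ u v → Dec (u ∼ v)
  _∼?_ = E? G

  private variable
    a b c d e u v w y z : V G

  flip : u ∼ v → v ∼ u
  flip = E-sym G

  flip≁ : u ≁ v → v ≁ u
  flip≁ u≁v = u≁v ∘ flip

  separated : c ∼ u → c ≁ v → u ≢ v
  separated cu ¬cv refl = ¬cv cu

  no-2P₂ : a ∼ b → c ∼ d → a ≁ c → a ≁ d → b ≁ c → b ≁ d → ⊥
  no-2P₂ ab cd ¬ac ¬ad ¬bc ¬bd = 2P₂⋢G (2P₂-in {G} ab cd ¬ac ¬ad ¬bc ¬bd)

  Common : V G → V G → Pred (V G) 0ℓ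
  Common a b c = a ∼ c × b ∼ c

  -- The common neighbourhood of two non-adjacent vertices is complete multipartite.
  multipartite : a ≢ b → a ≁ b → Common a b c → Common a b d → Common a b e → c ∼ e → c ≁ d → d ∼ e
  multipartite a≢b ¬ab (ac , bc) (ad , bd) (ae , be) ce ¬cd = decidable-stable (_ ∼? _) λ ¬de →
    H⋢G (co-P₂+P₃-in {G} a≢b ¬ab ac ad ae bc bd be ce ¬cd ¬de)

  -- Each vertex of `Y` has at most one neighbour in `X`, so two edges with different ends in `X`
  -- would form a 2P₂. `default` stands in when there is no edge.
  unique-contact : ∀ {X Y : Pred (V G) 0ℓ} → Decidable X → Decidable Y →
    (∀ {u v} → X u → X v → u ≁ v) → (∀ {u v} → Y u → Y v → u ≁ v) →
    (∀ {u v y} → X u → X v → Y y → y ∼ u → y ∼ v → u ≡ v) →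
    V G → ∃[ s ] (∀ {x y} → X x → Y y → y ∼ x → x ≡ s)
  unique-contact {X} {Y} X? Y? X-indep Y-indep one default
    with any? (λ x → any? λ y → X? x ×-dec Y? y ×-dec (y ∼? x))
  ... | no none = default , λ {x} {y} Xx Yy yx → contradiction (x , y , Xx , Yy , yx) none
  ... | yes (s , y′ , Xs , Yy′ , y′s) = s , same
    where
    same : ∀ {x y} → X x → Y y → y ∼ x → x ≡ s
    same {x} {y} Xx Yy yx with x ≟ᶠ s
    ... | yes x≡s = x≡s
    ... | no x≢s = ⊥-elim (no-2P₂ yx y′s (Y-indep Yy Yy′) (λ ys → x≢s (one Xx Xs Yy yx ys))
                            (λ xy′ → x≢s (one Xx Xs Yy′ (flip xy′) y′s)) (X-indep Xx Xs))

  -- For an exceptional vertex `s`: this gives `s` a class of its own and records the adjacency to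
  -- it.
  SameAt : V G → Rel (V G) 0ℓ
  SameAt s u v = (u ≡ s ⇔ v ≡ s) × (u ∼ s ⇔ v ∼ s)

  sameAt : ∀ s → Bits 2 (SameAt s)
  sameAt s = bits-× (bits-pred (_≟ᶠ s)) (bits-pred (_∼? s))

  record Square (x₁ x₂ x₃ x₄ : V G) : Set where
    field
      x₁₂   : x₁ ∼ x₂
      x₂₃   : x₂ ∼ x₃
      x₃₄   : x₃ ∼ x₄
      x₄₁   : x₄ ∼ x₁
      x₁≁x₃ : x₁ ≁ x₃
      x₂≁x₄ : x₂ ≁ x₄
      x₁≢x₃ : x₁ ≢ x₃
      x₂≢x₄ : x₂ ≢ x₄

  square? : ∀ x₁ x₂ x₃ x₄ → Dec (Square x₁ x₂ x₃ x₄)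
  square? x₁ x₂ x₃ x₄ = map′
    (λ (e₁₂ , e₂₃ , e₃₄ , e₄₁ , n₁₃ , n₂₄ , d₁₃ , d₂₄) → record
      { x₁₂ = e₁₂ ; x₂₃ = e₂₃ ; x₃₄ = e₃₄ ; x₄₁ = e₄₁ ; x₁≁x₃ = n₁₃ ; x₂≁x₄ = n₂₄ ; x₁≢x₃ = d₁₃ ; x₂≢x₄ = d₂₄ })
    fields
    ((x₁ ∼? x₂) ×-dec (x₂ ∼? x₃) ×-dec (x₃ ∼? x₄) ×-dec (x₄ ∼? x₁) ×-dec
     ¬? (x₁ ∼? x₃) ×-dec ¬? (x₂ ∼? x₄) ×-dec ¬? (x₁ ≟ᶠ x₃) ×-dec ¬? (x₂ ≟ᶠ x₄))
    where
    fields : Square x₁ x₂ x₃ x₄ → _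
    fields sq = x₁₂ , x₂₃ , x₃₄ , x₄₁ , x₁≁x₃ , x₂≁x₄ , x₁≢x₃ , x₂≢x₄
      where
      open Square sq

  HasSquare : Set
  HasSquare = ∃[ x₁ ] ∃[ x₂ ] ∃[ x₃ ] ∃[ x₄ ] Square x₁ x₂ x₃ x₄

  hasSquare? : Dec HasSquare
  hasSquare? = any? λ x₁ → any? λ x₂ → any? λ x₃ → any? λ x₄ → square? x₁ x₂ x₃ x₄

  rotate : ∀ {x₁ x₂ x₃ x₄} → Square x₁ x₂ x₃ x₄ → Square x₂ x₃ x₄ x₁
  rotate sq = record
    { x₁₂ = x₂₃ ; x₂₃ = x₃₄ ; x₃₄ = x₄₁ ; x₄₁ = x₁₂
    ; x₁≁x₃ = x₂≁x₄ ; x₂≁x₄ = flip≁ x₁≁x₃ ; x₁≢x₃ = x₂≢x₄ ; x₂≢x₄ = ≢-sym x₁≢x₃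
    }
    where
    open Square sq

  -- One side of the C₄: common neighbours of x₁ and x₃ against vertices missing both

  module Side {x₁ x₂ x₃ x₄ : V G} (sq : Square x₁ x₂ x₃ x₄) where

    open Square sq

    A Z W : Pred (V G) 0ℓ
    A u = u ∼ x₁ × u ∼ x₃ × u ≁ x₂ × u ≁ x₄
    Z u = u ≁ x₁ × u ≁ x₃
    W u = u ∼ x₁ × u ∼ x₃ × u ∼ x₂ × u ∼ x₄

    A? : Decidable A
    A? u = (u ∼? x₁) ×-dec (u ∼? x₃) ×-dec ¬? (u ∼? x₂) ×-dec ¬? (u ∼? x₄)

    Z? : Decidable Z
    Z? u = ¬? (u ∼? x₁) ×-dec ¬? (u ∼? x₃)

    x₂∈A : A x₂
    x₂∈A = flip x₁₂ , x₂₃ , E-irrefl G refl , x₂≁x₄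

    x₄∈A : A x₄
    x₄∈A = x₄₁ , flip x₃₄ , flip≁ x₂≁x₄ , E-irrefl G refl

    common₁₃ : u ∼ x₁ → u ∼ x₃ → Common x₁ x₃ u
    common₁₃ u1 u3 = flip u1 , flip u3

    parts₁₃ : u ∼ x₁ → u ∼ x₃ → v ∼ x₁ → v ∼ x₃ → w ∼ x₁ → w ∼ x₃ → u ∼ w → u ≁ v → v ∼ w
    parts₁₃ u1 u3 v1 v3 w1 w3 = multipartite x₁≢x₃ x₁≁x₃ (common₁₃ u1 u3) (common₁₃ v1 v3) (common₁₃ w1 w3)

    -- `x₂` and `x₄` lie in the same part of the complete multipartite graph on the common
    -- neighbours of `x₁` and `x₃`.
    A-or-W : u ∼ x₁ → u ∼ x₃ → A u ⊎ W u
    A-or-W {u} u1 u3 with u ∼? x₂ | u ∼? x₄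
    ... | yes u2 | yes u4 = inj₂ (u1 , u3 , u2 , u4)
    ... | no ¬u2 | no ¬u4 = inj₁ (u1 , u3 , ¬u2 , ¬u4)
    ... | yes u2 | no ¬u4 = contradiction
      (flip (parts₁₃ (flip x₁₂) x₂₃ x₄₁ (flip x₃₄) u1 u3 (flip u2) x₂≁x₄)) ¬u4
    ... | no ¬u2 | yes u4 = contradiction
      (flip (parts₁₃ x₄₁ (flip x₃₄) (flip x₁₂) x₂₃ u1 u3 (flip u4) (flip≁ x₂≁x₄))) ¬u2

    -- `A` is the part of `x₂` and `x₄` among these common neighbours, and `W` consists of the other
    -- parts.
    A-indep : A u → A v → u ≁ v
    A-indep (u1 , u3 , ¬u2 , _) (v1 , v3 , ¬v2 , _) uv =
      ¬v2 (flip (parts₁₃ u1 u3 (flip x₁₂) x₂₃ v1 v3 uv ¬u2))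

    A-W : A u → W w → u ∼ w
    A-W (u1 , u3 , ¬u2 , _) (w1 , w3 , w2 , _) = parts₁₃ (flip x₁₂) x₂₃ u1 u3 w1 w3 (flip w2) (flip≁ ¬u2)

    W-parts : W u → W v → W w → u ∼ w → u ≁ v → v ∼ w
    W-parts (u1 , u3 , _) (v1 , v3 , _) (w1 , w3 , _) = parts₁₃ u1 u3 v1 v3 w1 w3

    -- Among the common neighbours of `u` and `v`, `x₁` and `x₃` lie in the same part, so `w` is
    -- adjacent to both or to neither.
    A-share : A u → A v → u ∼ w → v ∼ w → u ≢ v → w ∼ x₁ ⊎ w ∼ x₃ → w ∼ x₁ × w ∼ x₃
    A-share Au@(u1 , u3 , _) Av@(v1 , v3 , _) uw vw u≢v (inj₁ w1) = w1 ,
      flip (multipartite u≢v (A-indep Au Av) (u1 , v1) (u3 , v3) (uw , vw) (flip w1) x₁≁x₃)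
    A-share Au@(u1 , u3 , _) Av@(v1 , v3 , _) uw vw u≢v (inj₂ w3) =
      flip (multipartite u≢v (A-indep Au Av) (u3 , v3) (u1 , v1) (uw , vw) (flip w3) (flip≁ x₁≁x₃)) , w3

    -- Two neighbours in `A` are a non-adjacent pair to which `multipartite` applies; with at most
    -- one, `unique-contact` applies.
    Big : Pred (V G) 0ℓ
    Big u = ∃[ a ] ∃[ b ] A a × A b × a ≢ b × u ∼ a × u ∼ b

    Big? : Decidable Big
    Big? u = any? λ a → any? λ b → A? a ×-dec A? b ×-dec ¬? (a ≟ᶠ b) ×-dec (u ∼? a) ×-dec (u ∼? b)

    big-balanced : Big u → u ∼ x₁ ⊎ u ∼ x₃ → u ∼ x₁ × u ∼ x₃
    big-balanced (a , b , Aa , Ab , a≢b , ua , ub) = A-share Aa Ab (flip ua) (flip ub) a≢b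

    big-Z : Big u → u ≁ x₁ ⊎ u ≁ x₃ → Z u
    big-Z Bu (inj₁ ¬u1) = ¬u1 , (λ u3 → ¬u1 (proj₁ (big-balanced Bu (inj₂ u3))))
    big-Z Bu (inj₂ ¬u3) = (λ u1 → ¬u3 (proj₂ (big-balanced Bu (inj₁ u1)))) , ¬u3

    small-one : ¬ Big u → A a → A b → u ∼ a → u ∼ b → a ≡ b
    small-one {u} {a} {b} ¬Bu Aa Ab ua ub with a ≟ᶠ b
    ... | yes a≡b = a≡b
    ... | no a≢b  = contradiction (a , b , Aa , Ab , a≢b , ua , ub) ¬Bu

    -- Among the common neighbours of `a` and `b`, `u` lies in the part of `x₁` and `w` does not.
    big-W : Z u → Big u → W w → u ∼ w
    big-W (¬u1 , _) (a , b , Aa , Ab , a≢b , ua , ub) Ww@(w1 , _) =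
      multipartite a≢b (A-indep Aa Ab) (proj₁ Aa , proj₁ Ab) (flip ua , flip ub)
        (A-W Aa Ww , A-W Ab Ww) (flip w1) (flip≁ ¬u1)

    -- If `a` and `b` differ, `x₁` is a third common neighbour beside `u` and `v`; it is in the part
    -- of `u`, hence adjacent to `v`.
    Z-share : Z u → Z v → u ∼ v → A a → A b → u ∼ a → u ∼ b → v ∼ a → v ∼ b → a ≡ b
    Z-share {u} {v} {a} {b} (¬u1 , _) (¬v1 , _) uv Aa Ab ua ub va vb with a ≟ᶠ b
    ... | yes a≡b = a≡b
    ... | no a≢b = contradiction (flip (multipartite a≢b (A-indep Aa Ab) (flip ua , flip ub)
                     (proj₁ Aa , proj₁ Ab) (flip va , flip vb) uv ¬u1)) ¬v1

    nested : u ≁ v → A a → A b → u ∼ a → v ∼ b → v ≁ a → u ∼ b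
    nested ¬uv Aa Ab ua vb ¬va = decidable-stable (_ ∼? _) λ ¬ub →
      no-2P₂ ua vb ¬uv ¬ub (flip≁ ¬va) (A-indep Aa Ab)

    -- The order 0 < 1 < 2 < 3 of the levels is chosen such that a vertex of higher
    -- level has a neighbour among x₂, x₄ that a vertex of lower level lacks.
    levelOf : ∀ {P Q : Set} → Dec P → Dec Q → Fin 4
    levelOf (no _)  (no _)  = 0F
    levelOf (yes _) (no _)  = 1F
    levelOf (no _)  (yes _) = 2F
    levelOf (yes _) (yes _) = 3F

    zlevel : V G → Fin 4
    zlevel u = levelOf (u ∼? x₂) (u ∼? x₄)

    Zₗ : Fin 4 → Pred (V G) 0ℓ
    Zₗ i u = Z u × zlevel u ≡ i

    Zₗ? : ∀ i → Decidable (Zₗ i)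
    Zₗ? i u = Z? u ×-dec (zlevel u ≟ᶠ i)

    -- If both miss `x₂` or both miss `x₄`, the edge `uv` and an edge at `x₁` form a 2P₂. Otherwise
    -- `u`, `v` and `x₁` are common neighbours of `x₂` and `x₄`, and `x₁` would be adjacent to `v`.
    Z-same-level : Z u → Z v → zlevel u ≡ zlevel v → u ≁ v
    Z-same-level {u} {v} (¬u1 , ¬u3) (¬v1 , ¬v3) eq uv
      with u ∼? x₂ | u ∼? x₄ | v ∼? x₂ | v ∼? x₄
    ... | no ¬u2 | _      | no ¬v2 | _      = no-2P₂ uv x₁₂ ¬u1 ¬u2 ¬v1 ¬v2
    ... | _      | no ¬u4 | _      | no ¬v4 = no-2P₂ uv x₄₁ ¬u4 ¬u1 ¬v4 ¬v1
    ... | yes u2 | yes u4 | yes v2 | yes v4 = ¬v1 (flip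
      (multipartite x₂≢x₄ x₂≁x₄ (flip u2 , flip u4) (flip x₁₂ , x₄₁) (flip v2 , flip v4) uv ¬u1))
    Z-same-level _ _ () uv | no _ | no _ | yes _ | yes _
    Z-same-level _ _ () uv | no _ | yes _ | yes _ | no _
    Z-same-level _ _ () uv | no _ | yes _ | yes _ | yes _
    Z-same-level _ _ () uv | yes _ | no _ | no _ | yes _
    Z-same-level _ _ () uv | yes _ | no _ | yes _ | yes _
    Z-same-level _ _ () uv | yes _ | yes _ | no _ | no _
    Z-same-level _ _ () uv | yes _ | yes _ | no _ | yes _
    Z-same-level _ _ () uv | yes _ | yes _ | yes _ | no _

    level-witness : ∀ u v → zlevel u Fin.< zlevel v → ∃[ x ] A x × v ∼ x × u ≁ x
    level-witness u v lt with u ∼? x₂ | u ∼? x₄ | v ∼? x₂ | v ∼? x₄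
    ... | no ¬u2 | _      | yes v2 | _      = x₂ , x₂∈A , v2 , ¬u2
    ... | _      | no ¬u4 | _      | yes v4 = x₄ , x₄∈A , v4 , ¬u4
    level-witness u v () | no _ | no _ | no _ | no _
    level-witness u v () | yes _ | no _ | no _ | no _
    level-witness u v (s≤s ()) | yes _ | no _ | yes _ | no _
    level-witness u v () | no _ | yes _ | no _ | no _
    level-witness u v (s≤s (s≤s ())) | no _ | yes _ | no _ | yes _
    level-witness u v () | yes _ | yes _ | no _ | no _
    level-witness u v (s≤s ()) | yes _ | yes _ | yes _ | no _
    level-witness u v (s≤s (s≤s ())) | yes _ | yes _ | no _ | yes _
    level-witness u v (s≤s (s≤s (s≤s ()))) | yes _ | yes _ | yes _ | yes _

    -- The neighbourhoods in A of big vertices of Z are nested or share at most one vertex.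
    -- Hence the union of those of level i is, apart from one vertex, complete or
    -- anticomplete to each vertex of a higher level, and Hit i tells which.
    Hit : Fin 4 → Pred (V G) 0ℓ
    Hit i u = ∃[ z ] Zₗ i z × Big z × z ∼ u

    Hit? : ∀ i → Decidable (Hit i)
    Hit? i u = any? λ z → Zₗ? i z ×-dec Big? z ×-dec (z ∼? u)

    -- Non-adjacent vertices have nested neighbourhoods in `A`; the corner that `z` sees and `y`
    -- misses gives the direction.
    grows : Z y → Z z → zlevel y Fin.< zlevel z → y ≁ z → A a → y ∼ a → z ∼ a
    grows {y} {z} Zy Zz y<z ¬yz Aa ya with level-witness y z y<z
    ... | x , Ax , zx , ¬yx = nested (flip≁ ¬yz) Ax Aa zx ya ¬yx

    escape : Big y → Z y → Z z → y ∼ z → ∃[ a ] A a × y ∼ a × z ≁ a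
    escape {y} {z} (a , b , Aa , Ab , a≢b , ya , yb) Zy Zz yz with z ∼? a | z ∼? b
    ... | no ¬za | _      = a , Aa , ya , ¬za
    ... | _      | no ¬zb = b , Ab , yb , ¬zb
    ... | yes za | yes zb = contradiction (Z-share Zy Zz yz Aa Ab ya yb za zb) a≢b

    -- Suppose `y` is not adjacent to `z`. Its neighbourhood in `A` then lies in that of `z` and,
    -- because of a neighbour `c` of `y′` missed by `z`, also in that of `y′`. So the adjacent `y′`
    -- and `z` share `a` and `b`, against `Z-share`.
    hit-all : ∀ {i} → Zₗ i y → Big y → Z z → i Fin.< zlevel z → Hit i z → y ∼ z
    hit-all {y} {z} (Zy , refl) (a , b , Aa , Ab , a≢b , ya , yb) Zz y<z (y′ , (Zy′ , y′≡y) , By′ , y′z) =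
      decidable-stable (y ∼? z) λ ¬yz → let
        inherits = λ {c} (Ac : A c) (yc : y ∼ c) → grows Zy Zz y<z ¬yz Ac yc
        c , Ac , y′c , ¬zc = escape By′ Zy′ Zz y′z
        absorbs = λ {d} (Ad : A d) (yd : y ∼ d) → decidable-stable (y′ ∼? d) λ ¬y′d →
          ¬zc (inherits Ac (nested (Z-same-level Zy Zy′ (sym y′≡y)) Ad Ac yd y′c ¬y′d))
      in a≢b (Z-share Zy′ Zz y′z Aa Ab (absorbs Aa ya) (absorbs Ab yb) (inherits Aa ya) (inherits Ab yb))

    unhit-complete : ∀ {i} → A a → Hit i a → Z z → i Fin.< zlevel z → ¬ Hit i z → z ∼ a
    unhit-complete Aa (y , (Zy , refl) , By , ya) Zz y<z ¬hit =
      grows Zy Zz y<z (λ yz → ¬hit (y , (Zy , refl) , By , yz)) Aa ya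

    -- Of the vertices hitting `a` and `b`, one is adjacent to both by nestedness. It is adjacent to
    -- `z` by `hit-all`, and `Z-share` applies.
    hit-one : ∀ {i} → A a → Hit i a → A b → Hit i b → Z z → i Fin.< zlevel z → Hit i z → z ∼ a → z ∼ b → a ≡ b
    hit-one {a} {b} Aa (y , Ly@(Zy , y≡) , By , ya) Ab (y′ , Ly′@(Zy′ , y′≡) , By′ , y′b) Zz i<z hit za zb
      with y ∼? b
    ... | yes yb = Z-share Zy Zz (hit-all Ly By Zz i<z hit) Aa Ab ya yb za zb
    ... | no ¬yb = Z-share Zy′ Zz (hit-all Ly′ By′ Zz i<z hit) Aa Ab
      (nested (Z-same-level Zy′ Zy (trans y′≡ (sym y≡))) Ab Aa y′b ya ¬yb) y′b za zb

    -- The vertex exists for all `i` and `j`, so that classes can refer to it uniformly; `x₁` is a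
    -- dummy value.
    hit-contact : ∀ i j → ∃[ s ] (i Fin.< j → ∀ {a z} → A a × Hit i a → Zₗ j z × Hit i z → z ∼ a → a ≡ s)
    hit-contact i j = decide (i <?ᶠ j)
      where
      decide : Dec (i Fin.< j) →
               ∃[ s ] (i Fin.< j → ∀ {a z} → A a × Hit i a → Zₗ j z × Hit i z → z ∼ a → a ≡ s)
      decide (no i≮j)  = x₁ , λ i<j → contradiction i<j i≮j
      decide (yes i<j) = proj₁ contact , λ _ → proj₂ contact
        where
        contact : ∃[ s ] (∀ {a z} → A a × Hit i a → Zₗ j z × Hit i z → z ∼ a → a ≡ s)
        contact = unique-contact (λ a → A? a ×-dec Hit? i a) (λ z → Zₗ? j z ×-dec Hit? i z)
          (λ (Au , _) (Av , _) → A-indep Au Av)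
          (λ ((Zu , u≡) , _) ((Zv , v≡) , _) → Z-same-level Zu Zv (trans u≡ (sym v≡)))
          (λ { (Au , Hu) (Av , Hv) ((Zz , refl) , Hz) → hit-one Au Hu Av Hv Zz i<j Hz }) x₁

    Type : (p q r s : Fin 2) → Pred (V G) 0ℓ
    Type p q r s u = bit (u ∼? x₁) ≡ p × bit (u ∼? x₂) ≡ q × bit (u ∼? x₃) ≡ r × bit (u ∼? x₄) ≡ s

    Type? : ∀ p q r s → Decidable (Type p q r s)
    Type? p q r s u = (_ ≟ᶠ p) ×-dec (_ ≟ᶠ q) ×-dec (_ ≟ᶠ r) ×-dec (_ ≟ᶠ s)

    record SameType (u v : V G) : Set where
      field
        same₁ : u ∼ x₁ ⇔ v ∼ x₁
        same₂ : u ∼ x₂ ⇔ v ∼ x₂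
        same₃ : u ∼ x₃ ⇔ v ∼ x₃
        same₄ : u ∼ x₄ ⇔ v ∼ x₄

    type-same : ∀ {p q r s} → Type p q r s u → Type p q r s v → SameType u v
    type-same (p , q , r , s) (p′ , q′ , r′ , s′) = record
      { same₁ = same p p′ ; same₂ = same q q′ ; same₃ = same r r′ ; same₄ = same s s′ }
      where
      same : ∀ {w b} → bit (u ∼? w) ≡ b → bit (v ∼? w) ≡ b → u ∼ w ⇔ v ∼ w
      same eq eq′ = mk⇔ (bit-≡ (_ ∼? _) (_ ∼? _) (trans eq (sym eq′)))
                        (bit-≡ (_ ∼? _) (_ ∼? _) (trans eq′ (sym eq)))

    same-type : SameType u v → Type (bit (u ∼? x₁)) (bit (u ∼? x₂)) (bit (u ∼? x₃)) (bit (u ∼? x₄)) v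
    same-type st = sym (same same₁) , sym (same same₂) , sym (same same₃) , sym (same same₄)
      where
      open SameType st
      same : ∀ {w} → u ∼ w ⇔ v ∼ w → bit (u ∼? w) ≡ bit (v ∼? w)
      same eqv = bit-cong (_ ∼? _) (_ ∼? _) (Equivalence.to eqv) (Equivalence.from eqv)

    same-A : SameType u v → A u → A v
    same-A st (u1 , u3 , ¬u2 , ¬u4) = Equivalence.to same₁ u1 , Equivalence.to same₃ u3 ,
      ¬u2 ∘ Equivalence.from same₂ , ¬u4 ∘ Equivalence.from same₄
      where
      open SameType st

    same-zlevel : SameType u v → zlevel u ≡ zlevel v
    same-zlevel {u} {v} st with u ∼? x₂ | u ∼? x₄ | v ∼? x₂ | v ∼? x₄ | SameType.same₂ st | SameType.same₄ st
    ... | yes _  | yes _  | yes _  | yes _  | _ | _ = refl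
    ... | yes _  | no _   | yes _  | no _   | _ | _ = refl
    ... | no _   | yes _  | no _   | yes _  | _ | _ = refl
    ... | no _   | no _   | no _   | no _   | _ | _ = refl
    ... | yes p  | _      | no ¬p  | _      | s | _ = contradiction (Equivalence.to s p) ¬p
    ... | no ¬p  | _      | yes p  | _      | s | _ = contradiction (Equivalence.from s p) ¬p
    ... | _      | yes p  | _      | no ¬p  | _ | s = contradiction (Equivalence.to s p) ¬p
    ... | _      | no ¬p  | _      | yes p  | _ | s = contradiction (Equivalence.from s p) ¬p

    -- A type missing an edge of the square gives a 2P₂. Any other type contains `x₂` and `x₄`,
    -- which makes `u` big, or `x₁` and `x₃` but not both `x₂` and `x₄`, which puts `u` and `v` into
    -- `A`.
    small-type-indep : SameType u v → ¬ Big u → u ≁ v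
    small-type-indep {u} {v} st ¬Bu uv with u ∼? x₁ | u ∼? x₂ | u ∼? x₃ | u ∼? x₄
    ... | _      | yes u2 | _      | yes u4 = ¬Bu (x₂ , x₄ , x₂∈A , x₄∈A , x₂≢x₄ , u2 , u4)
    ... | no ¬u1 | no ¬u2 | _      | _      = no-2P₂ uv x₁₂ ¬u1 ¬u2 (¬u1 ∘ Equivalence.from same₁) (¬u2 ∘ Equivalence.from same₂)
      where
      open SameType st
    ... | no ¬u1 | _      | _      | no ¬u4 = no-2P₂ uv x₄₁ ¬u4 ¬u1 (¬u4 ∘ Equivalence.from same₄) (¬u1 ∘ Equivalence.from same₁)
      where
      open SameType st
    ... | _      | no ¬u2 | no ¬u3 | _      = no-2P₂ uv x₂₃ ¬u2 ¬u3 (¬u2 ∘ Equivalence.from same₂) (¬u3 ∘ Equivalence.from same₃)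
      where
      open SameType st
    ... | _      | _      | no ¬u3 | no ¬u4 = no-2P₂ uv x₃₄ ¬u3 ¬u4 (¬u3 ∘ Equivalence.from same₃) (¬u4 ∘ Equivalence.from same₄)
      where
      open SameType st
    ... | yes u1 | no ¬u2 | yes u3 | _ = [ (λ Au → A-indep Au (same-A st Au) uv) , (λ (_ , _ , u2 , _) → ¬u2 u2) ]′ (A-or-W u1 u3)
    ... | yes u1 | _ | yes u3 | no ¬u4 = [ (λ Au → A-indep Au (same-A st Au) uv) , (λ (_ , _ , _ , u4) → ¬u4 u4) ]′ (A-or-W u1 u3)

    small-contact : ∀ p q r s → ∃[ t ] (∀ {a u} → A a → Type p q r s u × ¬ Big u → u ∼ a → a ≡ t)
    small-contact p q r s = unique-contact A? (λ u → Type? p q r s u ×-dec ¬? (Big? u)) A-indep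
      (λ (Tu , ¬Bu) (Tv , _) → small-type-indep (type-same Tu Tv) ¬Bu)
      (λ Aa Ab (_ , ¬Bu) ua ub → small-one ¬Bu Aa Ab ua ub) x₁

    same-contact : SameType u v → ¬ Big v → ¬ Big u → A a → A b → v ∼ a → u ∼ b → a ≡ b
    same-contact {u} {v} {a} {b} st ¬Bv ¬Bu Aa Ab va ub = trans (only Aa (same-type st , ¬Bv) va)
      (sym (only Ab ((refl , refl , refl , refl) , ¬Bu) ub))
      where
      only = λ {a w} → proj₂ (small-contact (bit (u ∼? x₁)) (bit (u ∼? x₂)) (bit (u ∼? x₃)) (bit (u ∼? x₄))) {a} {w}

    Contact : Pred (V G) 0ℓ
    Contact u = (∃[ i ] ∃[ j ] u ≡ proj₁ (hit-contact i j)) ⊎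
                (∃[ p ] ∃[ q ] ∃[ r ] ∃[ s ] u ≡ proj₁ (small-contact p q r s))

    Contact? : Decidable Contact
    Contact? u = (any? λ i → any? λ j → u ≟ᶠ _) ⊎-dec (any? λ p → any? λ q → any? λ r → any? λ s → u ≟ᶠ _)

    small-nonadjacent : A a → ¬ Contact a → ¬ Big u → u ≁ a
    small-nonadjacent {a} {u} Aa ¬Ca ¬Bu ua =
      ¬Ca (inj₂ (_ , _ , _ , _ , proj₂ (small-contact _ _ _ _) Aa ((refl , refl , refl , refl) , ¬Bu) ua))

    -- The least i with Hit i a, and 3 if there is none below 3.  Contacts aside, a vertex
    -- of Z of another level is adjacent to a or not by its level and its hits alone;
    -- within level a, the neighbourhoods in A form a chain.
    levelIn : ∀ {P Q R : Set} → Dec P → Dec Q → Dec R → Fin 4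
    levelIn (yes _) _       _       = 0F
    levelIn (no _)  (yes _) _       = 1F
    levelIn (no _)  (no _)  (yes _) = 2F
    levelIn (no _)  (no _)  (no _)  = 3F

    level : V G → Fin 4
    level a = levelIn (Hit? 0F a) (Hit? 1F a) (Hit? 2F a)

    level-hit : ∀ a → level a ≢ 3F → Hit (level a) a
    level-hit a ≢3 with Hit? 0F a | Hit? 1F a | Hit? 2F a
    ... | yes h | _     | _     = h
    ... | no _  | yes h | _     = h
    ... | no _  | no _  | yes h = h
    ... | no _  | no _  | no _  = contradiction refl ≢3

    level-least : ∀ {i} a → i Fin.< level a → ¬ Hit i a
    level-least {i} a i<l with Hit? 0F a | Hit? 1F a | Hit? 2F a
    level-least {0F} a _ | no ¬h | _ | _ = ¬h
    level-least {1F} a _ | no _ | no ¬h | _ = ¬h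
    level-least {2F} a _ | no _ | no _ | no ¬h = ¬h
    level-least {_} a () | yes _ | _ | _
    level-least {1F} a (s≤s ()) | no _ | yes _ | _
    level-least {2F} a (s≤s ()) | no _ | yes _ | _
    level-least {3F} a (s≤s ()) | no _ | yes _ | _
    level-least {2F} a (s≤s (s≤s ())) | no _ | no _ | yes _
    level-least {3F} a (s≤s (s≤s ())) | no _ | no _ | yes _
    level-least {3F} a (s≤s (s≤s (s≤s ()))) | no _ | no _ | no _

    level-cong : (∀ i → Hit i u ⇔ Hit i v) → level u ≡ level v
    level-cong {u} {v} hits with Hit? 0F u | Hit? 0F v | Hit? 1F u | Hit? 1F v | Hit? 2F u | Hit? 2F v
    ... | yes _ | yes _ | _     | _     | _     | _     = refl
    ... | no _  | no _  | yes _ | yes _ | _     | _     = refl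
    ... | no _  | no _  | no _  | no _  | yes _ | yes _ = refl
    ... | no _  | no _  | no _  | no _  | no _  | no _  = refl
    ... | yes h | no ¬h | _     | _     | _     | _     = contradiction (Equivalence.to (hits 0F) h) ¬h
    ... | no ¬h | yes h | _     | _     | _     | _     = contradiction (Equivalence.from (hits 0F) h) ¬h
    ... | _     | _     | yes h | no ¬h | _     | _     = contradiction (Equivalence.to (hits 1F) h) ¬h
    ... | _     | _     | no ¬h | yes h | _     | _     = contradiction (Equivalence.from (hits 1F) h) ¬h
    ... | _     | _     | _     | _     | yes h | no ¬h = contradiction (Equivalence.to (hits 2F) h) ¬h
    ... | _     | _     | _     | _     | no ¬h | yes h = contradiction (Equivalence.from (hits 2F) h) ¬h

    ranks : ∀ i → Σ[ ρ ∈ (V G → ℕ) ] Σ[ σ ∈ (V G → ℕ) ] (∀ {z a} → Zₗ i z → A a → z ∼ a ⇔ ρ z < σ a)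
    ranks i = chain-rank _∼?_ (Zₗ? i) A?
      λ (Zz , z≡) (Zz′ , z′≡) Aa Aa′ za z′a′ ¬za′ ¬z′a →
        ¬za′ (nested (Z-same-level Zz Zz′ (trans z≡ (sym z′≡))) Aa Aa′ za z′a′ ¬z′a)

    ρ σ : Fin 4 → V G → ℕ
    ρ i = proj₁ (ranks i)
    σ i = proj₁ (proj₂ (ranks i))

    -- `a` is hit at its own level. If `z` is hit there too, adjacency would make `a` the contact of
    -- these two levels; if not, `unhit-complete` applies.
    level-below : A a → ¬ Contact a → Z z → level a Fin.< zlevel z → z ∼ a ⇔ (¬ Hit (level a) z)
    level-below {a} {z} Aa ¬Ca Zz l<z = mk⇔
      (λ za hz → ¬Ca (inj₁ (level a , zlevel z , proj₂ (hit-contact (level a) (zlevel z)) l<z (Aa , ha) ((Zz , refl) , hz) za)))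
      (unhit-complete Aa ha Zz l<z)
      where
      ha : Hit (level a) a
      ha = level-hit a λ eq → <⇒≱ l<z (≤-trans (s≤s⁻¹ (toℕ<n (zlevel z))) (≤-reflexive (sym (cong toℕ eq))))

    -- As `a` is no contact, a neighbour `z` is big and thus hits `a` at a level below the least
    -- one.
    level-above : A a → ¬ Contact a → Z z → zlevel z Fin.< level a → z ≁ a
    level-above {a} {z} Aa ¬Ca Zz z<l za = small-nonadjacent Aa ¬Ca
      (λ Bz → level-least a z<l (z , (Zz , refl) , Bz , za)) za

    same-level : A a → Z z → level a ≡ zlevel z → z ∼ a ⇔ ρ (zlevel z) z < σ (level a) a
    same-level {a} {z} Aa Zz eq rewrite eq = proj₂ (proj₂ (ranks (zlevel z))) (Zz , refl) Aa

    vary-Z : A a → ¬ Contact a → Z y → Z z → zlevel y ≡ zlevel z → (∀ i → Hit i y ⇔ Hit i z) →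
             (level a ≡ zlevel y → ρ (zlevel y) y < σ (level a) a → ρ (zlevel z) z < σ (level a) a) →
             y ∼ a → z ∼ a
    vary-Z {a} {y} {z} Aa ¬Ca Zy Zz y≡z hits compare ya = go (<-cmpᶠ (level a) (zlevel y))
      where
      go : Tri (level a Fin.< zlevel y) (level a ≡ zlevel y) (zlevel y Fin.< level a) → z ∼ a
      go (tri< l<y _ _) = Equivalence.from (level-below Aa ¬Ca Zz (subst (level a Fin.<_) y≡z l<y))
        (Equivalence.to (level-below Aa ¬Ca Zy l<y) ya ∘ Equivalence.from (hits (level a)))
      go (tri≈ _ l≡y _) = Equivalence.from (same-level Aa Zz (trans l≡y y≡z))
        (compare l≡y (Equivalence.to (same-level Aa Zy l≡y) ya))
      go (tri> _ _ y<l) = contradiction ya (level-above Aa ¬Ca Zy y<l)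

    vary-A : A a → A b → ¬ Contact a → ¬ Contact b → level a ≡ level b → Z z →
             (level a ≡ zlevel z → ρ (zlevel z) z < σ (level a) a → ρ (zlevel z) z < σ (level b) b) →
             z ∼ a → z ∼ b
    vary-A {a} {b} {z} Aa Ab ¬Ca ¬Cb a≡b Zz compare za = go (<-cmpᶠ (level a) (zlevel z))
      where
      go : Tri (level a Fin.< zlevel z) (level a ≡ zlevel z) (zlevel z Fin.< level a) → z ∼ b
      go (tri< a<z _ _) = Equivalence.from (level-below Ab ¬Cb Zz (subst (Fin._< zlevel z) a≡b a<z))
        (subst (λ l → ¬ Hit l z) a≡b (Equivalence.to (level-below Aa ¬Ca Zz a<z) za))
      go (tri≈ _ a≡z _) = Equivalence.from (same-level Ab Zz (trans (sym a≡b) a≡z))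
        (compare a≡z (Equivalence.to (same-level Aa Zz a≡z) za))
      go (tri> _ _ z<a) = contradiction za (level-above Aa ¬Ca Zz z<a)

    Alike : Rel (V G) 0ℓ
    Alike u v = (∀ i j → SameAt (proj₁ (hit-contact i j)) u v) ×
                (∀ p q r s → SameAt (proj₁ (small-contact p q r s)) u v) ×
                (∀ i → Hit i u ⇔ Hit i v) × (Big u ⇔ Big v)

    -- Two bits for each of the 16 contacts of pairs of levels and of the 16 contacts of types, four
    -- for the hits, one for `Big`.
    alike : Bits 69 Alike
    alike = bits-× {m = 32} (bits-∀ {m = 8} {n = 4} λ i → bits-∀ {m = 2} {n = 4} λ j → sameAt _)
      (bits-× {m = 32} (bits-∀ {m = 16} {n = 2} λ p → bits-∀ {m = 8} {n = 2} λ q → bits-∀ {m = 4} {n = 2} λ r → bits-∀ {m = 2} {n = 2} λ s → sameAt _)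
        (bits-× {m = 4} (bits-∀ {m = 1} {n = 4} λ i → bits-pred (Hit? i)) (bits-pred Big?)))

    alike-contact : Alike u v → ∀ {s} → Contact s → SameAt s u v
    alike-contact (hit , _)       (inj₁ (i , j , refl))         = hit i j
    alike-contact (_ , small , _) (inj₂ (p , q , r , s , refl)) = small p q r s

  -- The two sides of the C₄ together

  module Cross {x₁ x₂ x₃ x₄ : V G} (sq : Square x₁ x₂ x₃ x₄) where

    module S = Side sq
    module T = Side (rotate sq)
    open Square sq

    Y : Pred (V G) 0ℓ
    Y u = ¬ (u ∼ x₁ × u ∼ x₃) × ¬ (u ∼ x₂ × u ∼ x₄)

    -- Seen from the other side, `A` belongs to the top level of `T.Z`, and the vertices of `Z` that
    -- are also in `T.Z` to the bottom level.
    zlevel-T : S.A a → T.zlevel a ≡ 3F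
    zlevel-T {a} (a1 , a3 , _) with a ∼? x₃ | a ∼? x₁
    ... | yes _  | yes _  = refl
    ... | no ¬a3 | _      = contradiction a3 ¬a3
    ... | _      | no ¬a1 = contradiction a1 ¬a1

    zlevel-0 : S.Z u → T.zlevel u ≡ 0F
    zlevel-0 {u} (¬u1 , ¬u3) with u ∼? x₃ | u ∼? x₁
    ... | no _   | no _   = refl
    ... | yes u3 | _      = contradiction u3 ¬u3
    ... | _      | yes u1 = contradiction u1 ¬u1

    zlevel-Y : Y u → S.zlevel u ≢ 3F
    zlevel-Y {u} (_ , ¬u24) eq with u ∼? x₂ | u ∼? x₄
    ... | yes u2 | yes u4 = ¬u24 (u2 , u4)
    zlevel-Y _ () | no _ | no _
    zlevel-Y _ () | yes _ | no _
    zlevel-Y _ () | no _ | yes _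

    A⇒ZT : S.A a → T.Z a
    A⇒ZT (_ , _ , ¬a2 , ¬a4) = ¬a2 , ¬a4

    Y-big-Z : Y u → S.Big u → S.Z u
    Y-big-Z {u} (¬u13 , _) Bu with u ∼? x₁
    ... | yes u1 = S.big-Z Bu (inj₂ λ u3 → ¬u13 (u1 , u3))
    ... | no ¬u1 = S.big-Z Bu (inj₁ ¬u1)

    same-Z : S.SameType u v → S.Z u → S.Z v
    same-Z st (¬u1 , ¬u3) = ¬u1 ∘ Equivalence.from same₁ , ¬u3 ∘ Equivalence.from same₃
      where
      open S.SameType st

    same-rotate : S.SameType u v → T.SameType u v
    same-rotate st = record { same₁ = same₂ ; same₂ = same₃ ; same₃ = same₄ ; same₄ = same₁ }
      where
      open S.SameType st

    BothAlike : Rel (V G) 0ℓ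
    BothAlike u v = S.SameType u v × S.Alike u v × (T.Hit 0F u ⇔ T.Hit 0F v) × (T.Big u ⇔ T.Big v)

    -- The rank is abstract since the rotated square reuses this module. Level 3 is left out of
    -- `rank-A`: no vertex of `Y` has it, and one side uses the ranks there to compare `A` with `B`.
    -- `rank-Z` leaves out the vertices that may carry the rank of the other side.
    module _ (rank : V G → ℕ)
      (rank-A : ∀ {a} → S.A a → S.level a ≢ 3F → rank a ≡ S.σ (S.level a) a)
      (rank-Z : ∀ {z} → Y z → S.Z z → (T.Z z → S.Big z × ¬ T.Big z) → rank z ≡ S.ρ (S.zlevel z) z)
      where

      Compared : V G → V G → V G → Set
      Compared u u′ v = (rank u < rank v × rank u′ < rank v) ⊎ (rank u ≡ rank v × rank u′ ≡ rank v)

      compared-< : ∀ {u u′ v} → Compared u u′ v → rank u < rank v → rank u′ < rank v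
      compared-< (inj₁ (_ , u′<v))  _   = u′<v
      compared-< (inj₂ (u≡v , _)) u<v = contradiction u<v (<-irrefl u≡v)

      compared-> : ∀ {u u′ v} → Compared u u′ v → ¬ rank v < rank u
      compared-> (inj₁ (u<v , _)) v<u = <-irrefl refl (<-trans u<v v<u)
      compared-> (inj₂ (u≡v , _)) v<u = <-irrefl (sym u≡v) v<u

      -- Three ways to decide the adjacency of `y` to `A` off the contacts: there is none, the hits
      -- of the other side tell, or the ranks of this side do.
      data Case (y : V G) : Set where
        small  : ¬ S.Big y → Case y
        rotated : S.Z y → T.Z y → T.Big y → Case y
        ranked : S.Z y → (T.Z y → S.Big y × ¬ T.Big y) → Case y

      cases : Y y → Case y
      cases {y} Yy with S.Big? y | T.Z? y | T.Big? y
      ... | no ¬By | _       | _       = small ¬By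
      ... | yes By | yes Ty  | yes TBy = rotated (Y-big-Z Yy By) Ty TBy
      ... | yes By | yes Ty  | no ¬TBy = ranked (Y-big-Z Yy By) λ _ → By , ¬TBy
      ... | yes By | no ¬Ty  | _       = ranked (Y-big-Z Yy By) λ Ty → contradiction Ty ¬Ty

      -- On the other side `y` is a big vertex of level 0 and `a` has level 3, so `T.hit-all`
      -- decides.
      Y-rotated : S.A a → S.Z y → T.Z y → T.Big y → T.Hit 0F a → y ∼ a
      Y-rotated {a} Aa Zy Ty By = T.hit-all (Ty , zlevel-0 Zy) By (A⇒ZT Aa)
        (subst (λ l → 0 < toℕ l) (sym (zlevel-T Aa)) (s≤s z≤n))

      vary-Y : ∀ {a y y′} → S.A a → ¬ S.Contact a → Y y → Y y′ → BothAlike y y′ → Compared y y′ a → y ∼ a → y′ ∼ a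
      vary-Y {a} {y} {y′} Aa ¬Ca Yy Yy′ (st , (_ , _ , hits , big) , _ , Tbig) comp ya = go (cases Yy)
        where
        go : Case y → y′ ∼ a
        go (small ¬By) = contradiction ya (S.small-nonadjacent Aa ¬Ca ¬By)
        go (rotated Zy Ty By) = Y-rotated Aa (same-Z st Zy) (Ty′ Ty)
          (Equivalence.to Tbig By) (y , (Ty , zlevel-0 Zy) , By , ya)
          where
          Ty′ : T.Z y → T.Z y′
          Ty′ (¬y2 , ¬y4) = ¬y2 ∘ Equivalence.from (S.SameType.same₂ st) , ¬y4 ∘ Equivalence.from (S.SameType.same₄ st)
        go (ranked Zy only) = S.vary-Z Aa ¬Ca Zy Zy′ (S.same-zlevel st) hits compare ya
          where
          Zy′ : S.Z y′
          Zy′ = same-Z st Zy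
          only′ : T.Z y′ → S.Big y′ × ¬ T.Big y′
          only′ (¬2 , ¬4) with only (¬2 ∘ Equivalence.to (S.SameType.same₂ st) , ¬4 ∘ Equivalence.to (S.SameType.same₄ st))
          ... | By , ¬TBy = Equivalence.to big By , ¬TBy ∘ Equivalence.from Tbig
          compare : S.level a ≡ S.zlevel y → S.ρ (S.zlevel y) y < S.σ (S.level a) a →
                    S.ρ (S.zlevel y′) y′ < S.σ (S.level a) a
          compare eq lt = subst₂ _<_ (rank-Z Yy′ Zy′ only′) ra (compared-< comp (subst₂ _<_ (sym (rank-Z Yy Zy only)) (sym ra) lt))
            where
            ra : rank a ≡ S.σ (S.level a) a
            ra = rank-A Aa λ eq′ → zlevel-Y Yy (trans (sym eq) eq′)

      vary-A : ∀ {a a′ y} → S.A a → S.A a′ → ¬ S.Contact a → ¬ S.Contact a′ → BothAlike a a′ → Y y → Compared a a′ y →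
               y ∼ a → y ∼ a′
      vary-A {a} {a′} {y} Aa Aa′ ¬Ca ¬Ca′ (st , (_ , _ , hits , _) , Thit , _) Yy comp ya = go (cases Yy)
        where
        go : Case y → y ∼ a′
        go (small ¬By) = contradiction ya (S.small-nonadjacent Aa ¬Ca ¬By)
        go (rotated Zy Ty By) = Y-rotated Aa′ Zy Ty By
          (Equivalence.to Thit (y , (Ty , zlevel-0 Zy) , By , ya))
        -- On equal levels adjacency means that the rank of `y` is below that of `a`, whereas `comp`
        -- puts `a` no higher than `y`.
        go (ranked Zy only) = S.vary-A Aa Aa′ ¬Ca ¬Ca′ (S.level-cong hits) Zy
          (λ eq lt → contradiction (subst₂ _<_ (sym (rank-Z Yy Zy only))
                        (sym (rank-A Aa λ eq′ → zlevel-Y Yy (trans (sym eq) eq′))) lt) (compared-> comp)) ya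

    zlevel-B : b ∼ x₂ → b ∼ x₄ → S.zlevel b ≡ 3F
    zlevel-B {b} b2 b4 with b ∼? x₂ | b ∼? x₄
    ... | yes _  | yes _  = refl
    ... | no ¬b2 | _      = contradiction b2 ¬b2
    ... | _      | no ¬b4 = contradiction b4 ¬b4

    -- `B` has level 3 in `S.Z`, so below level 3 the hits alone decide and no ranks are compared.
    vary-B-low : ∀ {a b b′} → S.A a → ¬ S.Contact a → T.A b → T.A b′ → BothAlike b b′ → S.level a ≢ 3F → b ∼ a → b′ ∼ a
    vary-B-low Aa ¬Ca (b2 , b4 , ¬b3 , ¬b1) (_ , _ , ¬b′3 , ¬b′1) (st , (_ , _ , hits , _) , _) ≢3 =
      S.vary-Z Aa ¬Ca (¬b1 , ¬b3) (¬b′1 , ¬b′3) (S.same-zlevel st) hits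
        (λ eq _ → contradiction (trans eq (zlevel-B b2 b4)) ≢3)

    vary-A-low : ∀ {a a′ b} → S.A a → S.A a′ → ¬ S.Contact a → ¬ S.Contact a′ → BothAlike a a′ → T.A b →
                 S.level a ≢ 3F → b ∼ a → b ∼ a′
    vary-A-low Aa Aa′ ¬Ca ¬Ca′ (_ , (_ , _ , hits , _) , _) (b2 , b4 , ¬b3 , ¬b1) ≢3 =
      S.vary-A Aa Aa′ ¬Ca ¬Ca′ (S.level-cong hits) (¬b1 , ¬b3) (λ eq _ → contradiction (trans eq (zlevel-B b2 b4)) ≢3)

  -- The neighbour u of y and the non-neighbour w lie on opposite sides of the square.
  opposite-homogeneous : ∀ {x₁ x₂ x₃ x₄} (sq : Square x₁ x₂ x₃ x₄) →
    y ∼ x₁ → y ≁ x₃ → u ∼ x₃ → u ≁ x₁ → Side.SameType sq y z → y ≁ z → u ∼ y → u ∼ z → Side.W sq w → y ∼ w → z ∼ w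
  opposite-homogeneous {y} {u} {z} {w} {x₁} {x₂} {x₃} {x₄} sq y1 ¬y3 u3 ¬u1 st ¬yz uy uz (w1 , w3 , w2 , w4) yw
    with u ∼? w
  -- `y`, `z` and `w` are common neighbours of the non-adjacent `u` and `x₁`, with `y` and `z` in
  -- one part.
  ... | yes uw = multipartite (λ { refl → x₁≁x₃ u3 }) ¬u1 (uy , flip y1) (uz , flip (Equivalence.to same₁ y1))
                   (uw , flip w1) yw ¬yz
    where
    open Square sq
    open Side.SameType st
  ... | no ¬uw = decidable-stable (z ∼? w) λ ¬zw → [ avoid x₁₂ x₂₃ w2 same₂ ¬zw , avoid (flip x₄₁) (flip x₃₄) w4 same₄ ¬zw ]′ misses
    where
    open Square sq
    open Side.SameType st
    misses : u ≁ x₂ ⊎ u ≁ x₄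
    misses with u ∼? x₂ | u ∼? x₄
    ... | no ¬u2 | _      = inj₁ ¬u2
    ... | _      | no ¬u4 = inj₂ ¬u4
    ... | yes u2 | yes u4 = contradiction
      ([ (λ (_ , _ , ¬u3 , _) → contradiction u3 ¬u3) , (λ (_ , _ , _ , u1) → u1) ]′ (Side.A-or-W (rotate sq) u2 u4)) ¬u1
    -- `x` is the one of `x₂` and `x₄` that `u` misses. If `y` sees it, the common neighbours `x`,
    -- `u`, `w` of `y` and `x₃` force `u` and `w` to be adjacent; otherwise `z` misses it too, and
    -- `uz` and `wx` form a 2P₂.
    avoid : ∀ {x} → x₁ ∼ x → x ∼ x₃ → w ∼ x → y ∼ x ⇔ z ∼ x → z ≁ w → u ≁ x → ⊥
    avoid {x} _ xx₃ wx same ¬zw ¬ux with y ∼? x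
    ... | yes yx = ¬uw (multipartite (separated (flip y1) x₁≁x₃) ¬y3 (yx , flip xx₃) (flip uy , flip u3)
                          (yw , flip w3) (flip wx) (flip≁ ¬ux))
    ... | no ¬yx = no-2P₂ uz wx ¬uw ¬ux ¬zw (¬yx ∘ Equivalence.from same)

  -- The vertices of W and Y when G is an atom

  module SquareCase (atom : Atom G) {x₁ x₂ x₃ x₄ : V G} (sq : Square x₁ x₂ x₃ x₄) where

    open Square sq
    open Cross sq public using (module S; module T; Y)
    module CS = Cross sq
    module CT = Cross (rotate sq)

    data Kind (u : V G) : Set where
      inA : S.A u → Kind u
      inB : T.A u → Kind u
      inW : S.W u → Kind u
      inY : Y u → Kind u

    kind : ∀ u → Kind u
    kind u with (u ∼? x₁) ×-dec (u ∼? x₃) | (u ∼? x₂) ×-dec (u ∼? x₄)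
    ... | yes (u1 , u3) | _             = [ inA , inW ]′ (S.A-or-W u1 u3)
    ... | no ¬u13       | yes (u2 , u4) = [ inB , (λ (_ , _ , u3 , u1) → contradiction (u1 , u3) ¬u13) ]′ (T.A-or-W u2 u4)
    ... | no ¬u13       | no ¬u24       = inY (¬u13 , ¬u24)

    W-rotate : S.W w → T.W w
    W-rotate (w1 , w3 , w2 , w4) = w2 , w4 , w3 , w1

    Y-rotate : Y u → CT.Y u
    Y-rotate (¬u13 , ¬u24) = ¬u24 , ¬u13 ∘ swap

    same-Y : S.SameType u v → Y u → Y v
    same-Y st (¬u13 , ¬u24) =
      (λ (v1 , v3) → ¬u13 (Equivalence.from same₁ v1 , Equivalence.from same₃ v3)) ,
      (λ (v2 , v4) → ¬u24 (Equivalence.from same₂ v2 , Equivalence.from same₄ v4))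
      where
      open S.SameType st

    same-B : S.SameType u v → T.A u → T.A v
    same-B st = T.same-A (CS.same-rotate st)

    same-W : S.SameType u v → S.W u → S.W v
    same-W st (u1 , u3 , u2 , u4) = Equivalence.to same₁ u1 , Equivalence.to same₃ u3 ,
      Equivalence.to same₂ u2 , Equivalence.to same₄ u4
      where
      open S.SameType st

    same-sym : S.SameType u v → S.SameType v u
    same-sym st = record { same₁ = ⇔-sym same₁ ; same₂ = ⇔-sym same₂ ; same₃ = ⇔-sym same₃ ; same₄ = ⇔-sym same₄ }
      where
      open S.SameType st
      ⇔-sym : ∀ {P Q : Set} → P ⇔ Q → Q ⇔ P
      ⇔-sym eqv = mk⇔ (Equivalence.from eqv) (Equivalence.to eqv)

    Opposite : V G → V G → Rel (V G) 0ℓ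
    Opposite p q u v = u ∼ p × u ≁ q × v ∼ q × v ≁ p

    data Opposed (u v : V G) : Set where
      opposed₁₃ : Opposite x₁ x₃ u v → Opposed u v
      opposed₂₄ : Opposite x₂ x₄ u v → Opposed u v
      opposed₃₁ : Opposite x₃ x₁ u v → Opposed u v
      opposed₄₂ : Opposite x₄ x₂ u v → Opposed u v

    opposite-or-miss : ∀ {p q} → ¬ (u ∼ p × u ∼ q) → ¬ (v ∼ p × v ∼ q) →
                       Opposite p q u v ⊎ Opposite q p u v ⊎ (u ≁ p × v ≁ p) ⊎ (u ≁ q × v ≁ q)
    opposite-or-miss {u} {v} {p} {q} ¬u ¬v with u ∼? p | u ∼? q | v ∼? p | v ∼? q
    ... | yes up | yes uq | _      | _      = contradiction (up , uq) ¬u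
    ... | _      | _      | yes vp | yes vq = contradiction (vp , vq) ¬v
    ... | yes up | no ¬uq | no ¬vp | yes vq = inj₁ (up , ¬uq , vq , ¬vp)
    ... | no ¬up | yes uq | yes vp | no ¬vq = inj₂ (inj₁ (uq , ¬up , vp , ¬vq))
    ... | no ¬up | _      | no ¬vp | _      = inj₂ (inj₂ (inj₁ (¬up , ¬vp)))
    ... | _      | no ¬uq | _      | no ¬vq = inj₂ (inj₂ (inj₂ (¬uq , ¬vq)))

    -- The adjacency of two vertices of Y is determined by their types.
    opposed : Y u → Y v → u ∼ v → Opposed u v
    opposed (¬u13 , ¬u24) (¬v13 , ¬v24) uv with opposite-or-miss ¬u13 ¬v13 | opposite-or-miss ¬u24 ¬v24
    ... | inj₁ o        | _             = opposed₁₃ o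
    ... | inj₂ (inj₁ o) | _             = opposed₃₁ o
    ... | _             | inj₁ o        = opposed₂₄ o
    ... | _             | inj₂ (inj₁ o) = opposed₄₂ o
    ... | inj₂ (inj₂ (inj₁ (¬u1 , ¬v1))) | inj₂ (inj₂ (inj₁ (¬u2 , ¬v2))) = ⊥-elim (no-2P₂ uv x₁₂ ¬u1 ¬u2 ¬v1 ¬v2)
    ... | inj₂ (inj₂ (inj₁ (¬u1 , ¬v1))) | inj₂ (inj₂ (inj₂ (¬u4 , ¬v4))) = ⊥-elim (no-2P₂ uv x₄₁ ¬u4 ¬u1 ¬v4 ¬v1)
    ... | inj₂ (inj₂ (inj₂ (¬u3 , ¬v3))) | inj₂ (inj₂ (inj₁ (¬u2 , ¬v2))) = ⊥-elim (no-2P₂ uv x₂₃ ¬u2 ¬u3 ¬v2 ¬v3)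
    ... | inj₂ (inj₂ (inj₂ (¬u3 , ¬v3))) | inj₂ (inj₂ (inj₂ (¬u4 , ¬v4))) = ⊥-elim (no-2P₂ uv x₃₄ ¬u3 ¬u4 ¬v3 ¬v4)

    opposite-adjacent : ∀ {p q} → p ≁ q → Opposite p q u v → u ∼ v
    opposite-adjacent {u} {v} ¬pq (up , ¬uq , vq , ¬vp) = decidable-stable (u ∼? v) λ ¬uv →
      no-2P₂ up vq ¬uv ¬uq (flip≁ ¬vp) ¬pq

    opposed-adjacent : Opposed u v → u ∼ v
    opposed-adjacent (opposed₁₃ o) = opposite-adjacent x₁≁x₃ o
    opposed-adjacent (opposed₂₄ o) = opposite-adjacent x₂≁x₄ o
    opposed-adjacent (opposed₃₁ o) = opposite-adjacent (flip≁ x₁≁x₃) o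
    opposed-adjacent (opposed₄₂ o) = opposite-adjacent (flip≁ x₂≁x₄) o

    opposed-same : S.SameType u v → Opposed u w → Opposed v w
    opposed-same st = λ
      { (opposed₁₃ (u1 , ¬u3 , o)) → opposed₁₃ (Equivalence.to same₁ u1 , ¬u3 ∘ Equivalence.from same₃ , o)
      ; (opposed₂₄ (u2 , ¬u4 , o)) → opposed₂₄ (Equivalence.to same₂ u2 , ¬u4 ∘ Equivalence.from same₄ , o)
      ; (opposed₃₁ (u3 , ¬u1 , o)) → opposed₃₁ (Equivalence.to same₃ u3 , ¬u1 ∘ Equivalence.from same₁ , o)
      ; (opposed₄₂ (u4 , ¬u2 , o)) → opposed₄₂ (Equivalence.to same₄ u4 , ¬u2 ∘ Equivalence.from same₂ , o) }
      where
      open S.SameType st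

    -- Adjacency within `Y` depends on types, so `u` is a neighbour of `z` as well, and a rotation
    -- brings `y` and `u` into the position of `opposite-homogeneous`.
    Y-homogeneous : S.SameType y z → y ≁ z → Y y → Y u → y ∼ u → S.W w → y ∼ w → z ∼ w
    Y-homogeneous {y} {z} {u} st ¬yz Yy Yu yu Ww = go o
      where
      o : Opposed y u
      o = opposed Yy Yu yu
      zu : u ∼ z
      zu = flip (opposed-adjacent (opposed-same st o))
      rotate-W : ∀ {x₁ x₂ x₃ x₄ w} {sq : Square x₁ x₂ x₃ x₄} → Side.W sq w → Side.W (rotate sq) w
      rotate-W (w1 , w3 , w2 , w4) = w2 , w4 , w3 , w1
      go : Opposed y u → y ∼ _ → z ∼ _
      go (opposed₁₃ (y1 , ¬y3 , u3 , ¬u1)) = opposite-homogeneous sq y1 ¬y3 u3 ¬u1 st ¬yz (flip yu) zu Ww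
      go (opposed₂₄ (y2 , ¬y4 , u4 , ¬u2)) = opposite-homogeneous (rotate sq) y2 ¬y4 u4 ¬u2
        (CS.same-rotate st) ¬yz (flip yu) zu (W-rotate Ww)
      go (opposed₃₁ (y3 , ¬y1 , u1 , ¬u3)) = opposite-homogeneous (rotate (rotate sq)) y3 ¬y1 u1 ¬u3
        (CT.same-rotate (CS.same-rotate st)) ¬yz (flip yu) zu (rotate-W {sq = rotate sq} (W-rotate Ww))
      go (opposed₄₂ (y4 , ¬y2 , u2 , ¬u4)) = opposite-homogeneous (rotate (rotate (rotate sq))) y4 ¬y2 u2 ¬u4
        (Cross.same-rotate (rotate (rotate sq)) (CT.same-rotate (CS.same-rotate st))) ¬yz (flip yu) zu
        (rotate-W {sq = rotate (rotate sq)} (rotate-W {sq = rotate sq} (W-rotate Ww)))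

    -- Non-adjacent `v` and `w` would have `y` and all corners as common neighbours. Then a corner
    -- missed by `y` forces `y` to see both corners next to it, which `Y` excludes.
    Y-W-clique : Y y → S.W v → S.W w → v ≢ w → y ∼ v → y ∼ w → v ∼ w
    Y-W-clique {y} {v} {w} (¬y13 , ¬y24) (v1 , v3 , v2 , v4) (w1 , w3 , w2 , w4) v≢w yv yw =
      decidable-stable (v ∼? w) λ ¬vw → let
        spread = λ {p q} (¬yp : y ≁ p) (pq : p ∼ q) (vp : v ∼ p) (vq : v ∼ q) (wp : w ∼ p) (wq : w ∼ q) →
          multipartite v≢w ¬vw (vp , wp) (flip yv , flip yw) (vq , wq) pq (flip≁ ¬yp)
        y1 = decidable-stable (y ∼? x₁) λ ¬y1 →
          ¬y24 (spread ¬y1 x₁₂ v1 v2 w1 w2 , spread ¬y1 (flip x₄₁) v1 v4 w1 w4)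
        y3 = decidable-stable (y ∼? x₃) λ ¬y3 →
          ¬y24 (spread ¬y3 (flip x₂₃) v3 v2 w3 w2 , spread ¬y3 x₃₄ v3 v4 w3 w4)
      in ¬y13 (y1 , y3)

    data Neighbours (y : V G) : Set where
      inside  : Y u → y ∼ u → Neighbours y
      between : S.A a → T.A b → a ≁ b → y ∼ a → y ∼ b → Neighbours y

    -- An atom gives `y` two non-adjacent neighbours. Smallness allows at most one in `A` and one in
    -- `B`, those in `W` form a clique, and `W` is complete to `A` and `B`; only the two
    -- constructors remain.
    neighbours : Y y → ¬ S.Big y → ¬ T.Big y → Neighbours y
    neighbours {y} Yy@(¬y13 , ¬y24) ¬SB ¬TB with nonneighbour
      where
      nonneighbour : ∃[ x ] y ≢ x × y ≁ x
      nonneighbour with y ∼? x₁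
      ... | no ¬y1 = x₁ , (λ { refl → ¬y24 (x₁₂ , flip x₄₁) }) , ¬y1
      ... | yes y1 = x₃ , (λ { refl → ¬y24 (flip x₂₃ , x₃₄) }) , λ y3 → ¬y13 (y1 , y3)
    ... | x , y≢x , ¬yx with atom-neighbourhood {G} atom y≢x ¬yx
    ...   | p , q , yp , yq , p≢q , ¬pq with kind p | kind q
    ...     | inY Yp | _      = inside Yp yp
    ...     | _      | inY Yq = inside Yq yq
    ...     | inA Ap | inA Aq = contradiction (S.small-one ¬SB Ap Aq yp yq) p≢q
    ...     | inB Bp | inB Bq = contradiction (T.small-one ¬TB Bp Bq yp yq) p≢q
    ...     | inW Wp | inW Wq = contradiction (Y-W-clique Yy Wp Wq p≢q yp yq) ¬pq
    ...     | inA Ap | inW Wq = contradiction (S.A-W Ap Wq) ¬pq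
    ...     | inW Wp | inA Aq = contradiction (flip (S.A-W Aq Wp)) ¬pq
    ...     | inB Bp | inW Wq = contradiction (T.A-W Bp (W-rotate Wq)) ¬pq
    ...     | inW Wp | inB Bq = contradiction (flip (T.A-W Bq (W-rotate Wp))) ¬pq
    ...     | inA Ap | inB Bq = between Ap Bq ¬pq yp yq
    ...     | inB Bp | inA Aq = between Aq Bp (flip≁ ¬pq) yq yp

    A-B-disjoint : S.A a → T.A b → a ≢ b
    A-B-disjoint (_ , _ , ¬a2 , _) (b2 , _) refl = ¬a2 b2

    -- If `y` or `z` has a neighbour in `Y`, the other shares it. Otherwise both see the contacts of
    -- their type in `A` and `B`, a non-adjacent pair with the common neighbours `y`, `z` and `w`.
    small-homogeneous : S.SameType y z → Y y → ¬ S.Big y → ¬ T.Big y → ¬ S.Big z → ¬ T.Big z → S.W w → y ∼ w → z ∼ w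
    small-homogeneous {y} {z} {w} st Yy ¬SBy ¬TBy ¬SBz ¬TBz Ww yw =
      go (neighbours Yy ¬SBy ¬TBy) (neighbours (same-Y st Yy) ¬SBz ¬TBz)
      where
      ¬yz : y ≁ z
      ¬yz = S.small-type-indep st ¬SBy
      go : Neighbours y → Neighbours z → z ∼ w
      go (inside Yu yu) _ = Y-homogeneous st ¬yz Yy Yu yu Ww yw
      go _ (inside Yu zu) = Y-homogeneous st ¬yz Yy Yu
        (opposed-adjacent (opposed-same (same-sym st) (opposed (same-Y st Yy) Yu zu))) Ww yw
      go (between {a} {b} Aa Bb ¬ab ya yb) (between {a′} {b′} Aa′ Bb′ _ za′ zb′) =
        multipartite (A-B-disjoint Aa Bb) ¬ab (flip ya , flip yb) (flip za , flip zb)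
          (S.A-W Aa Ww , T.A-W Bb (W-rotate Ww)) yw ¬yz
        where
        za : z ∼ a
        za = subst (z ∼_) (S.same-contact st ¬SBz ¬SBy Aa′ Aa za′ ya) za′
        zb : z ∼ b
        zb = subst (z ∼_) (T.same-contact (CS.same-rotate st) ¬TBz ¬TBy Bb′ Bb zb′ yb) zb′

    -- Two rotations give back `A` and `Big` but exchange levels 1 and 2. Hence only hits of level 0
    -- are carried between the two descriptions.
    module R = Side (rotate (rotate sq))

    A⇒R : S.A u → R.A u
    A⇒R (u1 , u3 , ¬u2 , ¬u4) = u3 , u1 , ¬u4 , ¬u2

    R⇒A : R.A u → S.A u
    R⇒A (u3 , u1 , ¬u4 , ¬u2) = u1 , u3 , ¬u2 , ¬u4

    Big⇒R : S.Big u → R.Big u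
    Big⇒R (a , b , Aa , Ab , rest) = a , b , A⇒R Aa , A⇒R Ab , rest

    R⇒Big : R.Big u → S.Big u
    R⇒Big (a , b , Aa , Ab , rest) = a , b , R⇒A Aa , R⇒A Ab , rest

    level-0 : ∀ {p q} (d : Dec (u ∼ p)) (d′ : Dec (u ∼ q)) → S.levelOf d d′ ≡ 0F → R.levelOf d′ d ≡ 0F
    level-0 (no _) (no _) _ = refl
    level-0 (yes _) (yes _) ()
    level-0 (no _) (yes _) ()
    level-0 (yes _) (no _) ()

    level-0⁻¹ : ∀ {p q} (d : Dec (u ∼ p)) (d′ : Dec (u ∼ q)) → R.levelOf d′ d ≡ 0F → S.levelOf d d′ ≡ 0F
    level-0⁻¹ (no _) (no _) _ = refl
    level-0⁻¹ (yes _) (yes _) ()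
    level-0⁻¹ (no _) (yes _) ()
    level-0⁻¹ (yes _) (no _) ()

    Hit⇔R : S.Hit 0F u ⇔ R.Hit 0F u
    Hit⇔R = mk⇔
      (λ (z , ((¬z1 , ¬z3) , z≡0) , Bz , zu) → z , ((¬z3 , ¬z1) , level-0 (z ∼? x₂) (z ∼? x₄) z≡0) , Big⇒R Bz , zu)
      (λ (z , ((¬z3 , ¬z1) , z≡0) , Bz , zu) → z , ((¬z1 , ¬z3) , level-0⁻¹ (z ∼? x₂) (z ∼? x₄) z≡0) , R⇒Big Bz , zu)

-- Classes and ranks for an atom with an induced C₄

choose : ∀ {P : Set} → Dec P → ℕ → ℕ → ℕ
choose (yes _) m n = m
choose (no _)  m n = n

choose-yes : ∀ {P : Set} (d : Dec P) {m n} → P → choose d m n ≡ m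
choose-yes (yes _) _ = refl
choose-yes (no ¬p) p = contradiction p ¬p

choose-no : ∀ {P : Set} (d : Dec P) {m n} → ¬ P → choose d m n ≡ n
choose-no (yes p) ¬p = contradiction p ¬p
choose-no (no _)  _  = refl

module SquareBound (G : Graph) (2P₂⋢G : ¬ 2P₂ ⊑ G) (H⋢G : ¬ co-P₂+P₃ ⊑ G) (atom : Atom G)
  {x₁ x₂ x₃ x₄ : V G} (sq : Structure.Square G 2P₂⋢G H⋢G x₁ x₂ x₃ x₄) where

  open Structure G 2P₂⋢G H⋢G
  open SquareCase atom sq
  open Square sq

  private variable
    a b u v : V G

  nonneighbour? : ∀ u → Decidable (λ w → S.W w × u ≁ w)
  nonneighbour? u w = ((w ∼? x₁) ×-dec (w ∼? x₃) ×-dec (w ∼? x₂) ×-dec (w ∼? x₄)) ×-dec ¬? (u ∼? w)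

  -- For `u` in `W` the non-neighbours in `W` are the part of `u`, which is thus named by its first
  -- vertex.
  part : V G → ℕ
  part u = first (nonneighbour? u)

  ViaS : Pred (V G) 0ℓ
  ViaS u = S.Z u × (¬ T.Z u ⊎ S.Big u)

  ViaS? : Decidable ViaS
  ViaS? u = S.Z? u ×-dec (¬? (T.Z? u) ⊎-dec S.Big? u)

  W? : Decidable S.W
  W? u = (u ∼? x₁) ×-dec (u ∼? x₃) ×-dec (u ∼? x₂) ×-dec (u ∼? x₄)

  -- A vertex without neighbour on the square lies in the Z of both sides.  If it is big
  -- for both sides, or small for one, hits and contacts decide its adjacency to A or
  -- to B, so that it needs a rank for one side only.  Between A and B, ranks matter only
  -- where both levels are 3.
  rankB rankY rank : V G → ℕ
  rankB u = choose (T.level u ≟ᶠ 3F) (S.ρ 3F u) (T.σ (T.level u) u)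
  rankY u = choose (ViaS? u) (S.ρ (S.zlevel u) u) (T.ρ (T.zlevel u) u)
  rank u = choose (S.A? u) (S.σ (S.level u) u) (choose (T.A? u) (rankB u) (choose (W? u) (part u) (rankY u)))

  rank-A : S.A u → rank u ≡ S.σ (S.level u) u
  rank-A {u} Au = choose-yes (S.A? u) Au

  rank-B : T.A u → rank u ≡ rankB u
  rank-B {u} Bu@(u2 , _) = trans (choose-no (S.A? u) (λ (_ , _ , ¬u2 , _) → ¬u2 u2)) (choose-yes (T.A? u) Bu)

  rank-W : S.W u → rank u ≡ part u
  rank-W {u} Wu@(u1 , u3 , u2 , u4) = trans (choose-no (S.A? u) (λ (_ , _ , ¬u2 , _) → ¬u2 u2))
    (trans (choose-no (T.A? u) (λ (_ , _ , ¬u3 , _) → ¬u3 u3)) (choose-yes (W? u) Wu))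

  rank-Y : Y u → rank u ≡ rankY u
  rank-Y {u} (¬u13 , ¬u24) = trans (choose-no (S.A? u) (λ (u1 , u3 , _) → ¬u13 (u1 , u3)))
    (trans (choose-no (T.A? u) (λ (u2 , u4 , _) → ¬u24 (u2 , u4))) (choose-no (W? u) (λ (u1 , u3 , _) → ¬u13 (u1 , u3))))

  rank-YS : Y u → S.Z u → (T.Z u → S.Big u × ¬ T.Big u) → rank u ≡ S.ρ (S.zlevel u) u
  rank-YS {u} Yu Zu only = trans (rank-Y Yu) (choose-yes (ViaS? u) (Zu , via (T.Z? u)))
    where
    via : Dec (T.Z u) → ¬ T.Z u ⊎ S.Big u
    via (yes Tu) = inj₂ (proj₁ (only Tu))
    via (no ¬Tu) = inj₁ ¬Tu

  rank-YT : Y u → T.Z u → (R.Z u → T.Big u × ¬ R.Big u) → rank u ≡ T.ρ (T.zlevel u) u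
  rank-YT {u} Yu Tu only = trans (rank-Y Yu) (choose-no (ViaS? u) λ
    { (_ , inj₁ ¬Tu) → ¬Tu Tu
    ; ((¬u1 , ¬u3) , inj₂ Bu) → proj₂ (only (¬u3 , ¬u1)) (Big⇒R Bu) })

  Y-unrotate : CT.Y u → Y u
  Y-unrotate (¬u24 , ¬u31) = ¬u31 ∘ swap , ¬u24

  rank-A₃ : S.A a → S.level a ≡ 3F → rank a ≡ S.σ 3F a
  rank-A₃ {a} Aa eq = trans (rank-A Aa) (cong (λ i → S.σ i a) eq)

  rank-B₃ : T.A b → T.level b ≡ 3F → rank b ≡ S.ρ 3F b
  rank-B₃ {b} Bb eq = trans (rank-B Bb) (choose-yes (T.level b ≟ᶠ 3F) eq)

  B-A-rank : T.A b → S.A a → b ∼ a ⇔ S.ρ 3F b < S.σ 3F a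
  B-A-rank (b2 , b4 , ¬b3 , ¬b1) = proj₂ (proj₂ (S.ranks 3F)) ((¬b1 , ¬b3) , CS.zlevel-B b2 b4)

  W-part : S.W u → S.W v → u ∼ v ⇔ part u ≢ part v
  W-part {u} {v} Wu Wv = mk⇔ to λ ≢ → decidable-stable (u ∼? v) (≢ ∘ from)
    where
    from : u ≁ v → part u ≡ part v
    from ¬uv = first-cong (nonneighbour? u) (nonneighbour? v)
      (λ { w (Ww , ¬uw) → Ww , λ vw → ¬uw (S.W-parts Wv Wu Ww vw (flip≁ ¬uv)) })
      (λ { w (Ww , ¬vw) → Ww , λ uw → ¬vw (S.W-parts Wu Wv Ww uw ¬uv) })
    to : u ∼ v → part u ≢ part v
    to uv eq with first-common (nonneighbour? u) (nonneighbour? v) eq (u , Wu , E-irrefl G refl)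
    ... | w , (Ww , ¬uw) , (_ , ¬vw) = ¬uw (flip (S.W-parts Wv Ww Wu (flip uv) ¬vw))

  Small : Pred (V G) 0ℓ
  Small u = Y u × ¬ S.Big u × ¬ T.Big u

  -- Small vertices of one type have the same neighbours in `W`, so one bit per type settles the
  -- adjacency of a vertex of `W` to all of them.
  SmallNeighbour : (p q r s : Fin 2) → Pred (V G) 0ℓ
  SmallNeighbour p q r s w = ∃[ y ] S.Type p q r s y × Small y × y ∼ w

  SmallNeighbour? : ∀ p q r s → Decidable (SmallNeighbour p q r s)
  SmallNeighbour? p q r s w = any? λ y → S.Type? p q r s y ×-dec
    ((¬? ((y ∼? x₁) ×-dec (y ∼? x₃)) ×-dec ¬? ((y ∼? x₂) ×-dec (y ∼? x₄))) ×-dec ¬? (S.Big? y) ×-dec ¬? (T.Big? y)) ×-dec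
    (y ∼? w)

  Indistinct : Rel (V G) 0ℓ
  Indistinct u v = S.Alike u v × T.Alike u v ×
    ((u ∼ x₁ ⇔ v ∼ x₁) × (u ∼ x₂ ⇔ v ∼ x₂) × (u ∼ x₃ ⇔ v ∼ x₃) × (u ∼ x₄ ⇔ v ∼ x₄)) ×
    (∀ p q r s → SmallNeighbour p q r s u ⇔ SmallNeighbour p q r s v)

  -- 69 bits for each side, 4 for the type and 16 for the small neighbours of the 16 types.
  indistinct : Bits 158 Indistinct
  indistinct = bits-× {m = 69} S.alike (bits-× {m = 69} T.alike (bits-× {m = 4}
    (bits-× (bits-pred (_∼? x₁)) (bits-× (bits-pred (_∼? x₂)) (bits-× (bits-pred (_∼? x₃)) (bits-pred (_∼? x₄)))))
    (bits-∀ {m = 8} {n = 2} λ p → bits-∀ {m = 4} {n = 2} λ q → bits-∀ {m = 2} {n = 2} λ r → bits-∀ {m = 1} {n = 2} λ s →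
      bits-pred (SmallNeighbour? p q r s))))

  Compared : V G → V G → V G → Set
  Compared u u′ v = (rank u < rank v × rank u′ < rank v) ⊎ (rank u ≡ rank v × rank u′ ≡ rank v)

  module _ {u u′ : V G} (ind : Indistinct u u′) where

    private
      alikeS : S.Alike u u′
      alikeS = proj₁ ind
      alikeT : T.Alike u u′
      alikeT = proj₁ (proj₂ ind)
      st : S.SameType u u′
      st = let (s₁ , s₂ , s₃ , s₄) = proj₁ (proj₂ (proj₂ ind)) in
        record { same₁ = s₁ ; same₂ = s₂ ; same₃ = s₃ ; same₄ = s₄ }
      hits : ∀ i → S.Hit i u ⇔ S.Hit i u′
      hits = proj₁ (proj₂ (proj₂ alikeS))
      bigS : S.Big u ⇔ S.Big u′
      bigS = proj₂ (proj₂ (proj₂ alikeS))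
      hitsT : ∀ i → T.Hit i u ⇔ T.Hit i u′
      hitsT = proj₁ (proj₂ (proj₂ alikeT))
      bigT : T.Big u ⇔ T.Big u′
      bigT = proj₂ (proj₂ (proj₂ alikeT))

      bothS : CS.BothAlike u u′
      bothS = st , alikeS , hitsT 0F , bigT

      bothT : CT.BothAlike u u′
      bothT = CS.same-rotate st , alikeT ,
        mk⇔ (Equivalence.to Hit⇔R ∘ Equivalence.to (hits 0F) ∘ Equivalence.from Hit⇔R)
            (Equivalence.to Hit⇔R ∘ Equivalence.from (hits 0F) ∘ Equivalence.from Hit⇔R) ,
        mk⇔ (Big⇒R ∘ Equivalence.to bigS ∘ R⇒Big) (Big⇒R ∘ Equivalence.from bigS ∘ R⇒Big)

    determined-regular : ∀ {v} → ¬ S.Contact u → ¬ S.Contact u′ → ¬ T.Contact u → ¬ T.Contact u′ →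
      ¬ S.Contact v → ¬ T.Contact v → Kind u → Kind v → Compared u u′ v → u ∼ v → u′ ∼ v
    determined-regular {v} ¬Su ¬Su′ ¬Tu ¬Tu′ ¬Sv ¬Tv ku kv comp uv = go ku kv
      where
      rank-A′ : ∀ {a} → S.A a → S.level a ≢ 3F → rank a ≡ S.σ (S.level a) a
      rank-A′ Aa _ = rank-A Aa
      rank-B′ : ∀ {b} → T.A b → T.level b ≢ 3F → rank b ≡ T.σ (T.level b) b
      rank-B′ {b} Bb ≢3 = trans (rank-B Bb) (choose-no (T.level b ≟ᶠ 3F) ≢3)
      go : Kind u → Kind v → u′ ∼ v
      go (inA Au) (inA Av) = contradiction uv (S.A-indep Au Av)
      go (inB Bu) (inB Bv) = contradiction uv (T.A-indep Bu Bv)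
      go (inA Au) (inW Wv) = S.A-W (S.same-A st Au) Wv
      go (inB Bu) (inW Wv) = T.A-W (same-B st Bu) (W-rotate Wv)
      go (inW Wu) (inA Av) = flip (S.A-W Av (same-W st Wu))
      go (inW Wu) (inB Bv) = flip (T.A-W Bv (W-rotate (same-W st Wu)))
      go (inY Yu) (inY Yv) = opposed-adjacent (opposed-same st (opposed Yu Yv uv))
      go (inY Yu) (inA Av) = CS.vary-Y rank rank-A′ rank-YS Av ¬Sv Yu (same-Y st Yu) bothS comp uv
      go (inY Yu) (inB Bv) = CT.vary-Y rank rank-B′ (λ Yz → rank-YT (Y-unrotate Yz)) Bv ¬Tv
        (Y-rotate Yu) (Y-rotate (same-Y st Yu)) bothT comp uv
      go (inA Au) (inY Yv) = flip (CS.vary-A rank rank-A′ rank-YS Au (S.same-A st Au) ¬Su ¬Su′ bothS Yv comp (flip uv))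
      go (inB Bu) (inY Yv) = flip (CT.vary-A rank rank-B′ (λ Yz → rank-YT (Y-unrotate Yz)) Bu (same-B st Bu) ¬Tu ¬Tu′ bothT
        (Y-rotate Yv) comp (flip uv))
      go (inW Wu) (inW Wv) = Equivalence.from (W-part (same-W st Wu) Wv) (subst₂ _≢_ (rank-W (same-W st Wu)) (rank-W Wv)
        (differ comp (subst₂ _≢_ (sym (rank-W Wu)) (sym (rank-W Wv)) (Equivalence.to (W-part Wu Wv) uv))))
        where
        differ : Compared u u′ v → rank u ≢ rank v → rank u′ ≢ rank v
        differ (inj₁ (_ , u′<v)) _   eq = <-irrefl eq u′<v
        differ (inj₂ (u≡v , _))  u≢v _  = u≢v u≡v
      go (inY Yu) (inW Wv) = Y-W (S.Big? u) (T.Big? u)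
        where
        Y-W : Dec (S.Big u) → Dec (T.Big u) → u′ ∼ v
        Y-W (yes SB) _        = S.big-W (CS.same-Z st (CS.Y-big-Z Yu SB)) (Equivalence.to bigS SB) Wv
        Y-W (no _)   (yes TB) = T.big-W (CT.same-Z (CS.same-rotate st) (CT.Y-big-Z (Y-rotate Yu) TB))
                                  (Equivalence.to bigT TB) (W-rotate Wv)
        Y-W (no ¬SB) (no ¬TB) = small-homogeneous st Yu ¬SB ¬TB (¬SB ∘ Equivalence.from bigS) (¬TB ∘ Equivalence.from bigT) Wv uv
      go (inW Wu) (inY Yv) = flip (W-Y (S.Big? v) (T.Big? v))
        where
        Wu′ : S.W u′
        Wu′ = same-W st Wu
        W-Y : Dec (S.Big v) → Dec (T.Big v) → v ∼ u′
        W-Y (yes SB) _        = S.big-W (CS.Y-big-Z Yv SB) SB Wu′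
        W-Y (no _)   (yes TB) = T.big-W (CT.Y-big-Z (Y-rotate Yv) TB) TB (W-rotate Wu′)
        W-Y (no ¬SB) (no ¬TB) =
          let y , Ty , (Yy , ¬SBy , ¬TBy) , yu′ = Equivalence.to (proj₂ (proj₂ (proj₂ ind)) _ _ _ _)
                (v , (refl , refl , refl , refl) , (Yv , ¬SB , ¬TB) , flip uv)
          in small-homogeneous (S.type-same Ty (refl , refl , refl , refl)) Yy ¬SBy ¬TBy ¬SB ¬TB Wu′ yu′
      go (inA Au) (inB Bv) = A-B (S.level u ≟ᶠ 3F) (T.level v ≟ᶠ 3F)
        where
        Au′ : S.A u′
        Au′ = S.same-A st Au
        A-B : Dec (S.level u ≡ 3F) → Dec (T.level v ≡ 3F) → u′ ∼ v
        A-B (no ≢3)  _        = flip (CS.vary-A-low Au Au′ ¬Su ¬Su′ bothS Bv ≢3 (flip uv))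
        A-B (yes _)  (no ≢3)  = CT.vary-B-low Bv ¬Tv (A⇒R Au) (A⇒R Au′) bothT ≢3 uv
        -- Adjacency would put the rank of `v`, in `B`, below that of `u`, in `A`, which `comp`
        -- excludes.
        A-B (yes u3) (yes v3) = contradiction
          (subst₂ _<_ (sym (rank-B₃ Bv v3)) (sym (rank-A₃ Au u3)) (Equivalence.to (B-A-rank Bv Au) (flip uv)))
          (not-above comp)
          where
          not-above : Compared u u′ v → ¬ rank v < rank u
          not-above (inj₁ (u<v , _)) v<u = <-irrefl refl (<-trans u<v v<u)
          not-above (inj₂ (u≡v , _)) v<u = <-irrefl (sym u≡v) v<u
      go (inB Bu) (inA Av) = B-A (S.level v ≟ᶠ 3F) (T.level u ≟ᶠ 3F)
        where
        Bu′ : T.A u′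
        Bu′ = same-B st Bu
        B-A : Dec (S.level v ≡ 3F) → Dec (T.level u ≡ 3F) → u′ ∼ v
        B-A (no ≢3)  _        = CS.vary-B-low Av ¬Sv Bu Bu′ bothS ≢3 uv
        B-A (yes _)  (no ≢3)  = flip (CT.vary-A-low Bu Bu′ ¬Tu ¬Tu′ bothT (A⇒R Av) ≢3 (flip uv))
        B-A (yes v3) (yes u3) = Equivalence.from (B-A-rank Bu′ Av)
          (subst₂ _<_ (rank-B₃ Bu′ (trans (sym (T.level-cong hitsT)) u3)) (rank-A₃ Av v3)
            (still-below comp (subst₂ _<_ (sym (rank-B₃ Bu u3)) (sym (rank-A₃ Av v3)) (Equivalence.to (B-A-rank Bu Av) uv))))
          where
          still-below : Compared u u′ v → rank u < rank v → rank u′ < rank v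
          still-below (inj₁ (_ , u′<v)) _   = u′<v
          still-below (inj₂ (u≡v , _))  u<v = contradiction u<v (<-irrefl u≡v)

  Special : Pred (V G) 0ℓ
  Special u = S.Contact u ⊎ T.Contact u

  special? : Decidable Special
  special? u = S.Contact? u ⊎-dec T.Contact? u

  special-same : ∀ {s} → Indistinct u v → Special s → SameAt s u v
  special-same (alike , _)     (inj₁ c) = S.alike-contact alike c
  special-same (_ , alike , _) (inj₂ c) = T.alike-contact alike c

  determined : ∀ {u u′ v} → u ≢ v → u′ ≢ v → Indistinct u u′ → Compared u u′ v → u ∼ v → u′ ∼ v
  determined {u} {u′} {v} _ _ ind comp uv = go (special? v) (special? u) (special? u′)
    where
    go : Dec (Special v) → Dec (Special u) → Dec (Special u′) → u′ ∼ v
    go (yes sv) _ _ = Equivalence.to (proj₂ (special-same ind sv)) uv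
    -- A special vertex is alone in its class, so `u` and `u′` coincide.
    go _ (yes su) _ = subst (_∼ v) (sym (Equivalence.to (proj₁ (special-same ind su)) refl)) uv
    go _ _ (yes su′) = subst (_∼ v) (Equivalence.from (proj₁ (special-same ind su′)) refl) uv
    go (no ¬sv) (no ¬su) (no ¬su′) = determined-regular ind (¬su ∘ inj₁) (¬su′ ∘ inj₁) (¬su ∘ inj₂) (¬su′ ∘ inj₂)
      (¬sv ∘ inj₁) (¬sv ∘ inj₂) (kind u) (kind v) comp uv

  square-constructible : Constructible (2 ^ 158 * 3) G
  square-constructible = constructible-by-bits G indistinct rank determined x₁

-- Graphs without induced C₄

module SquareFree (G : Graph) (2P₂⋢G : ¬ 2P₂ ⊑ G) (H⋢G : ¬ co-P₂+P₃ ⊑ G) (atom : Atom G)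
  (no-square : ¬ Structure.HasSquare G 2P₂⋢G H⋢G) where

  open Structure G 2P₂⋢G H⋢G

  private variable
    u v w : V G

  squareless : ∀ {x₁ x₂ x₃ x₄} → x₁ ∼ x₂ → x₂ ∼ x₃ → x₃ ∼ x₄ → x₄ ∼ x₁ → x₁ ≢ x₃ → x₂ ≢ x₄ → x₁ ≁ x₃ → x₂ ∼ x₄
  squareless e₁₂ e₂₃ e₃₄ e₄₁ d₁₃ d₂₄ n₁₃ = decidable-stable (_ ∼? _) λ n₂₄ → no-square (_ , _ , _ , _ , record
    { x₁₂ = e₁₂ ; x₂₃ = e₂₃ ; x₃₄ = e₃₄ ; x₄₁ = e₄₁ ; x₁≁x₃ = n₁₃ ; x₂≁x₄ = n₂₄ ; x₁≢x₃ = d₁₃ ; x₂≢x₄ = d₂₄ })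

  record Pentagon (c₁ c₂ c₃ c₄ c₅ : V G) : Set where
    field
      c₁₂   : c₁ ∼ c₂
      c₂₃   : c₂ ∼ c₃
      c₃₄   : c₃ ∼ c₄
      c₄₅   : c₄ ∼ c₅
      c₅₁   : c₅ ∼ c₁
      c₁≁c₃ : c₁ ≁ c₃
      c₂≁c₄ : c₂ ≁ c₄
      c₃≁c₅ : c₃ ≁ c₅
      c₄≁c₁ : c₄ ≁ c₁
      c₅≁c₂ : c₅ ≁ c₂

  turn : ∀ {c₁ c₂ c₃ c₄ c₅} → Pentagon c₁ c₂ c₃ c₄ c₅ → Pentagon c₂ c₃ c₄ c₅ c₁
  turn p = record
    { c₁₂ = c₂₃ ; c₂₃ = c₃₄ ; c₃₄ = c₄₅ ; c₄₅ = c₅₁ ; c₅₁ = c₁₂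
    ; c₁≁c₃ = c₂≁c₄ ; c₂≁c₄ = c₃≁c₅ ; c₃≁c₅ = c₄≁c₁ ; c₄≁c₁ = c₅≁c₂ ; c₅≁c₂ = c₁≁c₃
    }
    where
    open Pentagon p

  pentagon? : ∀ c₁ c₂ c₃ c₄ c₅ → Dec (Pentagon c₁ c₂ c₃ c₄ c₅)
  pentagon? c₁ c₂ c₃ c₄ c₅ = map′
    (λ (e₁ , e₂ , e₃ , e₄ , e₅ , n₁ , n₂ , n₃ , n₄ , n₅) → record
      { c₁₂ = e₁ ; c₂₃ = e₂ ; c₃₄ = e₃ ; c₄₅ = e₄ ; c₅₁ = e₅
      ; c₁≁c₃ = n₁ ; c₂≁c₄ = n₂ ; c₃≁c₅ = n₃ ; c₄≁c₁ = n₄ ; c₅≁c₂ = n₅ })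
    fields
    ((c₁ ∼? c₂) ×-dec (c₂ ∼? c₃) ×-dec (c₃ ∼? c₄) ×-dec (c₄ ∼? c₅) ×-dec (c₅ ∼? c₁) ×-dec
     ¬? (c₁ ∼? c₃) ×-dec ¬? (c₂ ∼? c₄) ×-dec ¬? (c₃ ∼? c₅) ×-dec ¬? (c₄ ∼? c₁) ×-dec ¬? (c₅ ∼? c₂))
    where
    fields : Pentagon c₁ c₂ c₃ c₄ c₅ → _
    fields p = c₁₂ , c₂₃ , c₃₄ , c₄₅ , c₅₁ , c₁≁c₃ , c₂≁c₄ , c₃≁c₅ , c₄≁c₁ , c₅≁c₂
      where
      open Pentagon p

  HasPentagon : Set
  HasPentagon = ∃[ c₁ ] ∃[ c₂ ] ∃[ c₃ ] ∃[ c₄ ] ∃[ c₅ ] Pentagon c₁ c₂ c₃ c₄ c₅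

  hasPentagon? : Dec HasPentagon
  hasPentagon? = any? λ c₁ → any? λ c₂ → any? λ c₃ → any? λ c₄ → any? λ c₅ → pentagon? c₁ c₂ c₃ c₄ c₅

  -- Suppose `u` misses `c₂`. Then it misses `c₃`, or there is a C₄; so it sees `c₄`, or `uc₁` and
  -- `c₃c₄` form a 2P₂; so it sees `c₅`, or there is a C₄ again; but now `uc₅` and `c₂c₃` form a
  -- 2P₂.
  spread : ∀ {c₁ c₂ c₃ c₄ c₅} → Pentagon c₁ c₂ c₃ c₄ c₅ → u ≢ c₂ → u ≢ c₅ → u ∼ c₁ → u ∼ c₂
  spread {u} {c₁} {c₂} {c₃} {c₄} {c₅} p u≢c₂ u≢c₅ u₁ = decidable-stable (u ∼? c₂) λ ¬u₂ → let
      ¬u₃ = λ (u₃ : u ∼ c₃) → c₁≁c₃ (squareless u₁ c₁₂ c₂₃ (flip u₃) u≢c₂ (separated c₅₁ (flip≁ c₃≁c₅)) ¬u₂)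
      u₄  = decidable-stable (u ∼? c₄) λ ¬u₄ → no-2P₂ u₁ c₃₄ ¬u₃ ¬u₄ c₁≁c₃ (flip≁ c₄≁c₁)
      u₅  = decidable-stable (u ∼? c₅) λ ¬u₅ →
        c₄≁c₁ (flip (squareless u₁ (flip c₅₁) (flip c₄₅) (flip u₄) u≢c₅ (≢-sym (separated c₃₄ (flip≁ c₁≁c₃))) ¬u₅))
    in no-2P₂ u₅ c₂₃ ¬u₂ ¬u₃ c₅≁c₂ (flip≁ c₃≁c₅)
    where
    open Pentagon p

  module _ {c₁ c₂ c₃ c₄ c₅ : V G} (p : Pentagon c₁ c₂ c₃ c₄ c₅) where

    open Pentagon p

    Outer : Pred (V G) 0ℓ
    Outer u = u ≢ c₁ × u ≢ c₂ × u ≢ c₃ × u ≢ c₄ × u ≢ c₅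

    Full : Pred (V G) 0ℓ
    Full u = u ∼ c₁ × u ∼ c₂ × u ∼ c₃ × u ∼ c₄ × u ∼ c₅

    full : Outer u → u ∼ c₁ → Full u
    full (d₁ , d₂ , d₃ , d₄ , d₅) u₁ = u₁ , u₂ , u₃ , u₄ , spread (turn (turn (turn p))) d₅ d₃ u₄
      where
      u₂ = spread p d₂ d₅ u₁
      u₃ = spread (turn p) d₃ d₁ u₂
      u₄ = spread (turn (turn p)) d₄ d₂ u₃

    untouched : Outer u → u ≁ c₁ → u ≁ c₂ × u ≁ c₃ × u ≁ c₄ × u ≁ c₅
    untouched {u} (d₁ , d₂ , d₃ , d₄ , d₅) ¬u₁ = ¬u₁ ∘ from₂ , ¬u₁ ∘ from₃ , ¬u₁ ∘ from₄ , ¬u₁ ∘ from₅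
      where
      from₅ : u ∼ c₅ → u ∼ c₁
      from₅ = spread (turn (turn (turn (turn p)))) d₁ d₄
      from₄ : u ∼ c₄ → u ∼ c₁
      from₄ = from₅ ∘ spread (turn (turn (turn p))) d₅ d₃
      from₃ : u ∼ c₃ → u ∼ c₁
      from₃ = from₄ ∘ spread (turn (turn p)) d₄ d₂
      from₂ : u ∼ c₂ → u ∼ c₁
      from₂ = from₃ ∘ spread (turn p) d₃ d₁

    full-adjacent : Full u → Full v → u ≢ v → u ∼ v
    full-adjacent (u₁ , _ , u₃ , _) (v₁ , _ , v₃ , _) u≢v = decidable-stable (_ ∼? _) λ ¬uv →
      c₁≁c₃ (squareless u₁ (flip v₁) v₃ (flip u₃) u≢v (separated c₅₁ (flip≁ c₃≁c₅)) ¬uv)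

    -- `w` is not on the pentagon, as `u` sees no corner; if it were untouched as well, `uw` and
    -- `c₁c₂` would form a 2P₂.
    untouched-neighbour : Outer u → u ≁ c₁ → u ∼ w → Full w
    untouched-neighbour {u} {w} Ou ¬u₁ uw = full Ow (decidable-stable (w ∼? c₁) λ ¬w₁ →
      no-2P₂ uw c₁₂ ¬u₁ ¬u₂ ¬w₁ (proj₁ (untouched Ow ¬w₁)))
      where
      ¬u₂ : u ≁ c₂
      ¬u₂ = proj₁ (untouched Ou ¬u₁)
      Ow : Outer w
      Ow = let (_ , ¬u₃ , ¬u₄ , ¬u₅) = untouched Ou ¬u₁ in
        separated uw ¬u₁ , separated uw ¬u₂ , separated uw ¬u₃ , separated uw ¬u₄ , separated uw ¬u₅

    -- The neighbours of an untouched vertex are full and hence form a clique, which an atom does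
    -- not allow.
    outer-full : Outer u → Full u
    outer-full {u} Ou = full Ou (decidable-stable (u ∼? c₁) λ ¬u₁ → let
        (q , r , uq , ur , q≢r , ¬qr) = atom-neighbourhood {G} atom (proj₁ Ou) ¬u₁
      in ¬qr (full-adjacent (untouched-neighbour Ou ¬u₁ uq) (untouched-neighbour Ou ¬u₁ ur) q≢r))

    Corner : Pred (V G) 0ℓ
    Corner s = (s ≡ c₁ ⊎ s ≡ c₂) ⊎ s ≡ c₃ ⊎ s ≡ c₄ ⊎ s ≡ c₅

    corner? : Decidable Corner
    corner? s = ((s ≟ᶠ c₁) ⊎-dec (s ≟ᶠ c₂)) ⊎-dec (s ≟ᶠ c₃) ⊎-dec (s ≟ᶠ c₄) ⊎-dec (s ≟ᶠ c₅)

    outer : ¬ Corner u → Outer u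
    outer ¬c = (λ e → ¬c (inj₁ (inj₁ e))) , (λ e → ¬c (inj₁ (inj₂ e))) , (λ e → ¬c (inj₂ (inj₁ e))) ,
      (λ e → ¬c (inj₂ (inj₂ (inj₁ e)))) , (λ e → ¬c (inj₂ (inj₂ (inj₂ e))))

    SameCorners : Rel (V G) 0ℓ
    SameCorners u v = (SameAt c₁ u v × SameAt c₂ u v) × SameAt c₃ u v × SameAt c₄ u v × SameAt c₅ u v

    same-corners : Bits 10 SameCorners
    same-corners = bits-× (bits-× (sameAt c₁) (sameAt c₂)) (bits-× (sameAt c₃) (bits-× (sameAt c₄) (sameAt c₅)))

    same-corner : ∀ {s} → SameCorners u v → Corner s → SameAt s u v
    same-corner ((s₁ , s₂) , s₃ , s₄ , s₅) = λ
      { (inj₁ (inj₁ refl)) → s₁ ; (inj₁ (inj₂ refl)) → s₂ ; (inj₂ (inj₁ refl)) → s₃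
      ; (inj₂ (inj₂ (inj₁ refl))) → s₄ ; (inj₂ (inj₂ (inj₂ refl))) → s₅ }

    pentagon-constructible : Constructible (2 ^ 10 * 3) G
    -- With a constant rank all comparisons are ties, and the classes alone decide.
    pentagon-constructible = constructible-by-bits G same-corners (λ _ → 0) determined c₁
      where
      determined : ∀ {u u′ v} → u ≢ v → u′ ≢ v → SameCorners u u′ → (0 < 0 × 0 < 0) ⊎ (0 ≡ 0 × 0 ≡ 0) → u ∼ v → u′ ∼ v
      determined {u} {u′} {v} _ u′≢v same _ uv with corner? v | corner? u | corner? u′
      ... | yes cv | _ | _ = Equivalence.to (proj₂ (same-corner same cv)) uv
      ... | no _ | yes cu | _ = subst (_∼ v) (sym (Equivalence.to (proj₁ (same-corner same cu)) refl)) uv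
      ... | no _ | no _ | yes cu′ = subst (_∼ v) (Equivalence.from (proj₁ (same-corner same cu′)) refl) uv
      ... | no ¬cv | no _ | no ¬cu′ = full-adjacent (outer-full (outer ¬cu′)) (outer-full (outer ¬cv)) u′≢v

  Closed : V G → Pred (V G) 0ℓ
  Closed v u = u ≡ v ⊎ v ∼ u

  closed? : ∀ v → Decidable (Closed v)
  closed? v u = (u ≟ᶠ v) ⊎-dec (v ∼? u)

  private-neighbour : count (closed? v) ≤ count (closed? u) → Closed v w → ¬ Closed u w →
                      ∃[ r ] Closed u r × ¬ Closed v r
  private-neighbour {v} {u} {w} v≤u vw ¬uw with any? (λ r → closed? u r ×-dec ¬? (closed? v r))
  ... | yes found = found
  ... | no none = contradiction v≤u (<⇒≱ (count-strict (closed? u) (closed? v)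
    (λ r ur → decidable-stable (closed? v r) λ ¬vr → none (r , ur , ¬vr)) w vw ¬uw))

  -- The neighbourhood of a vertex of least degree contains no non-adjacent p, q: these
  -- would have neighbours r, s outside it, closing a square or a pentagon.
  least-degree-simplicial : ¬ HasPentagon → ∀ {v p q} → (∀ u → count (closed? v) ≤ count (closed? u)) →
                            v ∼ p → v ∼ q → p ≢ q → p ∼ q
  least-degree-simplicial no-pentagon {v} {p} {q} least vp vq p≢q = decidable-stable (p ∼? q) λ ¬pq →
    let r , pr , ¬vr = outside ¬pq vp vq p≢q
        s , qs , ¬vs = outside (flip≁ ¬pq) vq vp (≢-sym p≢q)
        ¬qr = λ (qr : q ∼ r) → ¬pq (squareless vp pr (flip qr) (flip vq) (¬vr ∘ inj₁ ∘ sym) p≢q (¬vr ∘ inj₂))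
        ¬ps = λ (ps : p ∼ s) → ¬pq (squareless vp ps (flip qs) (flip vq) (¬vs ∘ inj₁ ∘ sym) p≢q (¬vs ∘ inj₂))
    in no-2P₂ pr qs ¬pq ¬ps (flip≁ ¬qr) λ rs → no-pentagon (v , p , r , s , q , record
      { c₁₂ = vp ; c₂₃ = pr ; c₃₄ = rs ; c₄₅ = flip qs ; c₅₁ = flip vq
      ; c₁≁c₃ = ¬vr ∘ inj₂ ; c₂≁c₄ = ¬ps ; c₃≁c₅ = flip≁ ¬qr ; c₄≁c₁ = flip≁ (¬vs ∘ inj₂) ; c₅≁c₂ = flip≁ ¬pq })
    where
    outside : ∀ {p q} → p ≁ q → v ∼ p → v ∼ q → p ≢ q → ∃[ r ] p ∼ r × ¬ Closed v r
    outside {p} {q} ¬pq vp vq p≢q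
      with private-neighbour (least p) (inj₂ vq) [ ≢-sym p≢q , ¬pq ]′
    ... | r , inj₁ refl , ¬vr = contradiction (inj₂ vp) ¬vr
    ... | r , inj₂ pr   , ¬vr = r , pr , ¬vr

  -- If a vertex of least degree is adjacent to all others, so is every vertex. If not, its
  -- neighbourhood is a clique by `least-degree-simplicial`, but not by `atom-neighbourhood`.
  complete : ¬ HasPentagon → ∀ {u z} → u ≢ z → u ∼ z
  complete no-pentagon {u} {z} u≢z = decidable-stable (u ∼? z) λ ¬uz → refute ¬uz (argmin (count ∘ closed?) u)
    where
    refute : u ≁ z → ∃[ v ] (∀ u → count (closed? v) ≤ count (closed? u)) → ⊥
    refute ¬uz (v , least) with any? (λ w → ¬? (closed? v w))
    ... | no full = <⇒≱ (count-strict (closed? u) (closed? v) (λ w _ → decidable-stable (closed? v w) λ ¬vw → full (w , ¬vw))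
      z (decidable-stable (closed? v z) λ ¬vz → full (z , ¬vz)) [ ≢-sym u≢z , ¬uz ]′) (least u)
    ... | yes (w , ¬vw) with atom-neighbourhood {G} atom (¬vw ∘ inj₁ ∘ sym) (¬vw ∘ inj₂)
    ...   | p , q , vp , vq , p≢q , ¬pq = ¬pq (least-degree-simplicial no-pentagon least vp vq p≢q)

  complete-constructible : ¬ HasPentagon → V G → Constructible (2 ^ 0 * 3) G
  complete-constructible no-pentagon = constructible-by-bits G {0} {λ _ _ → ⊤} ((λ _ ()) , λ _ → tt) (λ _ → 0)
    λ _ u′≢v _ _ _ → complete no-pentagon u′≢v

-- Bounds for all atoms and for the split graphs

root : ∀ {k} (e : Expr k) → V ⟦ e ⟧
root (vertex i)       = zero
root (union e f)      = root e ↑ˡ order ⟦ f ⟧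
root (join i j i≢j e) = root e
root (relabel i j e)  = root e

≤-sum : ∀ {k} a b c → k ≤ a ⊎ k ≤ b ⊎ k ≤ c → k ≤ a + (b + c)
≤-sum a b c (inj₁ k≤a)        = ≤-trans k≤a (m≤m+n a (b + c))
≤-sum a b c (inj₂ (inj₁ k≤b)) = ≤-trans k≤b (≤-trans (m≤m+n b c) (m≤n+m (b + c) a))
≤-sum a b c (inj₂ (inj₂ k≤c)) = ≤-trans k≤c (≤-trans (m≤n+m c b) (m≤n+m (b + c) a))

atom-width : ∀ {G} → (Free (2 · P 2 ∷ complement (P 2 ⊕ P 3) ∷ []) ∩ Atom) G → ∀ {k} → CliqueWidth G k →
             k ≤ 2 ^ 158 * 3 ⊎ k ≤ 2 ^ 10 * 3 ⊎ k ≤ 2 ^ 0 * 3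
atom-width {G} (2P₂⋢G ∷ H⋢G ∷ [] , atom) {k} ((e , f , _) , least) = square (Structure.hasSquare? G 2P₂⋢G H⋢G)
  where
  square : Dec (Structure.HasSquare G 2P₂⋢G H⋢G) → k ≤ 2 ^ 158 * 3 ⊎ k ≤ 2 ^ 10 * 3 ⊎ k ≤ 2 ^ 0 * 3
  square (yes (_ , _ , _ , _ , sq)) = inj₁ (least (SquareBound.square-constructible G 2P₂⋢G H⋢G atom sq))
  square (no no-square) = inj₂ (pentagon (SquareFree.hasPentagon? G 2P₂⋢G H⋢G atom no-square))
    where
    pentagon : Dec (SquareFree.HasPentagon G 2P₂⋢G H⋢G atom no-square) → k ≤ 2 ^ 10 * 3 ⊎ k ≤ 2 ^ 0 * 3
    pentagon (yes (_ , _ , _ , _ , _ , p)) =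
      inj₁ (least (SquareFree.pentagon-constructible G 2P₂⋢G H⋢G atom no-square p))
    pentagon (no no-pentagon) = inj₂ (least
      (SquareFree.complete-constructible G 2P₂⋢G H⋢G atom no-square no-pentagon (Inverse.to f (root e))))

atoms-bounded : BoundedCliqueWidth (Free (2 · P 2 ∷ complement (P 2 ⊕ P 3) ∷ []) ∩ Atom)
atoms-bounded = 2 ^ 158 * 3 + (2 ^ 10 * 3 + 2 ^ 0 * 3) , λ {G} free,atom cw →
  ≤-sum (2 ^ 158 * 3) (2 ^ 10 * 3) (2 ^ 0 * 3) (atom-width {G} free,atom cw)

constructible : ∀ G → V G → Constructible (order G * 3) G
constructible G = constructible-by-classes G id (λ _ → 0) λ { _ _ refl _ uv → uv }

-- By induction, no number `k` of labels suffices: if no smaller one does, `k` would be the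
-- clique-width, hence at most `c`, and `N` is large enough for `split-not-constructible`. This
-- contradicts the trivial bound of `constructible`.
split-graphs-unbounded : ¬ BoundedCliqueWidth (Free (2 · P 2 ∷ complement (P 2 ⊕ P 3) ∷ []))
split-graphs-unbounded (c , bound) = none (order G * 3) (constructible G zero)
  where
  N = suc c + (c + c)
  G = SplitGraph.split N
  free : Free (2 · P 2 ∷ complement (P 2 ⊕ P 3) ∷ []) G
  free = SplitGraph.2P₂-free N ∷ SplitGraph.co-P₂+P₃-free N ∷ []
  none-below : ∀ k {j} → j < k → ¬ Constructible j G
  none : ∀ k → ¬ Constructible k G
  none-below (suc k) {j} j<k = [ none-below k , (λ { refl → none′ }) ]′ (m≤n⇒m<n∨m≡n (s≤s⁻¹ j<k))
    where
    none′ : ¬ Constructible k G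
    none′ con = split-not-constructible {k} {N} (+-mono-≤ (s≤s k≤c) (+-mono-≤ k≤c k≤c)) con
      where
      k≤c : k ≤ c
      k≤c = bound {G} free (con , λ {i} con′ → ≮⇒≥ λ i<k → none-below k i<k con′)
  none k = none-below (suc k) ≤-refl

theorem2 : BoundedCliqueWidth (Free (2 · P 2 ∷ complement (P 2 ⊕ P 3) ∷ []) ∩ Atom)
    × ¬ BoundedCliqueWidth (Free (2 · P 2 ∷ complement (P 2 ⊕ P 3) ∷ []))
theorem2 = atoms-bounded , split-graphs-unbounded
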